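{- Let $G$ be a finite simple planar graph that contains no cycle of length $4$ and no cycle of length $5$ (as subgraphs). Then $V(G)$ can be partitioned into two (possibly empty) sets $V_1$ and $V_2$ such that the induced subgraph $G[V_1]$ is a forest with maximum degree at most $3$ and the induced subgraph $G[V_2]$ is a forest with maximum degree at most $4$.
   Context: All graphs are finite and simple. "Without $4$-cycles and $5$-cycles" means that the graph has no subgraph (not necessarily induced) isomorphic to a cycle of length $4$ or to a cycle of length $5$. Such a partition $(V_1,V_2)$ is called an $(\mathcal{F}_3,\mathcal{F}_4)$-partition, where $\mathcal{F}_d$ denotes the class of forests with maximum degree at most $d$. -}

module Defs where

open import Data.Bool.Base using (Bool; T)
open import Data.Fin.Base using (Fin; toℕ)
open import Data.Fin.Subset using (Subset; _∈_)
open import Data.Nat.Base using (ℕ; suc; _+_; _*_; _≤_)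
open import Data.Nat.DivMod using (_mod_)
open import Data.Product.Base using (∃; ∃-syntax; _×_; proj₁)
open import Function.Bundles using (Bijection; _⤖_; _↔_; Inverse)
open import Function.Definitions using (Injective)
open import Level using (0ℓ; Level; _⊔_)
open import Relation.Binary.Bundles using (Setoid)
open import Relation.Binary.Construct.Closure.ReflexiveTransitive using (Star)
import Relation.Binary.Construct.Closure.Equivalence as Eq
import Relation.Binary.Construct.On as On
open import Relation.Binary.Core using (Rel)
open import Relation.Binary.PropositionalEquality.Core using (_≡_)
open import Relation.Binary.PropositionalEquality.Properties using (setoid)
open import Relation.Nullary.Negation.Core using (¬_)

-- Simple graphs.  Adjacency is Bool-valued so that being an edge is a
-- decidable proposition with at most one proof.

record Graph (V : Set) : Set where
  field
    adj        : V → V → Bool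
    adj-sym    : ∀ {u v} → T (adj u v) → T (adj v u)
    adj-irrefl : ∀ {v} → ¬ T (adj v v)

  _~_ : Rel V 0ℓ
  u ~ v = T (adj u v)

  Neighbour : V → Set
  Neighbour v = ∃[ w ] v ~ w

induced : ∀ {n} → Graph (Fin n) → (S : Subset n) → Graph (∃ (_∈ S))
induced G S = record
  { adj        = λ u v → adj (proj₁ u) (proj₁ v)
  ; adj-sym    = adj-sym
  ; adj-irrefl = adj-irrefl
  }
  where open Graph G

-- The cyclic successor i ↦ i + 1 modulo ℓ.

next : ∀ {ℓ} → Fin ℓ → Fin ℓ
next {suc m} i = suc (toℕ i) mod suc m

-- A (not necessarily induced) copy of the cycle of length ℓ.

record Cycle {V : Set} (G : Graph V) (ℓ : ℕ) : Set where
  open Graph G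
  field
    3≤ℓ       : 3 ≤ ℓ
    vertex    : Fin ℓ → V
    injective : Injective _≡_ _≡_ vertex
    adjacent  : ∀ i → vertex i ~ vertex (next i)

Forest : {V : Set} → Graph V → Set
Forest G = ∀ ℓ → ¬ Cycle G ℓ

MaxDegree≤ : {V : Set} → ℕ → Graph V → Set
MaxDegree≤ d G = ∀ v → ∃[ k ] (Graph.Neighbour G v ⤖ Fin k) × k ≤ d

-- The class 𝓕_d of forests with maximum degree at most d.

𝓕 : {V : Set} → ℕ → Graph V → Set
𝓕 d G = Forest G × MaxDegree≤ d G

-- The setoid has exactly k equivalence classes.

HasClasses : {a ℓ : Level} → Setoid a ℓ → ℕ → Set (a ⊔ ℓ)
HasClasses S k = Bijection S (setoid (Fin k))

-- Planarity, via combinatorial embeddings (rotation systems) of genus 0.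

module _ {V : Set} (G : Graph V) where
  open Graph G

  -- An edge together with one of its two orientations.

  record Dart : Set where
    constructor dart
    field
      src tgt : V
      edge    : src ~ tgt

  open Dart

  reverse : Dart → Dart
  reverse (dart u v e) = dart v u (adj-sym e)

  -- A cyclic order of the darts leaving each vertex.

  record Rotation : Set where
    field
      rot        : Dart ↔ Dart
      rot-src    : ∀ d → src (Inverse.to rot d) ≡ src d
      rot-cyclic : ∀ d d′ → src d ≡ src d′ →
                   Star (λ x y → Inverse.to rot x ≡ y) d d′

    -- The dart following d on the boundary of the face beside d.

    faceStep : Dart → Dart
    faceStep d = Inverse.to rot (reverse d)

  Isolated : V → Set
  Isolated v = ∀ w → ¬ v ~ w

  vertexSetoid isolatedSetoid edgeSetoid componentSetoid : Setoid 0ℓ 0ℓ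
  vertexSetoid    = setoid V
  isolatedSetoid  = On.setoid {B = ∃ Isolated} (setoid V) proj₁
  edgeSetoid      = Eq.setoid (λ d d′ → reverse d ≡ d′)
  componentSetoid = Eq.setoid _~_

  -- Since faceStep is a permutation, the classes below are its orbits.

  faceSetoid : Rotation → Setoid 0ℓ 0ℓ
  faceSetoid R = Eq.setoid (λ d d′ → Rotation.faceStep R d ≡ d′)

  -- Each component is embedded in a closed orientable surface of its own,
  -- and V − E + F is summed over these surfaces.  An isolated vertex has no
  -- darts but lies on a sphere with one face, which is why #isolated is
  -- added to the number of orbits.  Each component contributes 2 minus twice
  -- its genus, so the total is twice the number of components exactly when
  -- every surface is a sphere.

  record Planar : Set where
    field
      rotation    : Rotation
      #vertices   : ℕ
      #edges      : ℕ
      #orbits     : ℕ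
      #isolated   : ℕ
      #components : ℕ
      vertices    : HasClasses vertexSetoid #vertices
      edges       : HasClasses edgeSetoid #edges
      orbits      : HasClasses (faceSetoid rotation) #orbits
      isolated    : HasClasses isolatedSetoid #isolated
      components  : HasClasses componentSetoid #components
      euler       : #vertices + (#orbits + #isolated) ≡ #edges + 2 * #components

{-# OPTIONS --safe #-}
-- Induction on the number of vertices, with discharging.  Without 4-cycles an
-- edge lies in at most one triangle, so the neighbourhood of v splits into m(v)
-- blocks, which are single vertices or adjacent pairs.  Call v large if
-- m(v) ≥ 5, mid if m(v) = 4 and either deg v ≥ 6 or v lies in a triangle with a
-- large vertex, and a killer in both cases.  An uncoloured vertex whose only
-- neighbour y of colour c is no killer (for the cap 3), or not large (for the
-- cap 4), can take the colour c: each block of y contains at most one neighbour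
-- of colour c, so y is not saturated, or else m(y) = 4 and y can be flipped to
-- the other colour.  Hence in a minimal counterexample the 2-vertices have only
-- killer neighbours and a 3-vertex has at least one.
--
-- When the triangular 2-vertices are left out, a graph H of minimum degree 2
-- remains, all of whose faces have length 3 or at least 6.  Euler's formula then
-- bounds the sum of 4 − [vw in a triangle of H] over the ordered adjacent pairs
-- (v , w) of H by less than 12|H|.  Killers pay their neighbours of degree 2 and
-- their triangular neighbours of degree 3; after this each vertex has at least
-- 12, unless it can be recoloured together with its blocks.
--
-- Euler's inequality passes to subgraphs by deleting edges one at a time, where
-- faces and components are counted as the classes of the equivalence generated
-- by a finite list of pairs.
module Submission where

open import Defs
open import Data.Bool.Base using (Bool; true; false; T; _∧_; _∨_; not; if_then_else_)
open import Data.Bool.Properties using (T?; T-∧; T-irrelevant)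
open import Data.Empty using (⊥-elim) renaming (⊥ to Empty)
open import Data.Fin.Base using (Fin; zero; suc; toℕ; combine; remQuot; punchIn; punchOut; _↑ˡ_; _↑ʳ_; splitAt; fromℕ; inject₁; fromℕ<)
open import Data.Fin.Properties using (_≟_; any?; toℕ-injective; injective⇒≤; <-cmp; pigeonhole; punchOut-cong; punchOut-punchIn; punchInᵢ≢i; punchOut-injective; remQuot-combine; combine-remQuot; splitAt⁻¹-↑ˡ; splitAt⁻¹-↑ʳ; toℕ<n; toℕ-fromℕ<; toℕ-fromℕ; toℕ-inject₁; ↑ʳ-injective)
open import Data.Fin.Subset using (Subset; _∪_; _∩_; ⊤; ⊥; _∈_; ∁)
open import Data.Fin.Subset.Properties using (_∈?_; ∪-inverseʳ; ∩-inverseʳ; x∈∁p⇒x∉p)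
open import Data.List.Base using (List; []; _∷_; _++_; length)
open import Data.List.Properties using (length-++)
open import Data.List.Relation.Binary.Permutation.Propositional using (_↭_; prep; swap; ↭-refl; ↭-trans; ↭-sym)
open import Data.List.Relation.Binary.Permutation.Propositional.Properties using (↭-length; shift)
open import Data.List.Relation.Unary.All as All using (All; []; _∷_)
open import Data.List.Relation.Unary.AllPairs as AllPairs using (AllPairs; []; _∷_)
open import Data.List.Relation.Unary.Any as Any using (Any; here; there)
open import Data.Maybe.Base using (Maybe; just; nothing)
open import Data.Maybe.Properties using (just-injective)
open import Data.Nat.Base using (ℕ; zero; suc; _+_; _*_; _∸_; _≤_; _<_; z≤n; s≤s; _≤ᵇ_; _<ᵇ_)
open import Data.Nat.DivMod using (_%_; n%n≡0; m<n⇒m%n≡m)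
open import Data.Nat.Properties hiding (<-cmp) renaming (_≟_ to _≟ᴺ_)
open import Data.Nat.Tactic.RingSolver using (solve-∀)
open import Data.Product.Base using (Σ; ∃; ∃₂; _×_; _,_; proj₁; proj₂)
open import Data.Sum.Base using (_⊎_; inj₁; inj₂; [_,_]′) renaming (swap to ⊎-swap)
open import Data.Unit.Base using (tt) renaming (⊤ to Unit)
open import Data.Vec.Base using ([]; _∷_; lookup; tabulate)
open import Data.Vec.Properties using ([]=⇒lookup; lookup⇒[]=; lookup∘tabulate)
open import Data.Vec.Properties.WithK using ([]=-irrelevant)
open import Data.Vec.Relation.Unary.All using ([]; _∷_)
open import Data.Vec.Relation.Unary.AllPairs using ([]; _∷_)
import Data.Vec.Relation.Unary.Unique.Propositional.Properties as Uniqueᵛ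
open import Function.Base using (_∘_; case_of_; id)
open import Function.Bundles using (Equivalence; Inverse; Bijection; mk⤖)
open import Level using (0ℓ)
import Relation.Binary.Construct.Closure.Equivalence as Closure
open import Relation.Binary.Bundles using (Setoid)
open import Relation.Binary.Structures using (IsEquivalence)
open import Relation.Binary.Construct.Closure.ReflexiveTransitive using (Star; ε; _◅_)
open import Relation.Binary.Definitions using (tri<; tri≈; tri>)
open import Relation.Binary.PropositionalEquality
open import Relation.Nullary.Decidable.Core using (Dec; yes; no; does; ⌊_⌋; toWitness; fromWitness; _×-dec_; _⊎-dec_; ¬?)
open import Relation.Nullary.Negation.Core using (¬_; contradiction)

-- Every recolouring attaches a vertex with at most one neighbour of its new colour, so acyclicity
-- is never at stake and only the caps are. The threshold 5 for large is the cap of ● plus one spare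
-- block. Flips go only from ○ to ●, the colour with the larger cap, hence the difference between
-- mid and large. The obstacle is a killer among blocks that cost it much: it has to be recoloured
-- together with them. The absence of 4- and 5-cycles makes its blocks independent, as filling one
-- of them changes neither the other blocks nor the colours on which their filling depends. The
-- constant 12 comes from six times Euler's inequality: a face of length at least 6 collects 2 from
-- each of its darts, a triangle 4. A triangular 2-vertex would have only 6 of its 12 units. It is
-- left out instead; its neighbours lose an edge, but the edge between them then lies in no triangle
-- of H and counts 4 instead of 3.

+-interchange : ∀ p q r s → p + q + (r + s) ≡ p + r + (q + s)
+-interchange = solve-∀

-- Finite sums and Boolean indicators.

sum : ∀ {n} → (Fin n → ℕ) → ℕ
sum {zero}  f = 0
sum {suc n} f = f zero + sum (f ∘ suc)

sum-cong : ∀ {n} {f g : Fin n → ℕ} → (∀ i → f i ≡ g i) → sum f ≡ sum g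
sum-cong {zero}  f≡g = refl
sum-cong {suc n} f≡g = cong₂ _+_ (f≡g zero) (sum-cong (f≡g ∘ suc))

sum-+ : ∀ {n} (f g : Fin n → ℕ) → sum (λ i → f i + g i) ≡ sum f + sum g
sum-+ {zero}  f g = refl
sum-+ {suc n} f g = begin
  f zero + g zero + sum (λ i → f (suc i) + g (suc i)) ≡⟨ cong (f zero + g zero +_) (sum-+ (f ∘ suc) (g ∘ suc)) ⟩
  f zero + g zero + (sum (f ∘ suc) + sum (g ∘ suc))   ≡⟨ +-interchange (f zero) (g zero) _ _ ⟩
  sum f + sum g                                       ∎
  where open ≡-Reasoning

sum-swap : ∀ {m n} (f : Fin m → Fin n → ℕ) → sum (λ i → sum (f i)) ≡ sum (λ j → sum (λ i → f i j))
sum-swap {zero}  {n} f = sym (sum-const-0 n)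
  where
  sum-const-0 : ∀ n → sum {n} (λ _ → 0) ≡ 0
  sum-const-0 zero    = refl
  sum-const-0 (suc n) = sum-const-0 n
sum-swap {suc m} {n} f =
  trans (cong (sum (f zero) +_) (sum-swap (f ∘ suc))) (sym (sum-+ (f zero) (λ j → sum (λ i → f (suc i) j))))

infixr 7 _·_
_·_ : Bool → ℕ → ℕ
true  · k = k
false · k = 0

_==_ : ∀ {n} → Fin n → Fin n → Bool
i == j = does (i ≟ j)

==-refl : ∀ {n} (i : Fin n) → (i == i) ≡ true
==-refl i with i ≟ i
... | yes _  = refl
... | no i≢i = contradiction refl i≢i

≢⇒== : ∀ {n} {i j : Fin n} → i ≢ j → (i == j) ≡ false
≢⇒== {i = i} {j} i≢j with i ≟ j
... | yes i≡j = contradiction i≡j i≢j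
... | no _    = refl

·-distrib-+ : ∀ b k l → b · (k + l) ≡ b · k + b · l
·-distrib-+ true  k l = refl
·-distrib-+ false k l = refl

·-0 : ∀ b → b · 0 ≡ 0
·-0 true  = refl
·-0 false = refl

·-mono′ : ∀ b {k l} → (T b → k ≤ l) → b · k ≤ b · l
·-mono′ true  k≤l = k≤l tt
·-mono′ false k≤l = z≤n

T⇒≡true : ∀ {b} → T b → b ≡ true
T⇒≡true {true} _ = refl

¬T⇒≡false : ∀ {b} → ¬ T b → b ≡ false
¬T⇒≡false {true}  ¬t = contradiction tt ¬t
¬T⇒≡false {false} _  = refl

T-≡ : ∀ {b c} → (T b → T c) → (T c → T b) → b ≡ c
T-≡ {true}  {true}  _ _ = refl
T-≡ {true}  {false} f _ = ⊥-elim (f tt)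
T-≡ {false} {true}  _ g = ⊥-elim (g tt)
T-≡ {false} {false} _ _ = refl

∧-intro : ∀ {a b} → T a → T b → T (a ∧ b)
∧-intro ta tb = Equivalence.from T-∧ (ta , tb)

∧-elim : ∀ {a b} → T (a ∧ b) → T a × T b
∧-elim = Equivalence.to T-∧

sum-mono : ∀ {n} {f g : Fin n → ℕ} → (∀ i → f i ≤ g i) → sum f ≤ sum g
sum-mono {zero}  f≤g = z≤n
sum-mono {suc n} f≤g = +-mono-≤ (f≤g zero) (sum-mono (f≤g ∘ suc))

sum-0 : ∀ {n} (f : Fin n → ℕ) → (∀ i → f i ≡ 0) → sum f ≡ 0
sum-0 {zero}  f f≡0 = refl
sum-0 {suc n} f f≡0 = cong₂ _+_ (f≡0 zero) (sum-0 (f ∘ suc) (f≡0 ∘ suc))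

sum-δ : ∀ {n} (j : Fin n) (f : Fin n → ℕ) → sum (λ i → (i == j) · f i) ≡ f j
sum-δ {suc n} zero f =
  trans (cong (f zero +_) (sum-0 {n} _ λ _ → refl)) (+-identityʳ _)
sum-δ {suc n} (suc j) f =
  trans (sum-cong (λ i → cong (_· f (suc i)) (suc-== i))) (sum-δ j (f ∘ suc))
  where
  suc-== : ∀ i → (suc i == suc j) ≡ (i == j)
  suc-== i with i ≟ j
  ... | yes _ = refl
  ... | no _  = refl

term≤sum : ∀ {n} (f : Fin n → ℕ) j → f j ≤ sum f
term≤sum f j = subst (_≤ sum f) (sum-δ j f) (sum-mono ≤f)
  where
  ≤f : ∀ i → (i == j) · f i ≤ f i
  ≤f i with i ≟ j
  ... | yes _ = ≤-refl
  ... | no _  = z≤n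

two-terms≤sum : ∀ {n} (f : Fin n → ℕ) {i j} → i ≢ j → f i + f j ≤ sum f
two-terms≤sum f {i} {j} i≢j = begin
  f i + f j                                             ≡⟨ cong₂ _+_ (sum-δ i f) (sum-δ j f) ⟨
  sum (λ k → (k == i) · f k) + sum (λ k → (k == j) · f k) ≡⟨ sum-+ (λ k → (k == i) · f k) (λ k → (k == j) · f k) ⟨
  sum (λ k → (k == i) · f k + (k == j) · f k)           ≤⟨ sum-mono ≤f ⟩
  sum f                                                 ∎
  where
  open ≤-Reasoning
  ≤f : ∀ k → (k == i) · f k + (k == j) · f k ≤ f k
  ≤f k with k ≟ i | k ≟ j
  ... | yes refl | yes refl = contradiction refl i≢j
  ... | yes refl | no _     = ≤-reflexive (+-identityʳ _)
  ... | no _     | yes refl = ≤-refl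
  ... | no _     | no _     = z≤n

sum-const : ∀ n k → sum {n} (λ _ → k) ≡ n * k
sum-const zero    k = refl
sum-const (suc n) k = cong (k +_) (sum-const n k)

-- Sums over lists.

module _ {A : Set} where

  ∑ᴸ : (A → ℕ) → List A → ℕ
  ∑ᴸ f []       = 0
  ∑ᴸ f (x ∷ xs) = f x + ∑ᴸ f xs

  ∑ᴸ-++ : ∀ f xs ys → ∑ᴸ f (xs ++ ys) ≡ ∑ᴸ f xs + ∑ᴸ f ys
  ∑ᴸ-++ f []       ys = refl
  ∑ᴸ-++ f (x ∷ xs) ys = trans (cong (f x +_) (∑ᴸ-++ f xs ys)) (sym (+-assoc (f x) _ _))

  ∑ᴸ-↭ : ∀ f {xs ys} → xs ↭ ys → ∑ᴸ f xs ≡ ∑ᴸ f ys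
  ∑ᴸ-↭ f _↭_.refl           = refl
  ∑ᴸ-↭ f (prep x p)         = cong (f x +_) (∑ᴸ-↭ f p)
  ∑ᴸ-↭ f (swap {xs} {ys} x y p) = begin
    f x + (f y + ∑ᴸ f xs) ≡⟨ cong (λ k → f x + (f y + k)) (∑ᴸ-↭ f p) ⟩
    f x + (f y + ∑ᴸ f ys) ≡⟨ +-assoc (f x) _ _ ⟨
    f x + f y + ∑ᴸ f ys   ≡⟨ cong (_+ ∑ᴸ f ys) (+-comm (f x) (f y)) ⟩
    f y + f x + ∑ᴸ f ys   ≡⟨ +-assoc (f y) _ _ ⟩
    f y + (f x + ∑ᴸ f ys) ∎
    where open ≡-Reasoning
  ∑ᴸ-↭ f (_↭_.trans p q)    = trans (∑ᴸ-↭ f p) (∑ᴸ-↭ f q)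

  ∑ᴸ-≤ : ∀ (f g : A → ℕ) {xs} → All (λ x → f x ≤ g x) xs → ∑ᴸ f xs ≤ ∑ᴸ g xs
  ∑ᴸ-≤ f g []       = z≤n
  ∑ᴸ-≤ f g (p ∷ ps) = +-mono-≤ p (∑ᴸ-≤ f g ps)

  ∑ᴸ-const : ∀ k xs → ∑ᴸ (λ _ → k) xs ≡ length xs * k
  ∑ᴸ-const k []       = refl
  ∑ᴸ-const k (_ ∷ xs) = cong (k +_) (∑ᴸ-const k xs)

  collect : ∀ {n} → (Fin n → List A) → List A
  collect {zero}  F = []
  collect {suc n} F = F zero ++ collect (F ∘ suc)

  ∑ᴸ-collect : ∀ {n} f (F : Fin n → List A) → ∑ᴸ f (collect F) ≡ sum (∑ᴸ f ∘ F)
  ∑ᴸ-collect {zero}  f F = refl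
  ∑ᴸ-collect {suc n} f F = trans (∑ᴸ-++ f (F zero) _) (cong (∑ᴸ f (F zero) +_) (∑ᴸ-collect f (F ∘ suc)))

  All-++ : ∀ {P : A → Set} {xs ys} → All P xs → All P ys → All P (xs ++ ys)
  All-++ []       qs = qs
  All-++ (p ∷ ps) qs = p ∷ All-++ ps qs

  All-collect : ∀ {n} {P : A → Set} (F : Fin n → List A) → (∀ i → All P (F i)) → All P (collect F)
  All-collect {zero}  F ps = []
  All-collect {suc n} F ps = All-++ (ps zero) (All-collect (F ∘ suc) (ps ∘ suc))

  All-↭ : ∀ {P : A → Set} {xs ys} → xs ↭ ys → All P xs → All P ys
  All-↭ _↭_.refl        ps           = ps
  All-↭ (prep x p)      (q ∷ qs)     = q ∷ All-↭ p qs
  All-↭ (swap x y p)    (q ∷ r ∷ qs) = r ∷ q ∷ All-↭ p qs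
  All-↭ (_↭_.trans p q) ps           = All-↭ q (All-↭ p ps)

when : ∀ {A : Set} → Bool → A → List A
when true  x = x ∷ []
when false x = []

∑ᴸ-when : ∀ {A : Set} (f : A → ℕ) b x → ∑ᴸ f (when b x) ≡ b · f x
∑ᴸ-when f true  x = +-identityʳ _
∑ᴸ-when f false x = refl

All-when : ∀ {A : Set} {P : A → Set} b x → (T b → P x) → All P (when b x)
All-when true  x p = p tt ∷ []
All-when false x p = []

-- Graphs without 4- and 5-cycles, and the blocks of a vertex.

record C45Free (n : ℕ) : Set where
  field
    a     : Fin n → Fin n → Bool

  infix 4 _~_
  _~_ : Fin n → Fin n → Set
  u ~ v = T (a u v)

  field
    ~-sym : ∀ {u v} → u ~ v → v ~ u
    ~-irr : ∀ {v} → ¬ v ~ v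
    noC4  : ∀ {p q r s} → p ~ q → q ~ r → r ~ s → s ~ p → p ≢ r → q ≢ s → Empty
    noC5  : ∀ {p q r s t} → p ~ q → q ~ r → r ~ s → s ~ t → t ~ p →
            p ≢ r → p ≢ s → q ≢ s → q ≢ t → r ≢ t → Empty

-- The neighbours of a vertex, grouped: an edge lies in at most one triangle, so
-- every neighbour is either on its own or has a unique partner.

data Block (n : ℕ) : Set where
  one : Fin n → Block n
  two : Fin n → Fin n → Block n

_∈ᵇ_ : ∀ {n} → Fin n → Block n → Set
u ∈ᵇ one w   = u ≡ w
u ∈ᵇ two w z = u ≡ w ⊎ u ≡ z

weigh : ∀ {n} → (Fin n → ℕ) → Block n → ℕ
weigh f (one w)   = f w
weigh f (two w z) = f w + f z

module Blocks {n : ℕ} (g : C45Free n) where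
  open C45Free g public

  ~⇒≢ : ∀ {u v} → u ~ v → u ≢ v
  ~⇒≢ u~v refl = ~-irr u~v

  third-unique : ∀ {v w z z′} → v ~ w → v ~ z → w ~ z → v ~ z′ → w ~ z′ → z ≡ z′
  third-unique {v} {w} {z} {z′} v~w v~z w~z v~z′ w~z′ with z ≟ z′
  ... | yes z≡z′ = z≡z′
  ... | no z≢z′  = ⊥-elim (noC4 v~z (~-sym w~z) w~z′ (~-sym v~z′) (~⇒≢ v~w) z≢z′)

  Tr : Fin n → Fin n → Set
  Tr v w = ∃ λ z → T (a v z ∧ a w z)

  abstract
    tr? : ∀ v w → Dec (Tr v w)
    tr? v w = any? λ z → T? (a v z ∧ a w z)

  tr : Fin n → Fin n → Bool
  tr v w = ⌊ tr? v w ⌋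

  triple : Fin n → Fin n → Fin n → Bool
  triple v w z = a v w ∧ (a v z ∧ a w z)

  common : ∀ v w z → T (a v z ∧ a w z) → v ~ z × w ~ z
  common v w z = ∧-elim {a v z} {a w z}

  triple-elim : ∀ v w z → T (triple v w z) → v ~ w × v ~ z × w ~ z
  triple-elim v w z t = proj₁ t′ , common v w z (proj₂ t′)
    where t′ = ∧-elim {a v w} {a v z ∧ a w z} t

  triple-swap : ∀ v w z → triple v w z ≡ triple v z w
  triple-swap v w z = T-≡ (go w z) (go z w)
    where
    go : ∀ w z → T (triple v w z) → T (triple v z w)
    go w z t = case triple-elim v w z t of λ where
      (vw , vz , wz) → ∧-intro {a v z} vz (∧-intro {a v w} vw (~-sym wz))

  sgl : Fin n → Fin n → List (Block n)
  sgl v w = when (a v w ∧ not (tr v w)) (one w)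

  dbl : Fin n → Fin n → Fin n → List (Block n)
  dbl v w z = when (triple v w z ∧ (toℕ w <ᵇ toℕ z)) (two w z)

  blocks : Fin n → List (Block n)
  blocks v = collect (sgl v) ++ collect (λ w → collect (dbl v w))

  sumₐ : Fin n → (Fin n → ℕ) → ℕ
  sumₐ v f = sum λ w → a v w · f w

  -- The third vertex of a triangle on an edge is unique, so the sum over `z` has at most one
  -- non-zero term and merely detects whether there is a triangle.
  sum-triple : ∀ v w k → sum (λ z → triple v w z · k) ≡ (a v w ∧ tr v w) · k
  sum-triple v w k with T? (a v w)
  ... | no v≁w rewrite ¬T⇒≡false v≁w = sum-0 {n} (λ z → false · k) (λ _ → refl)
  ... | yes v~w rewrite T⇒≡true v~w with tr? v w
  ...   | no ∄z        = sum-0 _ λ z → cong (_· k) (¬T⇒≡false λ t → ∄z (z , t))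
  ...   | yes (z₀ , t₀) = trans (sum-cong eq) (sum-δ z₀ (λ _ → k))
    where
    eq : ∀ z → (a v z ∧ a w z) · k ≡ (z == z₀) · k
    eq z with z ≟ z₀
    ... | yes refl = cong (_· k) (T⇒≡true t₀)
    ... | no z≢z₀  = cong (_· k) (¬T⇒≡false λ t →
            z≢z₀ (third-unique v~w (proj₁ (common v w z t)) (proj₂ (common v w z t))
              (proj₁ (common v w z₀ t₀)) (proj₂ (common v w z₀ t₀))))

  -- A pair is listed once, with its smaller vertex first. The part of its second vertex is renamed
  -- by `triple-swap`; after that trichotomy counts each `w` once for every partner, and
  -- `sum-triple` says that there is at most one.
  sum-blocks : ∀ v f → ∑ᴸ (weigh f) (blocks v) ≡ sumₐ v f
  sum-blocks v f = begin
    ∑ᴸ (weigh f) (blocks v)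
      ≡⟨ ∑ᴸ-++ (weigh f) (collect (sgl v)) _ ⟩
    ∑ᴸ (weigh f) (collect (sgl v)) + ∑ᴸ (weigh f) (collect (λ w → collect (dbl v w)))
      ≡⟨ cong₂ _+_ singles doubles ⟩
    sum (λ w → (a v w ∧ not (tr v w)) · f w) + sum (λ w → (a v w ∧ tr v w) · f w)
      ≡⟨ sum-+ (λ w → (a v w ∧ not (tr v w)) · f w) (λ w → (a v w ∧ tr v w) · f w) ⟨
    sum (λ w → (a v w ∧ not (tr v w)) · f w + (a v w ∧ tr v w) · f w)
      ≡⟨ sum-cong (λ w → join (a v w) (tr v w) (f w)) ⟩
    sumₐ v f ∎
    where
    open ≡-Reasoning
    lt : Fin n → Fin n → Bool
    lt w z = toℕ w <ᵇ toℕ z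

    join : ∀ b c k → (b ∧ not c) · k + (b ∧ c) · k ≡ b · k
    join true  true  k = refl
    join true  false k = +-identityʳ k
    join false c     k = refl

    singles : ∑ᴸ (weigh f) (collect (sgl v)) ≡ sum (λ w → (a v w ∧ not (tr v w)) · f w)
    singles = trans (∑ᴸ-collect (weigh f) (sgl v)) (sum-cong λ w → ∑ᴸ-when (weigh f) (a v w ∧ not (tr v w)) (one w))

    lt-total : ∀ w z k → (triple v w z ∧ lt w z) · k + (triple v w z ∧ lt z w) · k ≡ triple v w z · k
    lt-total w z k with T? (triple v w z)
    ... | no ¬t rewrite ¬T⇒≡false ¬t = refl
    ... | yes t rewrite T⇒≡true t with <-cmp w z
    ...   | tri< w<z _ z≮w rewrite T⇒≡true (<⇒<ᵇ w<z) | ¬T⇒≡false (z≮w ∘ <ᵇ⇒< (toℕ z) (toℕ w)) = +-identityʳ k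
    ...   | tri≈ _ refl _  = ⊥-elim (~-irr (proj₂ (proj₂ (triple-elim v w w t))))
    ...   | tri> w≮z _ z<w rewrite T⇒≡true (<⇒<ᵇ z<w) | ¬T⇒≡false (w≮z ∘ <ᵇ⇒< (toℕ w) (toℕ z)) = refl

    doubles : ∑ᴸ (weigh f) (collect (λ w → collect (dbl v w))) ≡ sum (λ w → (a v w ∧ tr v w) · f w)
    doubles = begin
      ∑ᴸ (weigh f) (collect (λ w → collect (dbl v w)))
        ≡⟨ ∑ᴸ-collect (weigh f) (λ w → collect (dbl v w)) ⟩
      sum (λ w → ∑ᴸ (weigh f) (collect (dbl v w)))
        ≡⟨ sum-cong (λ w → trans (∑ᴸ-collect (weigh f) (dbl v w))
             (sum-cong λ z → ∑ᴸ-when (weigh f) (triple v w z ∧ lt w z) (two w z))) ⟩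
      sum (λ w → sum λ z → (triple v w z ∧ lt w z) · (f w + f z))
        ≡⟨ sum-cong (λ w → trans (sum-cong λ z → ·-distrib-+ (triple v w z ∧ lt w z) (f w) (f z))
             (sum-+ (λ z → (triple v w z ∧ lt w z) · f w) (λ z → (triple v w z ∧ lt w z) · f z))) ⟩
      sum (λ w → sum (λ z → (triple v w z ∧ lt w z) · f w) + sum (λ z → (triple v w z ∧ lt w z) · f z))
        ≡⟨ sum-+ (λ w → sum (λ z → (triple v w z ∧ lt w z) · f w)) _ ⟩
      sum (λ w → sum (λ z → (triple v w z ∧ lt w z) · f w)) + sum (λ w → sum (λ z → (triple v w z ∧ lt w z) · f z))
        ≡⟨ cong (sum (λ w → sum (λ z → (triple v w z ∧ lt w z) · f w)) +_)
             (trans (sum-swap (λ w z → (triple v w z ∧ lt w z) · f z))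
               (sum-cong λ z → sum-cong λ w → cong (λ b → (b ∧ lt w z) · f z) (triple-swap v w z))) ⟩
      sum (λ w → sum (λ z → (triple v w z ∧ lt w z) · f w)) + sum (λ w → sum (λ z → (triple v w z ∧ lt z w) · f w))
        ≡⟨ sum-+ (λ w → sum (λ z → (triple v w z ∧ lt w z) · f w)) _ ⟨
      sum (λ w → sum (λ z → (triple v w z ∧ lt w z) · f w) + sum (λ z → (triple v w z ∧ lt z w) · f w))
        ≡⟨ sum-cong (λ w → trans (sym (sum-+ (λ z → (triple v w z ∧ lt w z) · f w) _))
             (trans (sum-cong λ z → lt-total w z (f w)) (sum-triple v w (f w)))) ⟩
      sum (λ w → (a v w ∧ tr v w) · f w) ∎

  IsBlock : Fin n → Block n → Set
  IsBlock v (one w)   = v ~ w × (∀ z → v ~ z → ¬ w ~ z)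
  IsBlock v (two w z) = v ~ w × v ~ z × w ~ z

  blocks-valid : ∀ v → All (IsBlock v) (blocks v)
  blocks-valid v = All-++ (All-collect (sgl v) sgl-ok) (All-collect _ λ w → All-collect (dbl v w) (dbl-ok w))
    where
    T-not : ∀ {b} → T (not b) → ¬ T b
    T-not {false} _ ()
    sgl-ok : ∀ w → All (IsBlock v) (sgl v w)
    sgl-ok w = All-when (a v w ∧ not (tr v w)) (one w) λ t → proj₁ (∧-elim {a v w} t) ,
      λ z v~z w~z → T-not (proj₂ (∧-elim {a v w} t)) (fromWitness (z , ∧-intro {a v z} v~z w~z))
    dbl-ok : ∀ w z → All (IsBlock v) (dbl v w z)
    dbl-ok w z = All-when (triple v w z ∧ (toℕ w <ᵇ toℕ z)) (two w z)
      (triple-elim v w z ∘ proj₁ ∘ ∧-elim {triple v w z})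

  -- As `f` is arbitrary, `total` says that every neighbour lies in exactly one block: the
  -- indicators `δ w` recover both covering and disjointness. Any rearrangement of `blocks v`
  -- qualifies.
  record Partition (v : Fin n) (Bs : List (Block n)) : Set where
    field
      valid : All (IsBlock v) Bs
      total : ∀ f → ∑ᴸ (weigh f) Bs ≡ sumₐ v f

  ↭⇒Partition : ∀ {v Bs} → blocks v ↭ Bs → Partition v Bs
  ↭⇒Partition {v} p = record
    { valid = All-↭ p (blocks-valid v)
    ; total = λ f → trans (sym (∑ᴸ-↭ (weigh f) p)) (sum-blocks v f)
    }

  deg m : Fin n → ℕ
  deg v = sumₐ v (λ _ → 1)
  m v = length (blocks v)

  δ : Fin n → Fin n → ℕ
  δ v w = (w == v) · 1

  sumₐ-δ : ∀ {v w} → v ~ w → sumₐ v (δ w) ≡ 1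
  sumₐ-δ {v} {w} v~w = trans (sum-cong eq) (sum-δ w (λ _ → 1))
    where
    eq : ∀ u → a v u · δ w u ≡ (u == w) · 1
    eq u with u ≟ w
    ... | yes refl rewrite T⇒≡true v~w = refl
    ... | no _     with a v u
    ...   | true  = refl
    ...   | false = refl

  sumₐ-mono : ∀ v {f h} → (∀ w → v ~ w → f w ≤ h w) → sumₐ v f ≤ sumₐ v h
  sumₐ-mono v f≤h = sum-mono λ w → ·-mono′ (a v w) (f≤h w)

  sumₐ-+ : ∀ v f h → sumₐ v (λ w → f w + h w) ≡ sumₐ v f + sumₐ v h
  sumₐ-+ v f h = trans (sum-cong λ w → ·-distrib-+ (a v w) (f w) (h w)) (sum-+ (λ w → a v w · f w) (λ w → a v w · h w))

  sumₐ≤m : ∀ v k f → (∀ B → IsBlock v B → weigh f B ≤ k) → sumₐ v f ≤ m v * k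
  sumₐ≤m v k f f≤k = begin
    sumₐ v f                ≡⟨ sum-blocks v f ⟨
    ∑ᴸ (weigh f) (blocks v) ≤⟨ ∑ᴸ-≤ (weigh f) (λ _ → k) (All.map (λ {B} → f≤k B) (blocks-valid v)) ⟩
    ∑ᴸ (λ _ → k) (blocks v) ≡⟨ ∑ᴸ-const k (blocks v) ⟩
    m v * k                 ∎
    where open ≤-Reasoning

-- Partial colourings

data Col : Set where
  ○ ● : Col

opp : Col → Col
opp ○ = ●
opp ● = ○

cap : Col → ℕ
cap ○ = 3
cap ● = 4

_≟ᶜ_ : (c d : Col) → Dec (c ≡ d)
○ ≟ᶜ ○ = yes refl
○ ≟ᶜ ● = no λ ()
● ≟ᶜ ○ = no λ ()
● ≟ᶜ ● = yes refl

opp-≢ : ∀ c → opp c ≢ c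
opp-≢ ○ ()
opp-≢ ● ()

is : Col → Maybe Col → ℕ
is ○ (just ○) = 1
is ● (just ●) = 1
is _ _        = 0

is-just : ∀ c → is c (just c) ≡ 1
is-just ○ = refl
is-just ● = refl

is-cases : ∀ c x → (x ≡ just c × is c x ≡ 1) ⊎ (x ≢ just c × is c x ≡ 0)
is-cases ○ nothing  = inj₂ ((λ ()) , refl)
is-cases ● nothing  = inj₂ ((λ ()) , refl)
is-cases ○ (just ○) = inj₁ (refl , refl)
is-cases ○ (just ●) = inj₂ ((λ ()) , refl)
is-cases ● (just ○) = inj₂ ((λ ()) , refl)
is-cases ● (just ●) = inj₁ (refl , refl)

just? : ∀ x (c : Col) → Dec (x ≡ just c)
just? nothing  c = no λ ()
just? (just d) c with d ≟ᶜ c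
... | yes refl = yes refl
... | no d≢c   = no λ where refl → d≢c refl

module Colouring {n : ℕ} (g : C45Free n) where
  open Blocks g public

  Colouring : Set
  Colouring = Fin n → Maybe Col

  Coloured : Colouring → Fin n → Set
  Coloured κ v = ∃ λ c → κ v ≡ just c

  dg : Colouring → Fin n → Col → ℕ
  dg κ v c = sumₐ v λ w → is c (κ w)

  -- A partial partition into forests; acyclicity is stated as the absence of
  -- a monochromatic subgraph of minimum degree two.
  record Valid (κ : Colouring) : Set₁ where
    field
      dg≤  : ∀ v c → κ v ≡ just c → dg κ v c ≤ cap c
      acyc : ∀ c (P : Fin n → Set) → (∀ v → P v → κ v ≡ just c) →
             (∀ v → P v → ∃₂ λ w w′ → w ≢ w′ × P w × P w′ × v ~ w × v ~ w′) →
             ∀ v → ¬ P v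
  open Valid public

  is≤1 : ∀ c x → is c x ≤ 1
  is≤1 c x with is-cases c x
  ... | inj₁ (_ , ≡1) = ≤-reflexive ≡1
  ... | inj₂ (_ , ≡0) = ≤-trans (≤-reflexive ≡0) z≤n

  is-mono : ∀ c {x y} → (x ≡ just c → y ≡ just c) → is c x ≤ is c y
  is-mono c {x} {y} f with is-cases c x
  ... | inj₁ (x≡c , ≡1) = ≤-reflexive (trans ≡1 (sym (trans (cong (is c) (f x≡c)) (is-just c))))
  ... | inj₂ (_ , ≡0)   = ≤-trans (≤-reflexive ≡0) z≤n

  δ-refl : ∀ v → δ v v ≡ 1
  δ-refl v = cong (_· 1) (==-refl v)

  δ-≢ : ∀ {v w} → w ≢ v → δ v w ≡ 0
  δ-≢ w≢v = cong (_· 1) (≢⇒== w≢v)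

  sumₐ-δ≤1 : ∀ v w → sumₐ v (δ w) ≤ 1
  sumₐ-δ≤1 v w with T? (a v w)
  ... | yes v~w = ≤-reflexive (sumₐ-δ v~w)
  ... | no v≁w  = ≤-trans (≤-reflexive (sum-0 _ zero-at)) z≤n
    where
    zero-at : ∀ u → a v u · δ w u ≡ 0
    zero-at u with u ≟ w
    ... | yes refl rewrite ¬T⇒≡false v≁w = refl
    ... | no _     with a v u
    ...   | true  = refl
    ...   | false = refl

  dg-mono : ∀ {κ κ′} v c → (∀ w → v ~ w → κ′ w ≡ just c → κ w ≡ just c) → dg κ′ v c ≤ dg κ v c
  dg-mono v c f = sumₐ-mono v λ w v~w → is-mono c (f w v~w)

  dg-step : ∀ {κ κ′} v c w₀ → (∀ w → v ~ w → κ′ w ≡ just c → κ w ≡ just c ⊎ w ≡ w₀) →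
            dg κ′ v c ≤ dg κ v c + 1
  dg-step {κ} {κ′} v c w₀ f = begin
    dg κ′ v c                         ≤⟨ sumₐ-mono v bound ⟩
    sumₐ v (λ w → is c (κ w) + δ w₀ w) ≡⟨ sumₐ-+ v (λ w → is c (κ w)) (δ w₀) ⟩
    dg κ v c + sumₐ v (δ w₀)          ≤⟨ +-monoʳ-≤ (dg κ v c) (sumₐ-δ≤1 v w₀) ⟩
    dg κ v c + 1                      ∎
    where
    open ≤-Reasoning
    bound : ∀ w → v ~ w → is c (κ′ w) ≤ is c (κ w) + δ w₀ w
    bound w v~w with is-cases c (κ′ w)
    ... | inj₂ (_ , ≡0) rewrite ≡0 = z≤n
    ... | inj₁ (≡c , ≡1) rewrite ≡1 with f w v~w ≡c
    ...   | inj₁ κw≡c rewrite κw≡c | is-just c = s≤s z≤n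
    ...   | inj₂ refl rewrite δ-refl w₀ = m≤n+m 1 (is c (κ w))

  dg-zero : ∀ {κ} v c → (∀ w → v ~ w → κ w ≢ just c) → dg κ v c ≡ 0
  dg-zero {κ} v c f = n≤0⇒n≡0 (≤-trans (sumₐ-mono v λ w v~w → zero-at w (f w v~w)) (≤-reflexive (sum-0 _ λ w → ·-0 (a v w))))
    where
    zero-at : ∀ w → κ w ≢ just c → is c (κ w) ≤ 0
    zero-at w κw≢c with is-cases c (κ w)
    ... | inj₁ (≡c , _) = contradiction ≡c κw≢c
    ... | inj₂ (_ , ≡0) = ≤-reflexive ≡0

  dg-one : ∀ {κ} v c y → (∀ w → v ~ w → κ w ≡ just c → w ≡ y) → dg κ v c ≤ 1
  dg-one {κ} v c y f = subst (λ k → dg κ v c ≤ k + 1) (dg-zero {λ _ → nothing} v c λ _ _ ())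
    (dg-step {λ _ → nothing} v c y λ w v~w ≡c → inj₂ (f w v~w ≡c))

  dg-two : ∀ {κ} v c {w z} → w ≢ z → v ~ w → v ~ z → κ w ≡ just c → κ z ≡ just c → 2 ≤ dg κ v c
  dg-two {κ} v c {w} {z} w≢z v~w v~z ≡c ≡c′ =
    subst (_≤ dg κ v c) (cong₂ _+_ (at w v~w ≡c) (at z v~z ≡c′)) (two-terms≤sum (λ u → a v u · is c (κ u)) w≢z)
    where
    at : ∀ u → v ~ u → κ u ≡ just c → a v u · is c (κ u) ≡ 1
    at u v~u ≡c rewrite T⇒≡true v~u | ≡c = is-just c

  _[_≔_] : Colouring → Fin n → Maybe Col → Colouring
  (κ [ v ≔ x ]) u with u ≟ v
  ... | yes _ = x
  ... | no _  = κ u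

  ≔-same : ∀ κ v x → (κ [ v ≔ x ]) v ≡ x
  ≔-same κ v x with v ≟ v
  ... | yes _  = refl
  ... | no v≢v = contradiction refl v≢v

  ≔-other : ∀ κ {v} x {u} → u ≢ v → (κ [ v ≔ x ]) u ≡ κ u
  ≔-other κ {v} x {u} u≢v with u ≟ v
  ... | yes u≡v = contradiction u≡v u≢v
  ... | no _    = refl

  ≔-cases : ∀ κ v x u → (u ≡ v × (κ [ v ≔ x ]) u ≡ x) ⊎ (u ≢ v × (κ [ v ≔ x ]) u ≡ κ u)
  ≔-cases κ v x u with u ≟ v
  ... | yes u≡v = inj₁ (u≡v , refl)
  ... | no u≢v  = inj₂ (u≢v , refl)

  shrink : ∀ {κ κ′} → Valid κ → (∀ v c → κ′ v ≡ just c → κ v ≡ just c) → Valid κ′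
  shrink {κ} {κ′} val sub = record
    { dg≤  = λ v c ≡c → ≤-trans (dg-mono {κ} {κ′} v c λ w _ → sub w c) (dg≤ val v c (sub v c ≡c))
    ; acyc = λ c P Pc → acyc val c P (λ v Pv → sub v c (Pc v Pv))
    }

  -- With at most one neighbour of its own colour, `v` lies in no monochromatic subgraph of minimum
  -- degree two, so acyclicity is inherited. Among the vertices of colour `c`, only `v` and `y` gain
  -- a neighbour of that colour, which is why `y` alone needs room.
  extend : ∀ {κ v c} y → Valid κ → (∀ w → v ~ w → κ w ≡ just c → w ≡ y) →
           (v ~ y → κ y ≡ just c → dg κ y c < cap c) → κ v ≡ nothing → Valid (κ [ v ≔ just c ])
  extend {κ} {v} {c} y val only room κv≡∅ = record { dg≤ = dg≤′ ; acyc = acyc′ }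
    where
    κ′ = κ [ v ≔ just c ]
    below : ∀ {w d} → w ≢ v → κ′ w ≡ just d → κ w ≡ just d
    below w≢v ≡d = trans (sym (≔-other κ (just c) w≢v)) ≡d
    only′ : ∀ w → v ~ w → κ′ w ≡ just c → w ≡ y
    only′ w v~w ≡c = only w v~w (below (~⇒≢ (~-sym v~w)) ≡c)

    1≤cap : ∀ d → 1 ≤ cap d
    1≤cap ○ = s≤s z≤n
    1≤cap ● = s≤s z≤n

    dg≤′ : ∀ u d → κ′ u ≡ just d → dg κ′ u d ≤ cap d
    dg≤′ u d ≡d with u ≟ v
    dg≤′ u d refl | yes refl = ≤-trans (dg-one {κ′} v c y only′) (1≤cap c)
    ... | no u≢v with T? (a v u) | d ≟ᶜ c
    ...   | yes v~u | yes refl = ≤-trans (dg-step {κ} {κ′} u c v split)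
              (≤-trans (≤-reflexive (+-comm (dg κ u c) 1))
                (subst (λ u → dg κ u c < cap c) (sym u≡y) (room (subst (v ~_) u≡y v~u) (subst (λ u → κ u ≡ just c) u≡y ≡d))))
      where
      u≡y = only u v~u ≡d
      split : ∀ w → u ~ w → κ′ w ≡ just c → κ w ≡ just c ⊎ w ≡ v
      split w _ ≡c with w ≟ v
      ... | yes w≡v = inj₂ w≡v
      ... | no w≢v  = inj₁ ≡c
    ...   | no v≁u | _ = ≤-trans (dg-mono {κ} {κ′} u d λ w u~w → below λ where refl → v≁u (~-sym u~w)) (dg≤ val u d ≡d)
    ...   | yes _ | no d≢c = ≤-trans (dg-mono {κ} {κ′} u d λ w _ ≡d′ → below (λ where
              refl → d≢c (sym (just-injective (trans (sym (≔-same κ v (just c))) ≡d′)))) ≡d′) (dg≤ val u d ≡d)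

    acyc′ : ∀ d P → (∀ u → P u → κ′ u ≡ just d) →
            (∀ u → P u → ∃₂ λ w w′ → w ≢ w′ × P w × P w′ × u ~ w × u ~ w′) → ∀ u → ¬ P u
    acyc′ d P Pd core = acyc val d P (λ u Pu → below (λ where refl → ¬Pv Pu) (Pd u Pu)) core
      where
      ¬Pv : ¬ P v
      ¬Pv Pv with core v Pv | just-injective (trans (sym (≔-same κ v (just c))) (Pd v Pv))
      ... | w , w′ , w≢w′ , Pw , Pw′ , v~w , v~w′ | refl =
        w≢w′ (trans (only′ w v~w (Pd w Pw)) (sym (only′ w′ v~w′ (Pd w′ Pw′))))

  extend₀ : ∀ {κ v c} → Valid κ → (∀ w → v ~ w → κ w ≢ just c) → κ v ≡ nothing → Valid (κ [ v ≔ just c ])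
  -- Choosing `v` itself as the exceptional neighbour expresses that there is none, since `v` is not
  -- adjacent to itself.
  extend₀ {v = v} val none = extend v val (λ w v~w ≡c → contradiction ≡c (none w v~w)) (λ v~v _ → contradiction v~v ~-irr)

  no-mono-triangle : ∀ {κ c u v w} → Valid κ → u ~ v → v ~ w → u ~ w →
                     κ u ≡ just c → κ v ≡ just c → κ w ≡ just c → Empty
  no-mono-triangle {κ} {c} {u} {v} {w} val u~v v~w u~w ku kv kw = acyc val c P mono core u (inj₁ refl)
    where
    P : Fin n → Set
    P x = x ≡ u ⊎ x ≡ v ⊎ x ≡ w
    mono : ∀ x → P x → κ x ≡ just c
    mono x (inj₁ refl)        = ku
    mono x (inj₂ (inj₁ refl)) = kv
    mono x (inj₂ (inj₂ refl)) = kw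
    core : ∀ x → P x → ∃₂ λ y y′ → y ≢ y′ × P y × P y′ × x ~ y × x ~ y′
    core x (inj₁ refl)        = v , w , ~⇒≢ v~w , inj₂ (inj₁ refl) , inj₂ (inj₂ refl) , u~v , u~w
    core x (inj₂ (inj₁ refl)) = u , w , ~⇒≢ u~w , inj₁ refl , inj₂ (inj₂ refl) , ~-sym u~v , v~w
    core x (inj₂ (inj₂ refl)) = u , v , ~⇒≢ u~v , inj₁ refl , inj₂ (inj₁ refl) , ~-sym u~w , ~-sym v~w

  Large Mid Killer : Fin n → Set
  Large v  = 5 ≤ m v
  Mid v    = m v ≡ 4 × (6 ≤ deg v ⊎ ∃ λ w → v ~ w × Tr v w × Large w)
  Killer v = Large v ⊎ Mid v

  abstract
    large? : ∀ v → Dec (Large v)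
    large? v = 5 ≤? m v

  abstract
    mid? : ∀ v → Dec (Mid v)
    mid? v = (m v ≟ᴺ 4) ×-dec ((6 ≤? deg v) ⊎-dec any? λ w → T? (a v w) ×-dec (tr? v w ×-dec large? w))

  abstract
    killer? : ∀ v → Dec (Killer v)
    killer? v = large? v ⊎-dec mid? v

  -- The conditions under which a neighbour of this colour cannot block. A saturated ● vertex with a
  -- spare block has five blocks, so it is large. A saturated ○ vertex with a spare block has only
  -- four for certain; it must then be flipped, and this works unless it is mid.
  Weak : Col → Fin n → Set
  Weak ○ v = ¬ Killer v
  Weak ● v = ¬ Large v

  -- Every block of y contains at most one neighbour of the colour c of y, and
  -- the blocks of marked vertices contain none.
  saturation : ∀ {κ y c} (e : Fin n → ℕ) → Valid κ → κ y ≡ just c →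
               (∀ w → y ~ w → is c (κ w) + e w ≤ 1) →
               (∀ w z → y ~ w → y ~ z → w ~ z → 1 ≤ e w → is c (κ z) + e z ≡ 0) →
               dg κ y c + sumₐ y e ≤ m y
  saturation {κ} {y} {c} e val ky small partner =
    subst₂ _≤_ (sumₐ-+ y (λ w → is c (κ w)) e) (*-identityʳ (m y)) (sumₐ≤m y 1 f bound)
    where
    f : Fin n → ℕ
    f w = is c (κ w) + e w
    drop : ∀ {k l} → l ≡ 0 → k ≤ 1 → k + l ≤ 1
    drop {k} refl k≤1 = subst (_≤ 1) (sym (+-identityʳ k)) k≤1
    bound : ∀ B → IsBlock y B → weigh f B ≤ 1
    bound (one w)   (y~w , _)         = small w y~w
    bound (two w z) (y~w , y~z , w~z) with e w in ew | e z in ez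
    ... | suc _ | _ = subst (_≤ 1) (cong₂ (λ p q → is c (κ w) + p + (is c (κ z) + q)) ew ez)
          (drop (partner w z y~w y~z w~z (subst (1 ≤_) (sym ew) (s≤s z≤n))) (small w y~w))
    ... | zero | suc _ = subst (_≤ 1) (trans (+-comm (f z) (f w)) (cong₂ (λ p q → is c (κ w) + p + (is c (κ z) + q)) ew ez))
          (drop (partner z w y~z y~w (~-sym w~z) (subst (1 ≤_) (sym ez) (s≤s z≤n))) (small z y~z))
    ... | zero | zero rewrite +-identityʳ (is c (κ w)) | +-identityʳ (is c (κ z)) with is-cases c (κ w) | is-cases c (κ z)
    ...   | inj₁ (kw , _) | inj₁ (kz , _) = ⊥-elim (no-mono-triangle val y~w w~z y~z ky kw kz)
    ...   | inj₁ (_ , p)  | inj₂ (_ , q)  rewrite p | q = s≤s z≤n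
    ...   | inj₂ (_ , p)  | inj₁ (_ , q)  rewrite p | q = s≤s z≤n
    ...   | inj₂ (_ , p)  | inj₂ (_ , q)  rewrite p | q = z≤n

  is-0 : ∀ {c x} → x ≢ just c → is c x ≡ 0
  is-0 {c} {x} x≢c with is-cases c x
  ... | inj₁ (x≡c , _) = contradiction x≡c x≢c
  ... | inj₂ (_ , ≡0)  = ≡0

  -- Neither `v` nor a possible partner of it has the colour `c`, so the block of `v` at `y` is
  -- wasted and the bound by the number of blocks becomes strict.
  saturation₁ : ∀ {κ y c v} → Valid κ → κ y ≡ just c → y ~ v → κ v ≢ just c →
                (∀ f → y ~ f → v ~ f → κ f ≢ just c) → dg κ y c < m y
  saturation₁ {κ} {y} {c} {v} val ky y~v kv partner =
    subst (_≤ m y) (trans (cong (dg κ y c +_) (sumₐ-δ y~v)) (+-comm (dg κ y c) 1))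
      (saturation (δ v) val ky small partner′)
    where
    small : ∀ w → y ~ w → is c (κ w) + δ v w ≤ 1
    small w y~w with w ≟ v
    ... | yes refl rewrite is-0 kv = ≤-refl
    ... | no w≢v   rewrite +-identityʳ (is c (κ w)) = is≤1 c (κ w)
    partner′ : ∀ w z → y ~ w → y ~ z → w ~ z → 1 ≤ δ v w → is c (κ z) + δ v z ≡ 0
    partner′ w z y~w y~z w~z 1≤ with w ≟ v
    ... | yes refl = cong₂ _+_ (is-0 (partner z y~z w~z)) (δ-≢ (~⇒≢ (~-sym w~z)))
    partner′ w z y~w y~z w~z () | no _

-- Colouring one more vertex, with a flip if necessary.

module Moves {n : ℕ} (g : C45Free n) where
  open Colouring g public

  -- Besides `v` only `y` may change, and it may be flipped but not uncoloured.
  record Step (κ : Colouring) (v : Fin n) (c : Col) (y : Fin n) : Set₁ where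
    field
      κ′    : Colouring
      valid : Valid κ′
      at    : κ′ v ≡ just c
      same  : ∀ u → u ≢ v → u ≢ y → κ′ u ≡ κ u
      grow  : Coloured κ y → Coloured κ′ y

  ○●-disjoint : ∀ x → is ○ x + is ● x ≤ 1
  ○●-disjoint nothing  = z≤n
  ○●-disjoint (just ○) = ≤-refl
  ○●-disjoint (just ●) = ≤-refl

  ¬Large⇒≤4 : ∀ {v} → ¬ Large v → m v ≤ 4
  ¬Large⇒≤4 ¬L = ≤-pred (≰⇒> ¬L)

  ≡∅⇒≢ : ∀ {x : Maybe Col} {c} → x ≡ nothing → x ≢ just c
  ≡∅⇒≢ refl ()

  -- Three ○ neighbours and the spare block of `v` force exactly four blocks at `y`. As `y` is not
  -- mid, its degree is at most 5, which leaves room for at most one ● neighbour `z`. This `z` is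
  -- not large, so it has room for `y` as a ● neighbour; after the flip of `y` no neighbour of `v`
  -- is ○.
  module Flip {κ v y} (val : Valid κ) (κv : κ v ≡ nothing) (v~y : v ~ y) (κy : κ y ≡ just ○)
              (only : ∀ w → v ~ w → κ w ≡ just ○ → w ≡ y) (soft : ¬ Killer y) (full : 3 ≤ dg κ y ○) where

    y~v : y ~ v
    y~v = ~-sym v~y

    partner : ∀ f → y ~ f → v ~ f → κ f ≢ just ○
    partner f y~f v~f κf with only f v~f κf
    ... | refl = ~-irr y~f

    m≡4 : m y ≡ 4
    m≡4 = ≤-antisym (¬Large⇒≤4 (soft ∘ inj₁))
      (≤-trans (s≤s full) (saturation₁ val κy y~v (≡∅⇒≢ κv) partner))

    deg≤5 : deg y ≤ 5
    deg≤5 = ≤-pred (≰⇒> λ 6≤ → soft (inj₂ (m≡4 , inj₁ 6≤)))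

    dg●≤1 : dg κ y ● ≤ 1
    -- The four cancelled units are three ○ neighbours and the uncoloured `v`.
    dg●≤1 = +-cancelˡ-≤ 4 _ _ (≤-trans (+-monoˡ-≤ (dg κ y ●) (s≤s full)) (≤-trans counts deg≤5))
      where
      open ≤-Reasoning
      f : Fin n → ℕ
      f w = is ○ (κ w) + is ● (κ w)
      f+δ≤1 : ∀ w → f w + δ v w ≤ 1
      f+δ≤1 w with w ≟ v
      ... | yes refl rewrite κv = ≤-refl
      ... | no _ rewrite +-identityʳ (f w) = ○●-disjoint (κ w)
      counts : suc (dg κ y ○ + dg κ y ●) ≤ deg y
      counts = begin
        suc (dg κ y ○ + dg κ y ●)        ≡⟨ cong suc (sumₐ-+ y (λ w → is ○ (κ w)) (λ w → is ● (κ w))) ⟨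
        1 + sumₐ y f                     ≡⟨ +-comm 1 _ ⟩
        sumₐ y f + 1                     ≡⟨ cong (sumₐ y f +_) (sumₐ-δ y~v) ⟨
        sumₐ y f + sumₐ y (δ v)          ≡⟨ sumₐ-+ y f (δ v) ⟨
        sumₐ y (λ w → f w + δ v w)       ≤⟨ sumₐ-mono y (λ w _ → f+δ≤1 w) ⟩
        deg y                            ∎

    κ₁ : Colouring
    κ₁ = κ [ y ≔ nothing ]

    κ₁-sub : ∀ u c → κ₁ u ≡ just c → κ u ≡ just c
    κ₁-sub u c ≡c with u ≟ y
    κ₁-sub u c () | yes _
    ... | no _ = ≡c

    val₁ : Valid κ₁
    val₁ = shrink val κ₁-sub

    ●-unique : ∀ {z w} → y ~ z → κ z ≡ just ● → y ~ w → κ w ≡ just ● → w ≡ z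
    ●-unique {z} {w} y~z κz y~w κw with w ≟ z
    ... | yes w≡z = w≡z
    ... | no w≢z  = contradiction (≤-trans (dg-two {κ} y ● w≢z y~w y~z κw κz) dg●≤1) λ where (s≤s ())

    ●-small : ∀ {z} → y ~ z → κ z ≡ just ● → ¬ Large z
    ●-small {z} y~z κz with tr? y z
    ... | yes t = λ Lz → soft (inj₂ (m≡4 , inj₂ (z , y~z , t , Lz)))
    -- Off triangles, `z` is a block on its own and, like the block of `v`, it has no ○ vertex;
    -- three ○ neighbours would then need five blocks.
    ... | no ¬t = λ _ → contradiction (≤-trans (s≤s (s≤s full)) two-free) (subst (λ k → ¬ (5 ≤ k)) (sym m≡4) λ where (s≤s (s≤s (s≤s (s≤s ())))))
      where
      z≢v : z ≢ v
      z≢v refl = ≡∅⇒≢ κv κz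
      e : Fin n → ℕ
      e w = δ v w + δ z w
      small : ∀ w → y ~ w → is ○ (κ w) + e w ≤ 1
      small w y~w with w ≟ v | w ≟ z
      ... | yes refl | yes refl = contradiction refl z≢v
      ... | yes refl | no _     rewrite κv = ≤-refl
      ... | no _     | yes refl rewrite κz = ≤-refl
      ... | no _     | no _     rewrite +-identityʳ (is ○ (κ w)) = is≤1 ○ (κ w)
      part : ∀ w u → y ~ w → y ~ u → w ~ u → 1 ≤ e w → is ○ (κ u) + e u ≡ 0
      part w u y~w y~u w~u 1≤ with w ≟ v | w ≟ z
      ... | _        | yes refl = ⊥-elim (¬t (u , ∧-intro {a y u} y~u w~u))
      ... | yes refl | no _     = cong₂ _+_ (is-0 (partner u y~u w~u)) (cong₂ _+_ (δ-≢ (~⇒≢ (~-sym w~u)))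
              (δ-≢ {z} {u} λ where refl → ¬t (v , ∧-intro {a y v} y~w (~-sym w~u))))
      part w u y~w y~u w~u () | no _ | no _
      two-free : suc (suc (dg κ y ○)) ≤ m y
      two-free = subst (_≤ m y) (trans (cong (dg κ y ○ +_) (trans (sumₐ-+ y (δ v) (δ z)) (cong₂ _+_ (sumₐ-δ y~v) (sumₐ-δ y~z))))
          (+-comm (dg κ y ○) 2)) (saturation e val κy small part)

    κ₂ κ₃ : Colouring
    κ₂ = κ₁ [ y ≔ just ● ]
    κ₃ = κ₂ [ v ≔ just ○ ]

    v≢y : v ≢ y
    v≢y = ~⇒≢ v~y

    val₂ : Valid κ₂
    val₂ with any? (λ z → T? (a y z) ×-dec just? (κ z) ●)
    ... | no ∄z = extend₀ val₁ (λ w y~w κw → ∄z (w , y~w , κ₁-sub w ● κw)) (≔-same κ y nothing)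
    ... | yes (z , y~z , κz) = extend z val₁ (λ w y~w κw → ●-unique y~z κz y~w (κ₁-sub w ● κw)) room (≔-same κ y nothing)
      where
      room : y ~ z → κ₁ z ≡ just ● → dg κ₁ z ● < 4
      -- In `κ₁` the vertex `y` is uncoloured and `z` is its only ● neighbour, so the block of `y`
      -- at `z` has no ● vertex.
      room _ κ₁z = ≤-trans (saturation₁ val₁ κ₁z (~-sym y~z) (≡∅⇒≢ (≔-same κ y nothing))
          λ f z~f y~f κf → ~⇒≢ (~-sym z~f) (●-unique y~z κz y~f (κ₁-sub f ● κf)))
        (¬Large⇒≤4 (●-small y~z κz))

    κ₂-at : ∀ u → u ≢ y → κ₂ u ≡ κ u
    κ₂-at u u≢y = trans (≔-other κ₁ (just ●) u≢y) (≔-other κ nothing u≢y)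

    step : Step κ v ○ y
    step = record
      { κ′    = κ₃
      ; valid = extend₀ val₂ none (trans (κ₂-at v v≢y) κv)
      ; at    = ≔-same κ₂ v (just ○)
      ; same  = λ u u≢v u≢y → trans (≔-other κ₂ (just ○) u≢v) (κ₂-at u u≢y)
      ; grow  = λ _ → ● , trans (≔-other κ₂ (just ○) (v≢y ∘ sym)) (≔-same κ₁ y (just ●))
      }
      where
      none : ∀ w → v ~ w → κ₂ w ≢ just ○
      none w v~w κ₂w with w ≟ y
      none w v~w () | yes refl
      ... | no w≢y = w≢y (only w v~w (κ₁-sub w ○ κ₂w))

  plain : ∀ {κ v c} y → Valid (κ [ v ≔ just c ]) → Step κ v c y
  plain {κ} {v} {c} y val = record
    { κ′    = κ [ v ≔ just c ]
    ; valid = val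
    ; at    = ≔-same κ v (just c)
    ; same  = λ u u≢v _ → ≔-other κ (just c) u≢v
    ; grow  = grow
    }
    where
    grow : Coloured κ y → Coloured (κ [ v ≔ just c ]) y
    grow (d , κy) with y ≟ v
    ... | yes _ = c , refl
    ... | no _  = d , κy

  colour-weak : ∀ {κ v} c y → Valid κ → κ v ≡ nothing → (∀ w → v ~ w → κ w ≡ just c → w ≡ y) →
                (v ~ y → Weak c y) → Step κ v c y
  colour-weak {κ} {v} c y val κv only weak with T? (a v y) | just? (κ y) c
  ... | no v≁y  | _      = plain y (extend y val only (λ v~y → contradiction v~y v≁y) κv)
  ... | yes _   | no κy  = plain y (extend y val only (λ _ κy′ → contradiction κy′ κy) κv)
  ... | yes v~y | yes κy with dg κ y c <? cap c
  ...   | yes room = plain y (extend y val only (λ _ _ → room) κv)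
  ...   | no ¬room = full c κy only (weak v~y) (≮⇒≥ ¬room)
    where
    full : ∀ c → κ y ≡ just c → (∀ w → v ~ w → κ w ≡ just c → w ≡ y) → Weak c y → cap c ≤ dg κ y c → Step κ v c y
    full ○ κy only weak cap≤ = Flip.step val κv v~y κy only weak cap≤
    -- Four ● neighbours and the spare block of `v` make five blocks, so `y` would be large.
    full ● κy only weak cap≤ = contradiction
      (≤-trans (s≤s cap≤) (saturation₁ val κy (~-sym v~y) (≡∅⇒≢ κv) λ f y~f v~f κf → ~⇒≢ (~-sym y~f) (only f v~f κf)))
      weak

-- Filling the blocks of a coloured vertex one after another.

module Jobs (far : Bool) {n : ℕ} (g : C45Free n) where
  open Moves g public

  -- A job may look at the colours of the `Outer` vertices and may change those of the `Near` ones.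
  -- The flag `far` admits changes at distance two from the block; these occur only when a neighbour
  -- in the block is recoloured together with its own blocks.
  Outer Near : Fin n → Block n → Fin n → Set
  Outer x B u = u ≢ x × ∃ λ w → w ∈ᵇ B × w ~ u
  Near x B u  = u ≢ x × (u ∈ᵇ B ⊎ (∃ λ w → w ∈ᵇ B × w ~ u) ⊎ (T far × ∃₂ λ w z → w ∈ᵇ B × w ~ z × z ≢ x × z ~ u))

  Disjoint Apart : Block n → Block n → Set
  Disjoint B B′ = ∀ w → w ∈ᵇ B → ¬ w ∈ᵇ B′
  Apart B B′    = ∀ w w′ → w ∈ᵇ B → w′ ∈ᵇ B′ → w ≢ w′ × ¬ w ~ w′

  member : ∀ {x B w} → IsBlock x B → w ∈ᵇ B → x ~ w
  member {B = one _}   (x~w , _)       refl        = x~w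
  member {B = two _ _} (x~w , x~z , _) (inj₁ refl) = x~w
  member {B = two _ _} (x~w , x~z , _) (inj₂ refl) = x~z

  partner-member : ∀ {x B w u} → IsBlock x B → w ∈ᵇ B → x ~ u → w ~ u → u ∈ᵇ B
  partner-member {B = one _}   (_ , alone)         refl        x~u w~u = contradiction w~u (alone _ x~u)
  partner-member {B = two _ _} (x~p , x~q , p~q) (inj₁ refl) x~u w~u = inj₂ (third-unique x~p x~u w~u x~q p~q)
  partner-member {B = two _ _} (x~p , x~q , p~q) (inj₂ refl) x~u w~u = inj₁ (third-unique x~q x~u w~u x~p (~-sym p~q))

  disjoint⇒apart : ∀ {x B B′} → IsBlock x B → IsBlock x B′ → Disjoint B B′ → Apart B B′
  disjoint⇒apart isB isB′ dis w w′ w∈ w′∈ =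
    (λ where refl → dis w w∈ w′∈) ,
    λ w~w′ → dis w′ (partner-member isB w∈ (member isB′ w′∈) w~w′) w′∈

  -- Neighbours of x in different blocks have no further common neighbour, and
  -- no adjacent further neighbours: this would close a cycle of length 4 or 5.
  apart⇒far : ∀ {x B B′ u} → IsBlock x B → IsBlock x B′ → Apart B B′ →
              u ∈ᵇ B′ ⊎ Outer x B′ u → ¬ Near x B u
  apart⇒far isB isB′ ap (inj₁ u∈′) (u≢x , inj₁ u∈) = proj₁ (ap _ _ u∈ u∈′) refl
  apart⇒far isB isB′ ap (inj₁ u∈′) (u≢x , inj₂ (inj₁ (w , w∈ , w~u))) = proj₂ (ap _ _ w∈ u∈′) w~u
  apart⇒far isB isB′ ap (inj₁ u∈′) (u≢x , inj₂ (inj₂ (_ , w , z , w∈ , w~z , z≢x , z~u))) =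
    noC4 (member isB w∈) w~z z~u (~-sym (member isB′ u∈′)) (z≢x ∘ sym) (proj₁ (ap _ _ w∈ u∈′))
  apart⇒far isB isB′ ap (inj₂ (_ , w′ , w′∈ , w′~u)) (u≢x , inj₁ u∈) = proj₂ (ap _ _ u∈ w′∈) (~-sym w′~u)
  apart⇒far isB isB′ ap (inj₂ (_ , w′ , w′∈ , w′~u)) (u≢x , inj₂ (inj₁ (w , w∈ , w~u))) =
    noC4 (member isB w∈) w~u (~-sym w′~u) (~-sym (member isB′ w′∈)) (u≢x ∘ sym) (proj₁ (ap _ _ w∈ w′∈))
  apart⇒far isB isB′ ap (inj₂ (_ , w′ , w′∈ , w′~u)) (u≢x , inj₂ (inj₂ (_ , w , z , w∈ , w~z , z≢x , z~u))) =
    noC5 (member isB w∈) w~z z~u (~-sym w′~u) (~-sym (member isB′ w′∈)) (z≢x ∘ sym) (u≢x ∘ sym)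
      (λ where refl → proj₂ (ap _ _ w∈ w′∈) (~-sym w′~u)) (proj₁ (ap _ _ w∈ w′∈))
      (λ where refl → proj₂ (ap _ _ w∈ w′∈) w~z)

  δ-member : ∀ {w} B → w ∈ᵇ B → 1 ≤ weigh (δ w) B
  δ-member {w} (one _)   refl        = ≤-reflexive (sym (δ-refl w))
  δ-member {w} (two _ z) (inj₁ refl) rewrite δ-refl w = s≤s z≤n
  δ-member {w} (two v _) (inj₂ refl) rewrite δ-refl w = m≤n+m 1 (δ w v)

  member-δ : ∀ {w} B → 1 ≤ weigh (δ w) B → w ∈ᵇ B
  member-δ {w} (one v) 1≤ with v ≟ w
  ... | yes refl = refl
  member-δ {w} (one v) () | no _
  member-δ {w} (two v z) 1≤ with v ≟ w | z ≟ w
  ... | yes refl | _        = inj₁ refl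
  ... | no _     | yes refl = inj₂ refl
  member-δ {w} (two v z) () | no _ | no _

  cover : ∀ {x Bs w} → Partition x Bs → x ~ w → Any (w ∈ᵇ_) Bs
  cover {x} {Bs} {w} part x~w =
    go Bs (≤-reflexive (sym (trans (Partition.total part (δ w)) (sumₐ-δ x~w))))
    where
    go : ∀ Bs → 1 ≤ ∑ᴸ (weigh (δ w)) Bs → Any (w ∈ᵇ_) Bs
    go (B ∷ Bs) 1≤ with weigh (δ w) B in eq
    ... | suc _ = here (member-δ B (subst (1 ≤_) (sym eq) (s≤s z≤n)))
    ... | zero  = there (go Bs 1≤)

  -- No vertex lies in two blocks, because the weight `δ w` has total at most one. No edge joins two
  -- blocks either, because adjacent neighbours of `x` belong to the same block.
  apart : ∀ {x Bs} → Partition x Bs → AllPairs Apart Bs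
  apart {x} {Bs} part = go Bs (Partition.valid part) λ w → ≤-trans (≤-reflexive (Partition.total part (δ w))) (sumₐ-δ≤1 x w)
    where
    go : ∀ Bs → All (IsBlock x) Bs → (∀ w → ∑ᴸ (weigh (δ w)) Bs ≤ 1) → AllPairs Apart Bs
    go []       []         _  = []
    go (B ∷ Bs) (isB ∷ isBs) ≤1 =
      heads Bs isBs (λ w w∈ → ≤-pred (≤-trans (+-monoˡ-≤ _ (δ-member B w∈)) (≤1 w)))
      ∷ go Bs isBs (λ w → ≤-trans (m≤n+m _ (weigh (δ w) B)) (≤1 w))
      where
      heads : ∀ Bs′ → All (IsBlock x) Bs′ → (∀ w → w ∈ᵇ B → ∑ᴸ (weigh (δ w)) Bs′ ≤ 0) → All (Apart B) Bs′
      heads []         []             _  = []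
      heads (B′ ∷ Bs′) (isB′ ∷ isBs′) ≤0 =
        disjoint⇒apart isB isB′ (λ w w∈ w∈′ → contradiction
          (≤-trans (δ-member B′ w∈′) (≤-trans (m≤m+n _ _) (≤0 w w∈))) λ ())
        ∷ heads Bs′ isBs′ λ w w∈ → ≤-trans (m≤n+m _ (weigh (δ w) B′)) (≤0 w w∈)

  record Done (κ : Colouring) (x : Fin n) (c : Col) (B : Block n) (k : ℕ) : Set₁ where
    field
      κ′      : Colouring
      valid   : Valid κ′
      colours : ∀ w → w ∈ᵇ B → Coloured κ′ w
      same    : ∀ u → ¬ Near x B u → κ′ u ≡ κ u
      grow    : ∀ u → Coloured κ u → Coloured κ′ u
      gain    : dg κ′ x c ≤ dg κ x c + k

  -- A way of colouring the block B of x once x has got the colour c; the load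
  -- bounds the number of vertices of B that have to take the colour c.
  record Job (x : Fin n) (c : Col) (B : Block n) : Set₁ where
    field
      load      : Colouring → ℕ
      load-cong : ∀ {κ κ′} → (∀ u → Outer x B u → κ′ u ≡ κ u) → load κ′ ≡ load κ
      run       : ∀ {κ} → Valid κ → κ x ≡ just c → (∀ w → w ∈ᵇ B → κ w ≡ nothing) →
                  dg κ x c + load κ ≤ cap c → Done κ x c B (load κ)
  open Job public

  loads : ∀ {x c Bs} → All (Job x c) Bs → Colouring → ℕ
  loads []       κ = 0
  loads (j ∷ js) κ = load j κ + loads js κ

  record AllDone (κ : Colouring) (x : Fin n) (c : Col) (Bs : List (Block n)) (k : ℕ) : Set₁ where
    field
      κ′      : Colouring
      valid   : Valid κ′
      centre  : κ′ x ≡ just c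
      colours : All (λ B → ∀ w → w ∈ᵇ B → Coloured κ′ w) Bs
      same    : ∀ u → All (λ B → ¬ Near x B u) Bs → κ′ u ≡ κ u
      grow    : ∀ u → Coloured κ u → Coloured κ′ u
      load≤   : dg κ′ x c ≤ k

  Fresh : Colouring → Block n → Set
  Fresh κ B = ∀ w → w ∈ᵇ B → κ w ≡ nothing

  -- By `apart⇒far`, a job leaves the other blocks uncoloured and does not touch the vertices that
  -- determine their loads. So the loads may all be computed at the start, and their sum bounds the
  -- final degree of `x` in its class.
  run-all : ∀ {x c Bs} (js : All (Job x c) Bs) → All (IsBlock x) Bs → AllPairs Apart Bs → ∀ {κ} → Valid κ →
            κ x ≡ just c → All (Fresh κ) Bs → dg κ x c + loads js κ ≤ cap c → AllDone κ x c Bs (dg κ x c + loads js κ)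
  run-all [] [] [] {κ} val κx [] room = record
    { κ′ = κ ; valid = val ; centre = κx ; colours = [] ; same = λ _ _ → refl ; grow = λ _ → id
    ; load≤ = m≤m+n _ _ }
  run-all {x} {c} {B ∷ Bs} (j ∷ js) (isB ∷ isBs) (ap ∷ aps) {κ} val κx (κB ∷ κBs) room = record
    { κ′      = AllDone.κ′ rest
    ; valid   = AllDone.valid rest
    ; centre  = AllDone.centre rest
    ; colours = (λ w w∈ → AllDone.grow rest w (Done.colours first w w∈)) ∷ AllDone.colours rest
    ; same    = λ where u (¬near ∷ ¬nears) → trans (AllDone.same rest u ¬nears) (Done.same first u ¬near)
    ; grow    = λ u → AllDone.grow rest u ∘ Done.grow first u
    ; load≤   = ≤-trans (AllDone.load≤ rest) total≤
    }
    where
    room₁ : dg κ x c + load j κ ≤ cap c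
    room₁ = ≤-trans (+-monoʳ-≤ (dg κ x c) (m≤m+n _ _)) room
    first : Done κ x c B (load j κ)
    first = run j val κx κB room₁
    κ₁ : Colouring
    κ₁ = Done.κ′ first
    same-loads : ∀ {Bs} (js : All (Job x c) Bs) → All (IsBlock x) Bs → All (Apart B) Bs → loads js κ₁ ≡ loads js κ
    same-loads []         []             []         = refl
    same-loads (j′ ∷ js′) (isB′ ∷ isBs′) (ap′ ∷ aps′) = cong₂ _+_
      (load-cong j′ λ u out → Done.same first u (apart⇒far isB isB′ ap′ (inj₂ out))) (same-loads js′ isBs′ aps′)
    fresh : ∀ {Bs} → All (IsBlock x) Bs → All (Apart B) Bs → All (Fresh κ) Bs → All (Fresh κ₁) Bs
    fresh []             []           []           = []
    fresh (isB′ ∷ isBs′) (ap′ ∷ aps′) (κB′ ∷ κBs′) =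
      (λ w w∈ → trans (Done.same first w (apart⇒far isB isB′ ap′ (inj₁ w∈))) (κB′ w w∈)) ∷ fresh isBs′ aps′ κBs′
    total≤ : dg κ₁ x c + loads js κ₁ ≤ dg κ x c + (load j κ + loads js κ)
    total≤ = begin
      dg κ₁ x c + loads js κ₁            ≤⟨ +-mono-≤ (Done.gain first) (≤-reflexive (same-loads js isBs ap)) ⟩
      dg κ x c + load j κ + loads js κ   ≡⟨ +-assoc (dg κ x c) _ _ ⟩
      dg κ x c + (load j κ + loads js κ) ∎
      where open ≤-Reasoning
    rest : AllDone κ₁ x c Bs (dg κ₁ x c + loads js κ₁)
    rest = run-all js isBs aps (Done.valid first)
      (trans (Done.same first x (λ near → proj₁ near refl)) κx) (fresh isBs ap κBs) (≤-trans total≤ room)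

  Nbrs₂ : Fin n → Fin n → Fin n → Set
  Nbrs₂ v x b = v ~ x × v ~ b × (∀ w → v ~ w → w ≡ x ⊎ w ≡ b)

  Nbrs₃ : Fin n → Fin n → Fin n → Fin n → Set
  Nbrs₃ v x e f = (v ~ x × v ~ e × v ~ f) × (x ≢ e × x ≢ f × e ≢ f) × (∀ w → v ~ w → w ≡ x ⊎ w ≡ e ⊎ w ≡ f)

  ≢opp : ∀ {x : Maybe Col} {c} → x ≡ just c → x ≢ just (opp c)
  ≢opp {c = c} refl eq = opp-≢ c (sym (just-injective eq))

  opp≢ : ∀ {x : Maybe Col} {c} → x ≡ just (opp c) → x ≢ just c
  opp≢ {c = c} refl eq = opp-≢ c (just-injective eq)

  grow-≔ : ∀ κ v c u → Coloured κ u → Coloured (κ [ v ≔ just c ]) u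
  grow-≔ κ v c u (d , κu) with u ≟ v
  ... | yes _ = c , refl
  ... | no _  = d , κu

  step-grow : ∀ {κ v c y} (s : Step κ v c y) u → Coloured κ u → Coloured (Step.κ′ s) u
  step-grow {v = v} {c} {y} s u col with u ≟ v | u ≟ y
  ... | yes refl | _        = c , Step.at s
  ... | no _     | yes refl = Step.grow s col
  ... | no u≢v   | no u≢y   = subst (∃ ∘ λ x c → x ≡ just c) (sym (Step.same s u u≢v u≢y)) col

  ≔-opp : ∀ {κ v c} w → (κ [ v ≔ just (opp c) ]) w ≡ just c → κ w ≡ just c
  ≔-opp {v = v} w ≡c with w ≟ v
  ... | yes _ = contradiction ≡c (opp≢ refl)
  ... | no _  = ≡c

  take : ∀ {κ x c v} → Valid κ → IsBlock x (one v) → κ v ≡ nothing → (∀ w → v ~ w → κ w ≡ just c → w ≡ x) →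
         dg κ x c + 1 ≤ cap c → Done κ x c (one v) 1
  take {κ} {x} {c} {v} val (x~v , _) κv only-x room = record
    { κ′      = κ [ v ≔ just c ]
    ; valid   = extend x val only-x (λ _ _ → ≤-trans (≤-reflexive (+-comm 1 _)) room) κv
    ; colours = λ where w refl → c , ≔-same κ v (just c)
    ; same    = λ u far → ≔-other κ (just c) λ where refl → far (~⇒≢ (~-sym x~v) , inj₁ refl)
    ; grow    = grow-≔ κ v c
    ; gain    = dg-step {κ} x c v λ w _ ≡c → split w ≡c
    }
    where
    split : ∀ w → (κ [ v ≔ just c ]) w ≡ just c → κ w ≡ just c ⊎ w ≡ v
    split w ≡c with w ≟ v
    ... | yes w≡v = inj₂ w≡v
    ... | no _    = inj₁ ≡c

  -- The step may flip `y`, but `y` is not adjacent to `x`, as `v` is a block on its own. Hence the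
  -- degree of `x` in its class does not grow.
  avoid : ∀ {κ x c v y} → IsBlock x (one v) → v ~ y → y ≢ x → Step κ v (opp c) y → Done κ x c (one v) 0
  avoid {κ} {x} {c} {v} {y} (x~v , alone) v~y y≢x s = record
    { κ′      = Step.κ′ s
    ; valid   = Step.valid s
    ; colours = λ where w refl → opp c , Step.at s
    ; same    = λ u far → Step.same s u (λ where refl → far (~⇒≢ (~-sym x~v) , inj₁ refl))
                  (λ where refl → far (y≢x , inj₂ (inj₁ (v , refl , v~y))))
    ; grow    = step-grow s
    ; gain    = ≤-trans (dg-mono {κ} x c back) (m≤m+n _ _)
    }
    where
    back : ∀ w → x ~ w → Step.κ′ s w ≡ just c → κ w ≡ just c
    back w x~w ≡c with w ≟ v
    ... | yes refl = contradiction ≡c (opp≢ (Step.at s))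
    ... | no w≢v   = trans (sym (Step.same s w w≢v λ where refl → alone y x~w v~y)) ≡c

  -- The colour `c` is forced on `v` only if the other neighbour `b` has the opposite one; otherwise
  -- `v` has no neighbour of colour `opp c`.
  job-2 : ∀ {x c v b} → IsBlock x (one v) → Nbrs₂ v x b → x ≢ b → Job x c (one v)
  job-2 {x} {c} {v} {b} isB (v~x , v~b , only) x≢b = record
    { load      = λ κ → is (opp c) (κ b)
    ; load-cong = λ same → cong (is (opp c)) (same b (x≢b ∘ sym , v , refl , v~b))
    ; run       = go
    }
    where
    go : ∀ {κ} → Valid κ → κ x ≡ just c → (∀ w → w ≡ v → κ w ≡ nothing) →
         dg κ x c + is (opp c) (κ b) ≤ cap c → Done κ x c (one v) (is (opp c) (κ b))
    go {κ} val κx κv room with is-cases (opp c) (κ b)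
    ... | inj₁ (κb , ≡1) rewrite ≡1 = take val isB (κv v refl) only-x room
      where
      only-x : ∀ w → v ~ w → κ w ≡ just c → w ≡ x
      only-x w v~w κw with only w v~w
      ... | inj₁ w≡x  = w≡x
      ... | inj₂ refl = contradiction κw (opp≢ κb)
    ... | inj₂ (κb , ≡0) rewrite ≡0 = avoid isB v~b (x≢b ∘ sym) (plain b (extend₀ val none (κv v refl)))
      where
      none : ∀ w → v ~ w → κ w ≢ just (opp c)
      none w v~w κw with only w v~w
      ... | inj₁ refl = contradiction κw (≢opp κx)
      ... | inj₂ refl = κb κw

  -- The colour `c` is forced only if both other neighbours have the opposite one, hence the
  -- product. Otherwise at most one of them does, and it is weak.
  job-3 : ∀ {x c v e f} → IsBlock x (one v) → Nbrs₃ v x e f → Weak (opp c) e → Weak (opp c) f → Job x c (one v)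
  job-3 {x} {c} {v} {e} {f} isB ((v~x , v~e , v~f) , (x≢e , x≢f , _) , only) weak-e weak-f = record
    { load      = load-3
    ; load-cong = λ same → cong₂ (λ p q → is (opp c) p * is (opp c) q)
                    (same e (x≢e ∘ sym , v , refl , v~e)) (same f (x≢f ∘ sym , v , refl , v~f))
    ; run       = go
    }
    where
    load-3 : Colouring → ℕ
    load-3 κ = is (opp c) (κ e) * is (opp c) (κ f)
    go : ∀ {κ} → Valid κ → κ x ≡ just c → (∀ w → w ≡ v → κ w ≡ nothing) →
         dg κ x c + load-3 κ ≤ cap c → Done κ x c (one v) (load-3 κ)
    go {κ} val κx κv room with is-cases (opp c) (κ e) | is-cases (opp c) (κ f)
    ... | inj₁ (κe , ≡1) | inj₁ (κf , ≡1′) rewrite ≡1 | ≡1′ = take val isB (κv v refl) only-x room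
      where
      only-x : ∀ w → v ~ w → κ w ≡ just c → w ≡ x
      only-x w v~w κw with only w v~w
      ... | inj₁ w≡x         = w≡x
      ... | inj₂ (inj₁ refl) = contradiction κw (opp≢ κe)
      ... | inj₂ (inj₂ refl) = contradiction κw (opp≢ κf)
    ... | inj₂ (κe , ≡0) | _ rewrite ≡0 = avoid isB v~f (x≢f ∘ sym)
          (colour-weak (opp c) f val (κv v refl) only-f λ _ → weak-f)
      where
      only-f : ∀ w → v ~ w → κ w ≡ just (opp c) → w ≡ f
      only-f w v~w κw with only w v~w
      ... | inj₁ refl        = contradiction κw (≢opp κx)
      ... | inj₂ (inj₁ refl) = contradiction κw κe
      ... | inj₂ (inj₂ w≡f)  = w≡f
    ... | inj₁ (_ , ≡1) | inj₂ (κf , ≡0) rewrite ≡1 | ≡0 = avoid isB v~e (x≢e ∘ sym)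
          (colour-weak (opp c) e val (κv v refl) only-e λ _ → weak-e)
      where
      only-e : ∀ w → v ~ w → κ w ≡ just (opp c) → w ≡ e
      only-e w v~w κw with only w v~w
      ... | inj₁ refl        = contradiction κw (≢opp κx)
      ... | inj₂ (inj₁ w≡e)  = w≡e
      ... | inj₂ (inj₂ refl) = contradiction κw κf

  -- Only the colour of the third neighbour z of q matters: whatever it is,
  -- the soft third neighbour y of p can be made to agree with the choice for p.
  job-33 : ∀ {x c B p q y z} → IsBlock x B → p ∈ᵇ B → q ∈ᵇ B → (∀ w → w ∈ᵇ B → w ≡ p ⊎ w ≡ q) →
           Nbrs₃ p x q y → Nbrs₃ q x p z → ¬ Killer y → Job x c B
  job-33 {x} {c} {B} {p} {q} {y} {z} isB p∈ q∈ in-B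
         ((p~x , p~q , p~y) , (x≢q , x≢y , q≢y) , only-p) ((q~x , _ , q~z) , (x≢p , x≢z , p≢z) , only-q) soft = record
    { load      = λ κ → is (opp c) (κ z)
    ; load-cong = λ same → cong (is (opp c)) (same z (x≢z ∘ sym , q , q∈ , q~z))
    ; run       = go
    }
    where
    weak-y : ∀ d → Weak d y
    weak-y ○ = soft
    weak-y ● = soft ∘ inj₁
    p≢q : p ≢ q
    p≢q = ~⇒≢ p~q
    x≁y : ¬ x ~ y
    x≁y x~y = q≢y (third-unique p~x p~q (~-sym q~x) p~y x~y)
    y≢z : y ≢ z
    y≢z refl = x≢y (third-unique p~q p~x q~x p~y q~z)
    y≢p : y ≢ p
    y≢p = ~⇒≢ (~-sym p~y)
    near-y : Near x B y
    near-y = x≢y ∘ sym , inj₂ (inj₁ (p , p∈ , p~y))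

    go : ∀ {κ} → Valid κ → κ x ≡ just c → (∀ w → w ∈ᵇ B → κ w ≡ nothing) →
         dg κ x c + is (opp c) (κ z) ≤ cap c → Done κ x c B (is (opp c) (κ z))
    go {κ} val κx κB room with is-cases (opp c) (κ z)
    ... | inj₁ (κz , ≡1) rewrite ≡1 = record
      { κ′      = Step.κ′ s
      ; valid   = Step.valid s
      ; colours = λ w w∈ → colours (in-B w w∈)
      ; same    = λ u far → trans
          (Step.same s u (λ where refl → far (x≢p ∘ sym , inj₁ p∈)) (λ where refl → far near-y))
          (≔-other κ (just c) λ where refl → far (x≢q ∘ sym , inj₁ q∈))
      ; grow    = λ u → step-grow s u ∘ grow-≔ κ q c u
      ; gain    = dg-step {κ} x c q split
      }
      where
      κ₁ : Colouring
      κ₁ = κ [ q ≔ just c ]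
      only-x : ∀ w → q ~ w → κ w ≡ just c → w ≡ x
      only-x w q~w κw with only-q w q~w
      ... | inj₁ w≡x         = w≡x
      ... | inj₂ (inj₁ refl) = contradiction (κB p p∈) λ ≡∅ → ≡∅⇒≢ ≡∅ κw
      ... | inj₂ (inj₂ refl) = contradiction κw (opp≢ κz)
      val₁ : Valid κ₁
      val₁ = extend x val only-x (λ _ _ → ≤-trans (≤-reflexive (+-comm 1 _)) room) (κB q q∈)
      only-y : ∀ w → p ~ w → κ₁ w ≡ just (opp c) → w ≡ y
      only-y w p~w κ₁w with only-p w p~w
      ... | inj₁ refl        = contradiction (trans (sym (≔-other κ (just c) x≢q)) κ₁w) (≢opp κx)
      ... | inj₂ (inj₁ refl) = contradiction κ₁w (≢opp (≔-same κ q (just c)))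
      ... | inj₂ (inj₂ w≡y)  = w≡y
      s : Step κ₁ p (opp c) y
      s = colour-weak (opp c) y val₁ (trans (≔-other κ (just c) p≢q) (κB p p∈)) only-y λ _ → weak-y (opp c)
      colours : ∀ {w} → w ≡ p ⊎ w ≡ q → Coloured (Step.κ′ s) w
      colours (inj₁ refl) = opp c , Step.at s
      colours (inj₂ refl) = step-grow s q (c , ≔-same κ q (just c))
      split : ∀ w → x ~ w → Step.κ′ s w ≡ just c → κ w ≡ just c ⊎ w ≡ q
      split w x~w ≡c with w ≟ p | w ≟ q
      ... | yes refl | _       = contradiction ≡c (opp≢ (Step.at s))
      ... | no _     | yes w≡q = inj₂ w≡q
      ... | no w≢p   | no w≢q  = inj₁ (trans (sym (trans (Step.same s w w≢p λ where refl → x≁y x~w) (≔-other κ (just c) w≢q))) ≡c)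
    ... | inj₂ (κz , ≡0) rewrite ≡0 = record
      { κ′      = κ₂
      ; valid   = val₂
      ; colours = λ w w∈ → colours (in-B w w∈)
      ; same    = λ u far → trans
          (≔-other κ₁ (just (opp c)) λ where refl → far (x≢q ∘ sym , inj₁ q∈))
          (Step.same s u (λ where refl → far (x≢p ∘ sym , inj₁ p∈)) (λ where refl → far near-y))
      ; grow    = λ u → grow-≔ κ₁ q (opp c) u ∘ step-grow s u
      ; gain    = ≤-trans (dg-mono {κ} x c back) (m≤m+n _ _)
      }
      where
      only-y : ∀ w → p ~ w → κ w ≡ just (opp c) → w ≡ y
      only-y w p~w κw with only-p w p~w
      ... | inj₁ refl        = contradiction κw (≢opp κx)
      ... | inj₂ (inj₁ refl) = contradiction κw (≡∅⇒≢ (κB q q∈))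
      ... | inj₂ (inj₂ w≡y)  = w≡y
      s : Step κ p (opp c) y
      s = colour-weak (opp c) y val (κB p p∈) only-y λ _ → weak-y (opp c)
      κ₁ κ₂ : Colouring
      κ₁ = Step.κ′ s
      κ₂ = κ₁ [ q ≔ just (opp c) ]
      κ₁-at : ∀ w → w ≢ p → w ≢ y → κ₁ w ≡ κ w
      κ₁-at = Step.same s
      only-p₁ : ∀ w → q ~ w → κ₁ w ≡ just (opp c) → w ≡ p
      only-p₁ w q~w κ₁w with only-q w q~w
      ... | inj₁ refl        = contradiction (trans (sym (κ₁-at x x≢p x≢y)) κ₁w) (≢opp κx)
      ... | inj₂ (inj₁ w≡p)  = w≡p
      ... | inj₂ (inj₂ refl) = contradiction (trans (sym (κ₁-at z (p≢z ∘ sym) (y≢z ∘ sym))) κ₁w) κz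
      κ₁q : κ₁ q ≡ nothing
      κ₁q = trans (κ₁-at q (p≢q ∘ sym) q≢y) (κB q q∈)
      only-y₁ : ∀ w → p ~ w → κ₁ w ≡ just (opp c) → w ≡ y
      only-y₁ w p~w κ₁w with only-p w p~w
      ... | inj₁ refl        = contradiction (trans (sym (κ₁-at x x≢p x≢y)) κ₁w) (≢opp κx)
      ... | inj₂ (inj₁ refl) = contradiction κ₁w (≡∅⇒≢ κ₁q)
      ... | inj₂ (inj₂ w≡y)  = w≡y
      2≤cap : ∀ d → 2 ≤ cap d
      2≤cap ○ = s≤s (s≤s z≤n)
      2≤cap ● = s≤s (s≤s z≤n)
      val₂ : Valid κ₂
      -- Both `p` and `q` get the colour `opp c`. Before `q` joins, `p` has at most `y` as a
      -- neighbour of this colour, and both caps are at least 2.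
      val₂ = extend p (Step.valid s) only-p₁
        (λ _ _ → ≤-trans (s≤s (dg-one {κ₁} p (opp c) y only-y₁)) (2≤cap (opp c))) κ₁q
      colours : ∀ {w} → w ≡ p ⊎ w ≡ q → Coloured κ₂ w
      colours (inj₁ refl) = grow-≔ κ₁ q (opp c) p (opp c , Step.at s)
      colours (inj₂ refl) = opp c , ≔-same κ₁ q (just (opp c))
      back : ∀ w → x ~ w → κ₂ w ≡ just c → κ w ≡ just c
      back w x~w ≡c with ≔-opp {κ₁} {q} w ≡c | w ≟ p
      ... | κ₁w | yes refl = contradiction κ₁w (opp≢ (Step.at s))
      ... | κ₁w | no w≢p   = trans (sym (κ₁-at w w≢p λ where refl → x≁y x~w)) κ₁w

-- Colouring a centre and refilling its blocks.

module Centres (far : Bool) {n : ℕ} (g : C45Free n) where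
  open Jobs far g public

  record Centred (κ : Colouring) (x y : Fin n) (c : Col) (Bs : List (Block n)) (k : ℕ) : Set₁ where
    field
      κ′     : Colouring
      valid  : Valid κ′
      centre : κ′ x ≡ just c
      filled : ∀ u → Any (u ∈ᵇ_) Bs → Coloured κ′ u
      grow   : ∀ u → Coloured κ u → Coloured κ′ u
      same   : ∀ u → u ≢ x → u ≢ y → All (λ B → ¬ Near x B u) Bs → κ′ u ≡ κ u
      low    : dg κ′ x c ≤ k

  -- The number `e` bounds the degree of `x` in its class right after `x` is coloured, and `k`
  -- bounds the loads. The choice `y ≡ x` encodes that no neighbour has the colour `c`. A genuine
  -- `y` is already coloured, so a flip of it does not disturb the uncoloured blocks; it may change
  -- the loads, hence the bound for all colourings that agree with `κ` elsewhere.
  centre-with : ∀ {κ x c Bs} (js : All (Job x c) Bs) → All (IsBlock x) Bs → AllPairs Apart Bs → Valid κ → κ x ≡ nothing →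
           All (Fresh κ) Bs → ∀ y e k → (∀ w → x ~ w → κ w ≡ just c → w ≡ y) → (x ~ y → Weak c y) →
           (y ≡ x × e ≡ 0) ⊎ (Coloured κ y × e ≡ 1) →
           (∀ κ₁ → (∀ u → u ≢ x → u ≢ y → κ₁ u ≡ κ u) → loads js κ₁ ≤ k) → e + k ≤ cap c → Centred κ x y c Bs (e + k)
  centre-with {κ} {x} {c} {Bs} js isBs aps val κx κBs y e k only weak kept small room = record
    { κ′     = AllDone.κ′ all-done
    ; valid  = AllDone.valid all-done
    ; centre = AllDone.centre all-done
    ; filled = λ u → filled (AllDone.colours all-done) u
    ; grow   = λ u → AllDone.grow all-done u ∘ step-grow s u
    ; same   = λ u u≢x u≢y far → trans (AllDone.same all-done u far) (Step.same s u u≢x u≢y)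
    ; low    = ≤-trans (AllDone.load≤ all-done) bound
    }
    where
    s : Step κ x c y
    s = colour-weak c y val κx only weak
    κ₁ : Colouring
    κ₁ = Step.κ′ s
    bound : dg κ₁ x c + loads js κ₁ ≤ e + k
    bound = +-mono-≤ (dg≤e kept) (small κ₁ (Step.same s))
      where
      dg≤e : (y ≡ x × e ≡ 0) ⊎ (Coloured κ y × e ≡ 1) → dg κ₁ x c ≤ e
      dg≤e (inj₁ (refl , refl)) = ≤-reflexive (dg-zero {κ₁} x c λ w x~w κ₁w →
        let w≢x = ~⇒≢ (~-sym x~w) in w≢x (only w x~w (trans (sym (Step.same s w w≢x w≢x)) κ₁w)))
      dg≤e (inj₂ (_ , refl)) = dg-one {κ₁} x c y λ w x~w κ₁w → only′ w x~w κ₁w (w ≟ y)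
        where
        only′ : ∀ w → x ~ w → κ₁ w ≡ just c → Dec (w ≡ y) → w ≡ y
        only′ w x~w κ₁w (yes w≡y) = w≡y
        only′ w x~w κ₁w (no w≢y)  = only w x~w (trans (sym (Step.same s w (~⇒≢ (~-sym x~w)) w≢y)) κ₁w)
    fresh : ∀ {Bs} → All (IsBlock x) Bs → All (Fresh κ) Bs → All (Fresh κ₁) Bs
    fresh []           []         = []
    fresh (isB ∷ isBs) (κB ∷ κBs) = (λ w w∈ → trans (Step.same s w (~⇒≢ (~-sym (member isB w∈))) (w≢y kept (member isB w∈) (κB w w∈))) (κB w w∈))
                                    ∷ fresh isBs κBs
      where
      w≢y : ∀ {w} → (y ≡ x × e ≡ 0) ⊎ (Coloured κ y × e ≡ 1) → x ~ w → κ w ≡ nothing → w ≢ y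
      w≢y (inj₁ (refl , _))         x~w κw refl = ~-irr x~w
      w≢y (inj₂ ((d , κy) , _)) x~w κw refl = ≡∅⇒≢ κw κy
    all-done : AllDone κ₁ x c Bs (dg κ₁ x c + loads js κ₁)
    all-done = run-all js isBs aps (Step.valid s) (Step.at s) (fresh isBs κBs) (≤-trans bound room)
    filled : ∀ {κ Bs} → All (λ B → ∀ w → w ∈ᵇ B → Coloured κ w) Bs → ∀ u → Any (u ∈ᵇ_) Bs → Coloured κ u
    filled (cB ∷ _)  u (here u∈)   = cB u u∈
    filled (_ ∷ cBs) u (there u∈s) = filled cBs u u∈s

  record Nice (x : Fin n) (B : Block n) : Set₁ where
    field
      job    : ∀ c → Job x c B
      load≤1 : ∀ c κ → load (job c) κ ≤ 1
  open Nice public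

  -- Either the block is uncoloured and refilled, or it is a single vertex that keeps its colour. As
  -- no killer, this vertex can be flipped if `x` gets the same colour.
  data Fourth (x : Fin n) : Block n → Set₁ where
    nice : ∀ {B} → Nice x B → Fourth x B
    solo : ∀ {w} → ¬ Killer w → Fourth x (one w)

  Ready : ∀ {x Y} → Fourth x Y → Colouring → Set
  Ready {Y = Y} (nice _) κ = Fresh κ Y
  Ready         (solo _) κ = Unit

  to-fill : ∀ {x Y} → Fourth x Y → List (Block n)
  to-fill {Y = Y} (nice _) = Y ∷ []
  to-fill         (solo _) = []

  soft⇒weak : ∀ {v} c → ¬ Killer v → Weak c v
  soft⇒weak ○ soft = soft
  soft⇒weak ● soft = soft ∘ inj₁

  3≤cap : ∀ d → 3 ≤ cap d
  3≤cap ○ = ≤-refl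
  3≤cap ● = s≤s (s≤s (s≤s z≤n))

  module _ {x X B₁ B₂ Y} (part : Partition x (X ∷ B₁ ∷ B₂ ∷ Y ∷ [])) (N₁ : Nice x B₁) (N₂ : Nice x B₂) where

    private
      isB = Partition.valid part
      aps = apart part

    -- If `X` avoids the colour `d`, the other three blocks cost at most one unit each, and 3 fits
    -- both caps.
    avoid-first : ∀ {κ} d (F : Fourth x Y) → Valid κ → κ x ≡ nothing → (∀ w → w ∈ᵇ X → κ w ≢ just d) →
                  Fresh κ B₁ → Fresh κ B₂ → Ready F κ →
                  ∃ λ y → (y ≡ x ⊎ y ∈ᵇ Y) × Centred κ x y d (B₁ ∷ B₂ ∷ to-fill F) 3
    avoid-first {κ} d (nice N₃) val κx X≢d κ₁ κ₂ κ₃ with isB | aps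
    ... | _ ∷ is@(_ ∷ _ ∷ _ ∷ []) | _ ∷ ap@(_ ∷ _ ∷ _ ∷ []) = x , inj₁ refl ,
      centre-with (job N₁ d ∷ job N₂ d ∷ job N₃ d ∷ []) is ap val κx (κ₁ ∷ κ₂ ∷ κ₃ ∷ []) x 0 3
        (λ w x~w κw → ⊥-elim (none w κw (cover part x~w))) (λ x~x → contradiction x~x ~-irr) (inj₁ (refl , refl))
        (λ κ′ _ → +-mono-≤ (load≤1 N₁ d κ′) (+-mono-≤ (load≤1 N₂ d κ′) (+-mono-≤ (load≤1 N₃ d κ′) z≤n))) (3≤cap d)
      where
      none : ∀ w → κ w ≡ just d → Any (w ∈ᵇ_) (X ∷ B₁ ∷ B₂ ∷ Y ∷ []) → Empty
      none w κw (here w∈)                         = X≢d w w∈ κw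
      none w κw (there (here w∈))                 = ≡∅⇒≢ (κ₁ w w∈) κw
      none w κw (there (there (here w∈)))         = ≡∅⇒≢ (κ₂ w w∈) κw
      none w κw (there (there (there (here w∈)))) = ≡∅⇒≢ (κ₃ w w∈) κw
    avoid-first {κ} d (solo {s} soft) val κx X≢d κ₁ κ₂ _ with isB | aps
    ... | _ ∷ is₁ ∷ is₂ ∷ is₃ ∷ [] | _ ∷ (ap₁₂ ∷ _) ∷ _ = by-colour (κ s) refl
      where
      only : ∀ w → κ w ≡ just d → Any (w ∈ᵇ_) (X ∷ B₁ ∷ B₂ ∷ Y ∷ []) → w ≡ s
      only w κw (here w∈)                           = contradiction κw (X≢d w w∈)
      only w κw (there (here w∈))                   = contradiction κw (≡∅⇒≢ (κ₁ w w∈))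
      only w κw (there (there (here w∈)))           = contradiction κw (≡∅⇒≢ (κ₂ w w∈))
      only w κw (there (there (there (here w≡s)))) = w≡s
      jobs : All (Job x d) (B₁ ∷ B₂ ∷ [])
      jobs = job N₁ d ∷ job N₂ d ∷ []
      loads≤2 : ∀ κ′ → loads jobs κ′ ≤ 2
      loads≤2 κ′ = +-mono-≤ (load≤1 N₁ d κ′) (+-mono-≤ (load≤1 N₂ d κ′) z≤n)
      by-colour : ∀ k → κ s ≡ k → ∃ λ y → (y ≡ x ⊎ y ∈ᵇ Y) × Centred κ x y d (B₁ ∷ B₂ ∷ []) 3
      by-colour (just e) κs = s , inj₂ refl ,
        centre-with jobs (is₁ ∷ is₂ ∷ []) ((ap₁₂ ∷ []) ∷ [] ∷ []) val κx (κ₁ ∷ κ₂ ∷ []) s 1 2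
          (λ w x~w κw → only w κw (cover part x~w)) (λ _ → soft⇒weak d soft) (inj₂ ((e , κs) , refl))
          (λ κ′ _ → loads≤2 κ′) (3≤cap d)
      -- This case is for colourings in which `s` has not been coloured yet; then no neighbour of
      -- `x` has the colour `d`.
      by-colour nothing κs = x , inj₁ refl ,
        centre-with jobs (is₁ ∷ is₂ ∷ []) ((ap₁₂ ∷ []) ∷ [] ∷ []) val κx (κ₁ ∷ κ₂ ∷ []) x 0 3
          (λ w x~w κw → contradiction κw (≡∅⇒≢ (trans (cong κ (only w κw (cover part x~w))) κs)))
          (λ x~x → contradiction x~x ~-irr) (inj₁ (refl , refl))
          (λ κ′ _ → ≤-trans (loads≤2 κ′) (s≤s (s≤s z≤n))) (3≤cap d)

  SoftIfSolo : ∀ {x Y} → Fourth x Y → Fin n → Set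
  SoftIfSolo (nice _) v = Unit
  SoftIfSolo (solo _) v = ¬ Killer v

  -- Unless it is nice, the first block keeps its colours. A single vertex or a monochromatic pair
  -- leaves one colour free for `x`. For a pair with both colours, `x` has to join one of its
  -- vertices: the ● one if the fourth block is refilled, and otherwise the one whose colour differs
  -- from that of the kept fourth block. The second choice may be ○, so it needs the pair to be free
  -- of killers.
  data First {x Y} (F : Fourth x Y) : Block n → Set₁ where
    nice   : ∀ {B} → Nice x B → First F B
    single : ∀ {u} → First F (one u)
    pair   : ∀ {r f} → ¬ Large r → ¬ Large f → SoftIfSolo F r → SoftIfSolo F f → First F (two r f)

  _∈ᵇ?_ : ∀ (u : Fin n) B → Dec (u ∈ᵇ B)
  u ∈ᵇ? one w   = u ≟ w
  u ∈ᵇ? two w z = (u ≟ w) ⊎-dec (u ≟ z)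

-- Reducible vertices with four blocks.

-- S is the current vertex set, all of whose proper subsets can be coloured.
module Reducible (far : Bool) {n : ℕ} (g : C45Free n) (S : Fin n → Set) (S-~ : ∀ {u v : Fin n} → C45Free._~_ g u v → S u)
  (colour-rest : ∀ x → S x → (R : Fin n → Set) → (∀ u → Dec (R u)) → R x →
    Σ (Fin n → Maybe Col) λ κ → Colouring.Valid g κ × (∀ u → R u → κ u ≡ nothing) ×
      (∀ u → S u → ¬ R u → ∃ λ c → κ u ≡ just c)) where
  open Centres far g public

  Goal : Set₁
  Goal = Σ Colouring λ κ → Valid κ × (∀ u → S u → Coloured κ u)

  In : Fin n → List (Block n) → Fin n → Set
  In x Bs u = u ≡ x ⊎ Any (u ∈ᵇ_) Bs

  record Start (x : Fin n) (Bs : List (Block n)) : Set₁ where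
    field
      κ     : Colouring
      valid : Valid κ
      κx    : κ x ≡ nothing
      fresh : All (Fresh κ) Bs
      rest  : ∀ u → S u → ¬ In x Bs u → Coloured κ u

  start : ∀ x → S x → ∀ Bs → Start x Bs
  start x Sx Bs with colour-rest x Sx (In x Bs) (λ u → (u ≟ x) ⊎-dec Any.any? (u ∈ᵇ?_) Bs) (inj₁ refl)
  ... | κ , val , off , on = record
    { κ = κ ; valid = val ; κx = off x (inj₁ refl) ; fresh = freshes Bs (λ u → off u ∘ inj₂) ; rest = on }
    where
    freshes : ∀ Bs → (∀ u → Any (u ∈ᵇ_) Bs → κ u ≡ nothing) → All (Fresh κ) Bs
    freshes []       off = []
    freshes (B ∷ Bs) off = (λ w w∈ → off w (here w∈)) ∷ freshes Bs (λ u u∈ → off u (there u∈))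

  finish : ∀ {x y c k Bs Bs′} (s : Start x Bs) → Centred (Start.κ s) x y c Bs′ k →
           (∀ {u} → Any (u ∈ᵇ_) Bs → Any (u ∈ᵇ_) Bs′) → Goal
  finish {x} {c = c} {Bs = Bs} s C ⊆ = Centred.κ′ C , Centred.valid C , col
    where
    col : ∀ u → S u → Coloured (Centred.κ′ C) u
    col u Su with (u ≟ x) ⊎-dec Any.any? (u ∈ᵇ?_) Bs
    ... | yes (inj₁ refl) = c , Centred.centre C
    ... | yes (inj₂ u∈)   = Centred.filled C u (⊆ u∈)
    ... | no u∉           = Centred.grow C u (Start.rest s u Su u∉)

  module FourBlocks {x X B₁ B₂ Y} (part : Partition x (X ∷ B₁ ∷ B₂ ∷ Y ∷ [])) (Sx : S x)
                    (N₁ : Nice x B₁) (N₂ : Nice x B₂) where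

    private
      all₄ : ∀ {P : Block n → Set} → All P (X ∷ B₁ ∷ B₂ ∷ Y ∷ []) → P X × P B₁ × P B₂ × P Y
      all₄ (p ∷ q ∷ r ∷ s ∷ []) = p , q , r , s

      isX = proj₁ (all₄ (Partition.valid part))
      is₁ = proj₁ (proj₂ (all₄ (Partition.valid part)))
      is₂ = proj₁ (proj₂ (proj₂ (all₄ (Partition.valid part))))
      isY = proj₂ (proj₂ (proj₂ (all₄ (Partition.valid part))))

      aps : (Apart X B₁ × Apart X B₂ × Apart X Y) × (Apart B₁ B₂ × Apart B₁ Y) × Apart B₂ Y
      aps with apart part
      ... | (p ∷ q ∷ r ∷ []) ∷ (s ∷ t ∷ []) ∷ (u ∷ []) ∷ [] ∷ [] = (p , q , r) , (s , t) , u

      clash : ∀ {B B′ : Block n} {w} {A : Set} → Apart B B′ → w ∈ᵇ B → w ∈ᵇ B′ → A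
      clash ap w∈ w∈′ = contradiction refl (proj₁ (ap _ _ w∈ w∈′))

      known : ∀ {B} → IsBlock x B → ∀ w → w ∈ᵇ B → S w × w ≢ x
      known isB w w∈ = S-~ (~-sym (member isB w∈)) , ~⇒≢ (~-sym (member isB w∈))

    removed : Fourth x Y → List (Block n)
    removed F = B₁ ∷ B₂ ∷ to-fill F

    ready : (F : Fourth x Y) → ∀ {κ} → All (Fresh κ) (removed F) → Ready F κ
    ready (nice _) (_ ∷ _ ∷ κY ∷ []) = κY
    ready (solo _) _                 = tt

    solo-coloured : ∀ {t} → Y ≡ one t → ∀ {Bs κ} → (∀ {u} → Any (u ∈ᵇ_) Bs → Any (u ∈ᵇ_) (X ∷ B₁ ∷ B₂ ∷ [])) →
                    (∀ u → S u → ¬ In x Bs u → Coloured κ u) → Coloured κ t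
    solo-coloured {t} refl ⊆ rest = rest t (proj₁ (known isY t refl)) λ where
        (inj₁ t≡x) → proj₂ (known isY t refl) t≡x
        (inj₂ t∈)  → not-in (⊆ t∈)
      where
      not-in : ¬ Any (t ∈ᵇ_) (X ∷ B₁ ∷ B₂ ∷ [])
      not-in (here t∈)                 = clash {X} {Y} (proj₂ (proj₂ (proj₁ aps))) t∈ refl
      not-in (there (here t∈))         = clash {B₁} {Y} (proj₂ (proj₁ (proj₂ aps))) t∈ refl
      not-in (there (there (here t∈))) = clash {B₂} {Y} (proj₂ (proj₂ aps)) t∈ refl

    X-coloured : (F : Fourth x Y) → ∀ {κ} → (∀ u → S u → ¬ In x (removed F) u → Coloured κ u) → ∀ w → w ∈ᵇ X → Coloured κ w
    X-coloured F rest w w∈ = rest w (proj₁ (known isX w w∈)) (not-in F)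
      where
      not-in : (F : Fourth x Y) → ¬ In x (removed F) w
      not-in _        (inj₁ w≡x)                            = proj₂ (known isX w w∈) w≡x
      not-in (nice _) (inj₂ (here w∈′))                     = clash {X} {B₁} (proj₁ (proj₁ aps)) w∈ w∈′
      not-in (nice _) (inj₂ (there (here w∈′)))             = clash {X} {B₂} (proj₁ (proj₂ (proj₁ aps))) w∈ w∈′
      not-in (nice _) (inj₂ (there (there (here w∈′))))     = clash {X} {Y} (proj₂ (proj₂ (proj₁ aps))) w∈ w∈′
      not-in (solo _) (inj₂ (here w∈′))                     = clash {X} {B₁} (proj₁ (proj₁ aps)) w∈ w∈′
      not-in (solo _) (inj₂ (there (here w∈′)))             = clash {X} {B₂} (proj₁ (proj₂ (proj₁ aps))) w∈ w∈′

    fresh₁₂ : (F : Fourth x Y) → ∀ {κ} → All (Fresh κ) (removed F) → Fresh κ B₁ × Fresh κ B₂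
    fresh₁₂ _ (κ₁ ∷ κ₂ ∷ _) = κ₁ , κ₂

    avoiding : (F : Fourth x Y) → ∀ d → (s : Start x (removed F)) → (∀ w → w ∈ᵇ X → Start.κ s w ≢ just d) → Goal
    avoiding F d s X≢d = finish s (proj₂ (proj₂ (avoid-first part N₁ N₂ d F (Start.valid s) (Start.κx s) X≢d
      (proj₁ κ₁₂) (proj₂ κ₁₂) (ready F (Start.fresh s))))) id
      where κ₁₂ = fresh₁₂ F (Start.fresh s)

    elim : ∀ {A : Set} {w} → (w ∈ᵇ X → A) → (w ∈ᵇ B₁ → A) → (w ∈ᵇ B₂ → A) → (w ∈ᵇ Y → A) → x ~ w → A
    elim {A} {w} f f₁ f₂ fY x~w = go (cover part x~w)
      where
      go : Any (w ∈ᵇ_) (X ∷ B₁ ∷ B₂ ∷ Y ∷ []) → A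
      go (here w∈)                         = f w∈
      go (there (here w∈))                 = f₁ w∈
      go (there (there (here w∈)))         = f₂ w∈
      go (there (there (there (here w∈)))) = fY w∈

    -- The pair X has both colours, p being its vertex of colour ●.
    mixed : (F : Fourth x Y) (s : Start x (removed F)) → ∀ {p q} → (∀ w → w ∈ᵇ X → w ≡ p ⊎ w ≡ q) →
            Start.κ s p ≡ just ● → Start.κ s q ≡ just ○ → ¬ Large p → SoftIfSolo F q → Goal
    -- With `x` of colour ●, the vertex `p` and the three refilled blocks cost at most 1 each, which
    -- is exactly the cap.
    mixed (nice NY) s {p} {q} in-X κp κq small _ = finish s
      (centre-with (job N₁ ● ∷ job N₂ ● ∷ job NY ● ∷ []) (is₁ ∷ is₂ ∷ isY ∷ [])
        ((proj₁ (proj₁ (proj₂ aps)) ∷ proj₂ (proj₁ (proj₂ aps)) ∷ []) ∷ (proj₂ (proj₂ aps) ∷ []) ∷ [] ∷ [])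
        (Start.valid s) (Start.κx s) (Start.fresh s) p 1 3
        (λ w x~w κw → elim (λ w∈ → only w κw (in-X w w∈)) (off κw κ₁) (off κw κ₂) (off κw κY) x~w)
        (λ _ → small) (inj₂ ((● , κp) , refl))
        (λ κ′ _ → +-mono-≤ (load≤1 N₁ ● κ′) (+-mono-≤ (load≤1 N₂ ● κ′) (+-mono-≤ (load≤1 NY ● κ′) z≤n))) ≤-refl)
      id
      where
      κ = Start.κ s
      κ₁ = proj₁ (fresh₁₂ (nice NY) (Start.fresh s))
      κ₂ = proj₂ (fresh₁₂ (nice NY) (Start.fresh s))
      κY = ready (nice NY) (Start.fresh s)
      only : ∀ w → κ w ≡ just ● → w ≡ p ⊎ w ≡ q → w ≡ p
      only w κw (inj₁ w≡p)  = w≡p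
      only w κw (inj₂ refl) = contradiction κw (≢opp κq)
      off : ∀ {w B} → κ w ≡ just ● → Fresh κ B → w ∈ᵇ B → w ≡ p
      off κw κB w∈ = contradiction κw (≡∅⇒≢ (κB _ w∈))
    -- Here `x` avoids the colour of `t`, so only one vertex of the pair and two refilled blocks
    -- count: 3 units in either colour.
    mixed (solo {t} soft-t) s {p} {q} in-X κp κq small soft with solo-coloured refl there (Start.rest s)
    ... | ○ , κt = finish s
      (centre-with (job N₁ ● ∷ job N₂ ● ∷ []) (is₁ ∷ is₂ ∷ []) ((proj₁ (proj₁ (proj₂ aps)) ∷ []) ∷ [] ∷ [])
        (Start.valid s) (Start.κx s) (Start.fresh s) p 1 2
        (λ w x~w κw → elim (λ w∈ → only w κw (in-X w w∈)) (off κw (proj₁ κ₁₂)) (off κw (proj₂ κ₁₂))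
          (λ where refl → contradiction κw (≢opp κt)) x~w)
        (λ _ → small) (inj₂ ((● , κp) , refl))
        (λ κ′ _ → +-mono-≤ (load≤1 N₁ ● κ′) (+-mono-≤ (load≤1 N₂ ● κ′) z≤n)) (s≤s (s≤s (s≤s z≤n))))
      id
      where
      κ = Start.κ s
      κ₁₂ = fresh₁₂ (solo soft-t) (Start.fresh s)
      only : ∀ w → κ w ≡ just ● → w ≡ p ⊎ w ≡ q → w ≡ p
      only w κw (inj₁ w≡p)  = w≡p
      only w κw (inj₂ refl) = contradiction κw (≢opp κq)
      off : ∀ {w B} → κ w ≡ just ● → Fresh κ B → w ∈ᵇ B → w ≡ p
      off κw κB w∈ = contradiction κw (≡∅⇒≢ (κB _ w∈))
    ... | ● , κt = finish s
      (centre-with (job N₁ ○ ∷ job N₂ ○ ∷ []) (is₁ ∷ is₂ ∷ []) ((proj₁ (proj₁ (proj₂ aps)) ∷ []) ∷ [] ∷ [])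
        (Start.valid s) (Start.κx s) (Start.fresh s) q 1 2
        (λ w x~w κw → elim (λ w∈ → only w κw (in-X w w∈)) (off κw (proj₁ κ₁₂)) (off κw (proj₂ κ₁₂))
          (λ where refl → contradiction κw (≢opp κt)) x~w)
        (λ _ → soft) (inj₂ ((○ , κq) , refl))
        (λ κ′ _ → +-mono-≤ (load≤1 N₁ ○ κ′) (+-mono-≤ (load≤1 N₂ ○ κ′) z≤n)) ≤-refl)
      id
      where
      κ = Start.κ s
      κ₁₂ = fresh₁₂ (solo soft-t) (Start.fresh s)
      only : ∀ w → κ w ≡ just ○ → w ≡ p ⊎ w ≡ q → w ≡ q
      only w κw (inj₁ refl) = contradiction κw (≢opp κp)
      only w κw (inj₂ w≡q)  = w≡q
      off : ∀ {w B} → κ w ≡ just ○ → Fresh κ B → w ∈ᵇ B → w ≡ q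
      off κw κB w∈ = contradiction κw (≡∅⇒≢ (κB _ w∈))

    -- Each of the four blocks costs at most one unit, and 4 is the cap of ●, so `x` gets ●. A kept
    -- `t` also costs at most 1 and is weak for ●.
    all-nice : (F : Fourth x Y) → Nice x X → Goal
    all-nice (nice NY) NX = finish s
      (centre-with (job NX ● ∷ job N₁ ● ∷ job N₂ ● ∷ job NY ● ∷ []) (Partition.valid part) (apart part)
        (Start.valid s) (Start.κx s) (Start.fresh s) x 0 4
        (λ w x~w κw → ⊥-elim (none (Start.fresh s) κw (cover part x~w))) (λ x~x → contradiction x~x ~-irr) (inj₁ (refl , refl))
        (λ κ′ _ → +-mono-≤ (load≤1 NX ● κ′) (+-mono-≤ (load≤1 N₁ ● κ′) (+-mono-≤ (load≤1 N₂ ● κ′) (+-mono-≤ (load≤1 NY ● κ′) z≤n)))) ≤-refl)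
      id
      where
      s = start x Sx (X ∷ B₁ ∷ B₂ ∷ Y ∷ [])
      none : ∀ {Bs κ w c} → All (Fresh κ) Bs → κ w ≡ just c → ¬ Any (w ∈ᵇ_) Bs
      none (κB ∷ _)  κw (here w∈)  = ≡∅⇒≢ (κB _ w∈) κw
      none (_ ∷ κBs) κw (there w∈) = none κBs κw w∈
    all-nice (solo {t} soft) NX = finish s
      (centre-with (job NX ● ∷ job N₁ ● ∷ job N₂ ● ∷ []) (isX ∷ is₁ ∷ is₂ ∷ [])
        ((proj₁ (proj₁ aps) ∷ proj₁ (proj₂ (proj₁ aps)) ∷ []) ∷ (proj₁ (proj₁ (proj₂ aps)) ∷ []) ∷ [] ∷ [])
        (Start.valid s) (Start.κx s) (Start.fresh s) t 1 3
        (λ w x~w κw → elim (off κw (κB₁ κs)) (off κw (κB₂ κs)) (off κw (κB₃ κs)) id x~w)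
        (λ _ → soft ∘ inj₁) (inj₂ (solo-coloured refl id (Start.rest s) , refl))
        (λ κ′ _ → +-mono-≤ (load≤1 NX ● κ′) (+-mono-≤ (load≤1 N₁ ● κ′) (+-mono-≤ (load≤1 N₂ ● κ′) z≤n))) ≤-refl)
      id
      where
      s = start x Sx (X ∷ B₁ ∷ B₂ ∷ [])
      κs = Start.fresh s
      κB₁ : ∀ {κ} → All (Fresh κ) (X ∷ B₁ ∷ B₂ ∷ []) → Fresh κ X
      κB₁ (p ∷ _) = p
      κB₂ : ∀ {κ} → All (Fresh κ) (X ∷ B₁ ∷ B₂ ∷ []) → Fresh κ B₁
      κB₂ (_ ∷ p ∷ _) = p
      κB₃ : ∀ {κ} → All (Fresh κ) (X ∷ B₁ ∷ B₂ ∷ []) → Fresh κ B₂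
      κB₃ (_ ∷ _ ∷ p ∷ []) = p
      off : ∀ {w B} → Start.κ s w ≡ just ● → Fresh (Start.κ s) B → w ∈ᵇ B → w ≡ t
      off κw κB w∈ = contradiction κw (≡∅⇒≢ (κB _ w∈))

    goal : (F : Fourth x Y) → First F X → Goal
    goal F (nice NX) = all-nice F NX
    goal F (single {u}) with start x Sx (removed F)
    ... | s with X-coloured F (Start.rest s) u refl
    ...   | d , κu = avoiding F (opp d) s λ where w refl → ≢opp κu
    goal F (pair {r} {f} ¬Lr ¬Lf soft-r soft-f) with start x Sx (removed F)
    ... | s with X-coloured F (Start.rest s) r (inj₁ refl) | X-coloured F (Start.rest s) f (inj₂ refl)
    ...   | ○ , κr | ○ , κf = avoiding F ● s λ where
              w (inj₁ refl) → ≢opp κr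
              w (inj₂ refl) → ≢opp κf
    ...   | ● , κr | ● , κf = avoiding F ○ s λ where
              w (inj₁ refl) → ≢opp κr
              w (inj₂ refl) → ≢opp κf
    ...   | ● , κr | ○ , κf = mixed F s (λ _ → id) κr κf ¬Lr soft-f
    ...   | ○ , κr | ● , κf = mixed F s (λ _ → ⊎-swap) κf κr ¬Lf soft-r

-- Reducible vertices with five blocks.

module Reducible₅ {n : ℕ} (g : C45Free n) (S : Fin n → Set) (S-~ : ∀ {u v : Fin n} → C45Free._~_ g u v → S u)
  (colour-rest : ∀ x → S x → (R : Fin n → Set) → (∀ u → Dec (R u)) → R x →
    Σ (Fin n → Maybe Col) λ κ → Colouring.Valid g κ × (∀ u → R u → κ u ≡ nothing) ×
      (∀ u → S u → ¬ R u → ∃ λ c → κ u ≡ just c)) where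
  open Reducible true g S S-~ colour-rest public

  weigh-fresh : ∀ {κ} c B → Fresh κ B → weigh (is c ∘ κ) B ≡ 0
  weigh-fresh c (one w)   κB = is-0 {c} (≡∅⇒≢ (κB w refl))
  weigh-fresh c (two w z) κB = cong₂ _+_ (is-0 {c} (≡∅⇒≢ (κB w (inj₁ refl)))) (is-0 {c} (≡∅⇒≢ (κB z (inj₂ refl))))

  outer-member : ∀ {x B u} → IsBlock x B → x ~ u → Outer x B u → u ∈ᵇ B
  outer-member isB x~u (_ , w , w∈ , w~u) = partner-member isB w∈ x~u w~u

  loads-cong : ∀ {x c Bs κ κ′} (js : All (Job x c) Bs) → All (λ B → ∀ u → Outer x B u → κ′ u ≡ κ u) Bs →
               loads js κ′ ≡ loads js κ
  loads-cong []       []       = refl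
  loads-cong (j ∷ js) (p ∷ ps) = cong₂ _+_ (load-cong j p) (loads-cong js ps)

  -- A degree of at most 1 lets `x` join its class as a leaf. Its neighbour there, if there is one,
  -- is no killer and hence weak; the loads do not depend on whether it is flipped.
  centre-search : ∀ {κ x c Bs} (js : All (Job x c) Bs) → All (IsBlock x) Bs → AllPairs Apart Bs → Valid κ → κ x ≡ nothing →
                  All (Fresh κ) Bs → dg κ x c ≤ 1 → (∀ w → x ~ w → κ w ≡ just c → ¬ Killer w) →
                  dg κ x c + loads js κ ≤ cap c → ∃₂ λ y k → Centred κ x y c Bs k
  centre-search {κ} {x} {c} {Bs} js isBs aps val κx κBs dg≤1 soft room with any? (λ w → T? (a x w) ×-dec just? (κ w) c)
  ... | no ∄w = x , _ , centre-with js isBs aps val κx κBs x 0 (loads js κ)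
        (λ w x~w κw → contradiction (w , x~w , κw) ∄w) (λ x~x → contradiction x~x ~-irr) (inj₁ (refl , refl))
        (λ κ₁ same → ≤-reflexive (loads-cong {κ = κ} {κ₁} js (All.universal (λ B u out → same u (proj₁ out) (proj₁ out)) Bs)))
        (≤-trans (m≤n+m _ (dg κ x c)) room)
  ... | yes (y , x~y , κy) = y , _ , centre-with js isBs aps val κx κBs y 1 (loads js κ) only (λ _ → soft⇒weak c (soft y x~y κy))
        (inj₂ ((c , κy) , refl))
        (λ κ₁ same → ≤-reflexive (loads-cong {κ = κ} {κ₁} js (stable same isBs κBs)))
        (≤-trans (+-monoˡ-≤ (loads js κ) 1≤dg) room)
    where
    only : ∀ w → x ~ w → κ w ≡ just c → w ≡ y
    only w x~w κw with w ≟ y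
    ... | yes w≡y = w≡y
    ... | no w≢y  = contradiction (≤-trans (dg-two {κ} x c w≢y x~w x~y κw κy) dg≤1) λ where (s≤s ())
    1≤dg : 1 ≤ dg κ x c
    1≤dg = ≤-trans (≤-reflexive (sym (trans (cong (_· is c (κ y)) (T⇒≡true x~y)) (trans (cong (is c) κy) (is-just c)))))
             (term≤sum (λ w → a x w · is c (κ w)) y)
    stable : ∀ {κ₁ : Colouring} {Bs} → (∀ u → u ≢ x → u ≢ y → κ₁ u ≡ κ u) → All (IsBlock x) Bs → All (Fresh κ) Bs →
             All (λ B → ∀ u → Outer x B u → κ₁ u ≡ κ u) Bs
    stable same []           []         = []
    stable same (isB ∷ isBs) (κB ∷ κBs) =
      -- An outer vertex that is adjacent to `x` belongs to the block itself, which is uncoloured,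
      -- whereas `y` is coloured.
      (λ u out → same u (proj₁ out) λ where refl → ≡∅⇒≢ (κB u (outer-member isB x~y out)) κy) ∷ stable same isBs κBs

  -- A block that adds at most one neighbour to x, and only for one of the two
  -- colours of x.  A tip is coloured beforehand, and recoloured only if x gets ○.
  data Pure (x : Fin n) : Block n → Set₁ where
    nice : ∀ {B} (N : Nice x B) → (∀ κ → load (job N ○) κ + load (job N ●) κ ≤ 1) → Pure x B
    tip  : ∀ {w} (j : Job x ○ (one w)) → (∀ {κ} → Valid κ → load j κ + is ● (κ w) ≤ 1) → ¬ Killer w → Pure x (one w)

  job○ : ∀ {x B} → Pure x B → Job x ○ B
  job○ (nice N _)  = job N ○
  job○ (tip j _ _) = j

  -- A tip keeps its colour if `x` gets ●, so it costs a unit exactly when it is ● itself.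
  load● : ∀ {x B} → Pure x B → Colouring → ℕ
  load● (nice N _)      κ = load (job N ●) κ
  load● (tip {w} _ _ _) κ = is ● (κ w)

  exclusive : ∀ {x B κ} (p : Pure x B) → Valid κ → load (job○ p) κ + load● p κ ≤ 1
  exclusive (nice _ ex)  _   = ex _
  exclusive (tip _ ex _) val = ex val

  jobs○ : ∀ {x Bs} → All (Pure x) Bs → All (Job x ○) Bs
  jobs○ []       = []
  jobs○ (p ∷ ps) = job○ p ∷ jobs○ ps

  loads● : ∀ {x Bs} → All (Pure x) Bs → Colouring → ℕ
  loads● []       κ = 0
  loads● (p ∷ ps) κ = load● p κ + loads● ps κ

  exclusives : ∀ {x Bs κ} (ps : All (Pure x) Bs) → Valid κ → loads (jobs○ ps) κ + loads● ps κ ≤ length Bs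
  exclusives []       val = z≤n
  exclusives {κ = κ} (p ∷ ps) val = ≤-trans (≤-reflexive (+-interchange (load (job○ p) κ) _ _ _))
    (+-mono-≤ (exclusive p val) (exclusives ps val))

  nices tips : ∀ {x Bs} → All (Pure x) Bs → List (Block n)
  nices []                       = []
  nices (_∷_ {x = B} (nice _ _) ps) = B ∷ nices ps
  nices (tip _ _ _ ∷ ps)         = nices ps
  tips []                              = []
  tips (nice _ _ ∷ ps)                 = tips ps
  tips (_∷_ {x = B} (tip _ _ _) ps)    = B ∷ tips ps

  jobs● : ∀ {x Bs} (ps : All (Pure x) Bs) → All (Job x ●) (nices ps)
  jobs● []                = []
  jobs● (nice N _ ∷ ps)   = job N ● ∷ jobs● ps
  jobs● (tip _ _ _ ∷ ps)  = jobs● ps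

  nices-All : ∀ {x Bs} {P : Block n → Set} (ps : All (Pure x) Bs) → All P Bs → All P (nices ps)
  nices-All []               []       = []
  nices-All (nice _ _ ∷ ps)  (q ∷ qs) = q ∷ nices-All ps qs
  nices-All (tip _ _ _ ∷ ps) (q ∷ qs) = nices-All ps qs

  nices-Apart : ∀ {x Bs} (ps : All (Pure x) Bs) → AllPairs Apart Bs → AllPairs Apart (nices ps)
  nices-Apart []               []       = []
  nices-Apart (nice _ _ ∷ ps)  (q ∷ qs) = nices-All ps q ∷ nices-Apart ps qs
  nices-Apart (tip _ _ _ ∷ ps) (q ∷ qs) = nices-Apart ps qs

  nices⊆ : ∀ {x Bs u} (ps : All (Pure x) Bs) → Any (u ∈ᵇ_) (nices ps) → Any (u ∈ᵇ_) Bs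
  nices⊆ (nice _ _ ∷ ps)  (here u∈)   = here u∈
  nices⊆ (nice _ _ ∷ ps)  (there u∈)  = there (nices⊆ ps u∈)
  nices⊆ (tip _ _ _ ∷ ps) u∈          = there (nices⊆ ps u∈)

  tips⊆ : ∀ {x Bs u} (ps : All (Pure x) Bs) → Any (u ∈ᵇ_) (tips ps) → Any (u ∈ᵇ_) Bs
  tips⊆ (nice _ _ ∷ ps)  u∈          = there (tips⊆ ps u∈)
  tips⊆ (tip _ _ _ ∷ ps) (here u∈)   = here u∈
  tips⊆ (tip _ _ _ ∷ ps) (there u∈)  = there (tips⊆ ps u∈)

  nices⊎tips : ∀ {x Bs u} (ps : All (Pure x) Bs) → Any (u ∈ᵇ_) Bs → Any (u ∈ᵇ_) (nices ps) ⊎ Any (u ∈ᵇ_) (tips ps)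
  nices⊎tips (nice _ _ ∷ ps)  (here u∈)  = inj₁ (here u∈)
  nices⊎tips (tip _ _ _ ∷ ps) (here u∈)  = inj₂ (here u∈)
  nices⊎tips (nice _ _ ∷ ps)  (there u∈) with nices⊎tips ps u∈
  ... | inj₁ u∈′ = inj₁ (there u∈′)
  ... | inj₂ u∈′ = inj₂ u∈′
  nices⊎tips (tip _ _ _ ∷ ps) (there u∈) with nices⊎tips ps u∈
  ... | inj₁ u∈′ = inj₁ u∈′
  ... | inj₂ u∈′ = inj₂ (there u∈′)

  tips-soft : ∀ {x Bs u} (ps : All (Pure x) Bs) → Any (u ∈ᵇ_) (tips ps) → ¬ Killer u
  tips-soft (nice _ _ ∷ ps)     u∈          = tips-soft ps u∈
  tips-soft (tip _ _ soft ∷ ps) (here refl) = soft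
  tips-soft (tip _ _ _ ∷ ps)    (there u∈)  = tips-soft ps u∈

  data Solo : Block n → Set where
    solo : ∀ {s} → ¬ Killer s → Solo (one s)

  fresh-any : ∀ {κ Bs u} → All (Fresh κ) Bs → Any (u ∈ᵇ_) Bs → κ u ≡ nothing
  fresh-any (κB ∷ _)  (here u∈)  = κB _ u∈
  fresh-any (_ ∷ κBs) (there u∈) = fresh-any κBs u∈

  module FiveBlocks {x Q Ps} (part : Partition x (Q ++ Ps)) (Sx : S x) (solos : All Solo Q) (Q≤1 : length Q ≤ 1)
                    (ps : All (Pure x) Ps) (five : length Q + length Ps ≡ 5) where

    split-All : ∀ {P : Block n → Set} Q → All P (Q ++ Ps) → All P Q × All P Ps
    split-All []      all     = [] , all
    split-All (_ ∷ Q) (p ∷ all) = let qs , rs = split-All Q all in p ∷ qs , rs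

    split-Apart : ∀ Q → AllPairs Apart (Q ++ Ps) → AllPairs Apart Ps
    split-Apart []      all       = all
    split-Apart (_ ∷ Q) (_ ∷ all) = split-Apart Q all

    split-Any : ∀ {P : Block n → Set} Q → Any P (Q ++ Ps) → Any P Q ⊎ Any P Ps
    split-Any []      any         = inj₂ any
    split-Any (_ ∷ Q) (here p)    = inj₁ (here p)
    split-Any (_ ∷ Q) (there any) with split-Any Q any
    ... | inj₁ q = inj₁ (there q)
    ... | inj₂ r = inj₂ r

    isPs : All (IsBlock x) Ps
    isPs = proj₂ (split-All Q (Partition.valid part))

    apPs : AllPairs Apart Ps
    apPs = split-Apart Q (apart part)

    s : Start x (nices ps)
    s = start x Sx (nices ps)
    open Start s

    kept : Col → Colouring → ℕ
    kept c κ = ∑ᴸ (weigh (is c ∘ κ)) Q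

    dg-split : ∀ c κ → dg κ x c ≡ kept c κ + ∑ᴸ (weigh (is c ∘ κ)) Ps
    dg-split c κ = trans (sym (Partition.total part (is c ∘ κ))) (∑ᴸ-++ (weigh (is c ∘ κ)) Q Ps)

    kept≤ : ∀ {Q} → All Solo Q → ∑ᴸ (weigh (is ○ ∘ κ)) Q + ∑ᴸ (weigh (is ● ∘ κ)) Q ≤ length Q
    kept≤ []                  = z≤n
    kept≤ (solo {s} _ ∷ sols) = ≤-trans (≤-reflexive (+-interchange (is ○ (κ s)) _ _ _)) (+-mono-≤ (○●-disjoint (κ s)) (kept≤ sols))

    solo-soft : ∀ {Q w} → All Solo Q → Any (w ∈ᵇ_) Q → ¬ Killer w
    solo-soft (solo soft ∷ _) (here refl) = soft
    solo-soft (_ ∷ sols)      (there w∈)  = solo-soft sols w∈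

    -- The tips stay as they are: a ● tip is counted in the degree of `x` and contributes no job, a
    -- nice block contributes a job and no degree. So `loads●` covers both.
    with-● : kept ● κ + loads● ps κ ≤ 1 → Goal
    with-● ≤1 = finish s (proj₂ (proj₂ (centre-search (jobs● ps) (nices-All ps isPs) (nices-Apart ps apPs) valid κx fresh
        (≤-trans (m≤m+n _ _) total≤1) soft (≤-trans total≤1 (s≤s z≤n))))) id
      where
      count : ∀ {Ps} (ps : All (Pure x) Ps) → All (Fresh κ) (nices ps) →
              ∑ᴸ (weigh (is ● ∘ κ)) Ps + loads (jobs● ps) κ ≤ loads● ps κ
      count []              []         = z≤n
      count (_∷_ {x = B} {xs = Bs} (nice N _) ps) (κB ∷ κBs) rewrite weigh-fresh ● B κB =
        ≤-trans (≤-reflexive (+-left (∑ᴸ (weigh (is ● ∘ κ)) Bs) (load (job N ●) κ) (loads (jobs● ps) κ))) (+-monoʳ-≤ (load (job N ●) κ) (count ps κBs))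
        where
        +-left : ∀ p q r → p + (q + r) ≡ q + (p + r)
        +-left = solve-∀
      count (tip {w} _ _ _ ∷ ps) κBs = ≤-trans (≤-reflexive (+-assoc (is ● (κ w)) _ _)) (+-monoʳ-≤ (is ● (κ w)) (count ps κBs))
      total≤1 : dg κ x ● + loads (jobs● ps) κ ≤ 1
      total≤1 = begin
        dg κ x ● + loads (jobs● ps) κ                                            ≡⟨ cong (_+ loads (jobs● ps) κ) (dg-split ● κ) ⟩
        kept ● κ + ∑ᴸ (weigh (is ● ∘ κ)) Ps + loads (jobs● ps) κ                 ≡⟨ +-assoc (kept ● κ) _ _ ⟩
        kept ● κ + (∑ᴸ (weigh (is ● ∘ κ)) Ps + loads (jobs● ps) κ)               ≤⟨ +-monoʳ-≤ (kept ● κ) (count ps fresh) ⟩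
        kept ● κ + loads● ps κ                                                   ≤⟨ ≤1 ⟩
        1                                                                        ∎
        where open ≤-Reasoning
      soft : ∀ w → x ~ w → κ w ≡ just ● → ¬ Killer w
      soft w x~w κw with split-Any Q (cover part x~w)
      ... | inj₁ w∈Q = solo-soft solos w∈Q
      ... | inj₂ w∈P with nices⊎tips ps w∈P
      ...   | inj₁ w∈N = contradiction κw (≡∅⇒≢ (fresh-any fresh w∈N))
      ...   | inj₂ w∈T = tips-soft ps w∈T

    -- The tips are uncoloured, so that their jobs can colour them anew. Then the ○ neighbours of
    -- `x` all come from `Q`, so there is at most one.
    with-○ : kept ○ κ + loads (jobs○ ps) κ ≤ 3 → Goal
    with-○ ≤3 = Centred.κ′ C , Centred.valid C , col
      where
      tip? : ∀ u → Dec (Any (u ∈ᵇ_) (tips ps))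
      tip? u = Any.any? (u ∈ᵇ?_) (tips ps)
      κ₁ : Colouring
      κ₁ u with tip? u
      ... | yes _ = nothing
      ... | no _  = κ u
      κ₁-sub : ∀ u c → κ₁ u ≡ just c → κ u ≡ just c
      κ₁-sub u c κ₁u with tip? u
      κ₁-sub u c () | yes _
      ... | no _ = κ₁u
      κ₁-tip : ∀ u → Any (u ∈ᵇ_) (tips ps) → κ₁ u ≡ nothing
      κ₁-tip u u∈ with tip? u
      ... | yes _ = refl
      ... | no u∉ = contradiction u∈ u∉
      κ₁-∅ : ∀ u → κ u ≡ nothing → κ₁ u ≡ nothing
      κ₁-∅ u κu with tip? u
      ... | yes _ = refl
      ... | no _  = κu
      val₁ : Valid κ₁
      val₁ = shrink valid κ₁-sub
      κ₁x : κ₁ x ≡ nothing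
      κ₁x = κ₁-∅ x κx
      freshP : ∀ u → Any (u ∈ᵇ_) Ps → κ₁ u ≡ nothing
      freshP u u∈ with nices⊎tips ps u∈
      ... | inj₁ u∈N = κ₁-∅ u (fresh-any fresh u∈N)
      ... | inj₂ u∈T = κ₁-tip u u∈T
      fresh₁ : All (Fresh κ₁) Ps
      fresh₁ = all-fresh Ps freshP
        where
        all-fresh : ∀ Bs → (∀ u → Any (u ∈ᵇ_) Bs → κ₁ u ≡ nothing) → All (Fresh κ₁) Bs
        all-fresh []       f = []
        all-fresh (B ∷ Bs) f = (λ w w∈ → f w (here w∈)) ∷ all-fresh Bs (λ u u∈ → f u (there u∈))
      weigh-mono : ∀ B → weigh (is ○ ∘ κ₁) B ≤ weigh (is ○ ∘ κ) B
      weigh-mono (one w)   = is-mono ○ (κ₁-sub w ○)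
      weigh-mono (two w z) = +-mono-≤ (is-mono ○ (κ₁-sub w ○)) (is-mono ○ (κ₁-sub z ○))
      dg₁≤ : dg κ₁ x ○ ≤ kept ○ κ
      dg₁≤ = begin
        dg κ₁ x ○                                     ≡⟨ dg-split ○ κ₁ ⟩
        kept ○ κ₁ + ∑ᴸ (weigh (is ○ ∘ κ₁)) Ps         ≤⟨ +-mono-≤
          (∑ᴸ-≤ (weigh (is ○ ∘ κ₁)) (weigh (is ○ ∘ κ)) (All.universal weigh-mono Q))
          (∑ᴸ-≤ (weigh (is ○ ∘ κ₁)) (λ _ → 0) (All.map (λ {B} κB → ≤-reflexive (weigh-fresh ○ B κB)) fresh₁)) ⟩
        kept ○ κ + ∑ᴸ (λ _ → 0) Ps                    ≡⟨ cong (kept ○ κ +_) (trans (∑ᴸ-const 0 Ps) (*-zeroʳ (length Ps))) ⟩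
        kept ○ κ + 0                                  ≡⟨ +-identityʳ _ ⟩
        kept ○ κ                                      ∎
        where open ≤-Reasoning
      -- Uncolouring the tips does not affect the loads: tips are adjacent to `x`, and an outer
      -- vertex adjacent to `x` lies in its own block, which is uncoloured anyway or consists of a
      -- single vertex, not adjacent to itself.
      stable : ∀ {Ps} (ps′ : All (Pure x) Ps) → (∀ u → ¬ Any (u ∈ᵇ_) (tips ps) → κ₁ u ≡ κ u) →
               All (IsBlock x) Ps → All (Fresh κ) (nices ps′) → All (λ B → ∀ u → Outer x B u → κ₁ u ≡ κ u) Ps
      stable []                            eq []           []         = []
      stable (_∷_ {x = B} (nice _ _) ps′) eq (isB ∷ isBs) (κB ∷ κBs) = at ∷ stable ps′ eq isBs κBs
        where
        at : ∀ u → Outer x B u → κ₁ u ≡ κ u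
        at u out with T? (a x u)
        ... | yes x~u = let κu = κB u (outer-member isB x~u out) in trans (κ₁-∅ u κu) (sym κu)
        ... | no x≁u  = eq u λ u∈T → x≁u (tip~x u∈T)
          where
          tip~x : Any (u ∈ᵇ_) (tips ps) → x ~ u
          tip~x u∈T = any-member isPs (tips⊆ ps u∈T)
            where
            any-member : ∀ {Bs} → All (IsBlock x) Bs → Any (u ∈ᵇ_) Bs → x ~ u
            any-member (isB ∷ _)  (here u∈)  = member isB u∈
            any-member (_ ∷ isBs) (there u∈) = any-member isBs u∈
      stable (tip {w} _ _ _ ∷ ps′) eq (isB ∷ isBs) κBs = at ∷ stable ps′ eq isBs κBs
        where
        at : ∀ u → Outer x (one w) u → κ₁ u ≡ κ u
        at u out@(_ , .w , refl , w~u) with T? (a x u)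
        ... | yes x~u = contradiction (subst (w ~_) (outer-member isB x~u out) w~u) ~-irr
        ... | no x≁u  = eq u λ u∈T → x≁u (any-member isPs (tips⊆ ps u∈T))
          where
          any-member : ∀ {Bs} → All (IsBlock x) Bs → Any (u ∈ᵇ_) Bs → x ~ u
          any-member (isB ∷ _)  (here u∈)  = member isB u∈
          any-member (_ ∷ isBs) (there u∈) = any-member isBs u∈
      κ₁-at : ∀ u → ¬ Any (u ∈ᵇ_) (tips ps) → κ₁ u ≡ κ u
      κ₁-at u u∉ with tip? u
      ... | yes u∈ = contradiction u∈ u∉
      ... | no _   = refl
      loads≡ : loads (jobs○ ps) κ₁ ≡ loads (jobs○ ps) κ
      loads≡ = loads-cong (jobs○ ps) (stable ps κ₁-at isPs fresh)
      soft : ∀ w → x ~ w → κ₁ w ≡ just ○ → ¬ Killer w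
      soft w x~w κ₁w with split-Any Q (cover part x~w)
      ... | inj₁ w∈Q = solo-soft solos w∈Q
      ... | inj₂ w∈P = contradiction κ₁w (≡∅⇒≢ (freshP w w∈P))
      found = centre-search {κ₁} (jobs○ ps) isPs apPs val₁ κ₁x fresh₁
        (≤-trans dg₁≤ (≤-trans (≤-trans (m≤m+n _ _) (kept≤ solos)) Q≤1))
        soft (≤-trans (+-mono-≤ dg₁≤ (≤-reflexive loads≡)) ≤3)
      C = proj₂ (proj₂ found)
      col : ∀ u → S u → Coloured (Centred.κ′ C) u
      col u Su with u ≟ x | Any.any? (u ∈ᵇ?_) Ps
      ... | yes refl | _       = ○ , Centred.centre C
      ... | no _     | yes u∈P = Centred.filled C u u∈P
      ... | no u≢x   | no u∉P  with rest u Su (λ where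
              (inj₁ u≡x) → u≢x u≡x
              (inj₂ u∈N) → u∉P (nices⊆ ps u∈N))
      ...   | c , κu = Centred.grow C u (c , trans (κ₁-at u (u∉P ∘ tips⊆ ps)) κu)

    goal : Goal
    goal with kept ○ κ + loads (jobs○ ps) κ ≤? 3
    ... | yes ≤3 = with-○ ≤3
    -- Over both colours the kept vertices and the loads add up to at most 5. If ○ costs at least 4,
    -- at most 1 remains for ●.
    ... | no ≰3  = with-● (+-cancelˡ-≤ 4 _ _ (begin
      4 + (kept ● κ + loads● ps κ)                                              ≤⟨ +-monoˡ-≤ _ (≰⇒> ≰3) ⟩
      kept ○ κ + loads (jobs○ ps) κ + (kept ● κ + loads● ps κ)                  ≡⟨ +-interchange (kept ○ κ) _ _ _ ⟩
      kept ○ κ + kept ● κ + (loads (jobs○ ps) κ + loads● ps κ)                  ≤⟨ +-mono-≤ (kept≤ solos) (exclusives ps valid) ⟩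
      length Q + length Ps                                                      ≡⟨ five ⟩
      5                                                                         ∎))
      where
      open ≤-Reasoning

-- A triangular 2-vertex together with a mid vertex that can be recoloured.

module NeedyPair {n : ℕ} (g : C45Free n) where
  open Centres true g public
  module Close = Centres false g

  -- Two steps that avoid `x` cannot lead from the block to another neighbour of `x`, as this would
  -- close a 4-cycle through `x`.
  near-member : ∀ {x B u} → IsBlock x B → x ~ u → Near x B u → u ∈ᵇ B
  near-member isB x~u (u≢x , inj₁ u∈)                   = u∈
  near-member isB x~u (u≢x , inj₂ (inj₁ (w , w∈ , w~u))) = partner-member isB w∈ x~u w~u
  near-member {u = u} isB x~u (u≢x , inj₂ (inj₂ (_ , w , z , w∈ , w~z , z≢x , z~u))) with w ≟ u
  ... | yes refl = w∈
  ... | no w≢u   = ⊥-elim (noC4 (member isB w∈) w~z z~u (~-sym x~u) (z≢x ∘ sym) w≢u)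

  apart-sym : ∀ {B B′} → Apart B B′ → Apart B′ B
  apart-sym ap w w′ w∈ w′∈ = let w≢ , w≁ = ap w′ w w′∈ w∈ in w≢ ∘ sym , w≁ ∘ ~-sym

  -- t is a triangular 2-vertex and y can be given either colour; then y is
  -- given the colour that x has not, so that t becomes free to be ●.
  module _ {x B t y} (isB : IsBlock x B) (t∈ : t ∈ᵇ B) (y∈ : y ∈ᵇ B) (in-B : ∀ w → w ∈ᵇ B → w ≡ t ⊎ w ≡ y)
           (nbrs : Nbrs₂ t x y) {X B₁ B₂ Y} (part : Partition y (X ∷ B₁ ∷ B₂ ∷ Y ∷ [])) (t∈X : t ∈ᵇ X) (x∈X : x ∈ᵇ X)
           (in-X : ∀ w → w ∈ᵇ X → w ≡ t ⊎ w ≡ x) (N₁ : Close.Nice y B₁) (N₂ : Close.Nice y B₂) (F : Close.Fourth y Y) where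

    private
      Bs : List (Block n)
      Bs = B₁ ∷ B₂ ∷ Close.to-fill F

      to-All : ∀ {P : Block n → Set} → P Y → All P (Close.to-fill F)
      to-All pY = go F pY
        where
        go : ∀ {P : Block n → Set} {Y} (F : Close.Fourth y Y) → P Y → All P (Close.to-fill F)
        go (Close.nice _) pY = pY ∷ []
        go (Close.solo _) _  = []

      sub : ∀ {P : Block n → Set} → All P (X ∷ B₁ ∷ B₂ ∷ Y ∷ []) → All P Bs
      sub (_ ∷ p₁ ∷ p₂ ∷ pY ∷ []) = p₁ ∷ p₂ ∷ to-All pY

      isX : IsBlock y X
      isX = All.head (Partition.valid part)

      isBs : All (IsBlock y) Bs
      isBs = sub (Partition.valid part)

      apX : All (Apart X) (B₁ ∷ B₂ ∷ Y ∷ [])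
      apX = AllPairs.head (apart part)

      apBs : All (Apart X) Bs
      apBs with apX
      ... | p₁ ∷ p₂ ∷ pY ∷ [] = p₁ ∷ p₂ ∷ to-All pY

      apY : Apart X Y
      apY with apX
      ... | _ ∷ _ ∷ pY ∷ [] = pY

      x≢t : x ≢ t
      x≢t refl = ~-irr (proj₁ nbrs)
      x~y : x ~ y
      x~y = member isB y∈

    module Run {c κ} (val : Valid κ) (κx : κ x ≡ just c) (κB : Fresh κ B)
               (room : dg κ x c + is ● (just c) ≤ cap c) where

      in? : ∀ u → Dec (Any (u ∈ᵇ_) Bs)
      in? u = Any.any? (u ∈ᵇ?_) Bs

      κ₁ : Colouring
      κ₁ u with in? u
      ... | yes _ = nothing
      ... | no _  = κ u

      κ₁-in : ∀ u → Any (u ∈ᵇ_) Bs → κ₁ u ≡ nothing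
      κ₁-in u u∈ with in? u
      ... | yes _ = refl
      ... | no u∉ = contradiction u∈ u∉

      κ₁-out : ∀ u → ¬ Any (u ∈ᵇ_) Bs → κ₁ u ≡ κ u
      κ₁-out u u∉ with in? u
      ... | yes u∈ = contradiction u∈ u∉
      ... | no _   = refl

      κ₁-sub : ∀ u c → κ₁ u ≡ just c → κ u ≡ just c
      κ₁-sub u c κ₁u with in? u
      κ₁-sub u c () | yes _
      ... | no _ = κ₁u

      κ₁-∅ : ∀ u → κ u ≡ nothing → κ₁ u ≡ nothing
      κ₁-∅ u κu with in? u
      ... | yes _ = refl
      ... | no _  = κu

      found : ∃ λ y′ → (y′ ≡ y ⊎ y′ ∈ᵇ Y) × Close.Centred κ₁ y y′ (opp c) Bs 3
      -- Of the block `X` of `y`, the vertex `t` is uncoloured and `x` has the colour `c`, so `X`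
      -- avoids `opp c`.
      found = Close.avoid-first part N₁ N₂ (opp c) F (shrink val κ₁-sub) (κ₁-∅ y (κB y y∈)) X≢
        (λ w w∈ → κ₁-in w (here w∈)) (λ w w∈ → κ₁-in w (there (here w∈))) (ready F (λ w w∈ → κ₁-in w (there (there w∈))))
        where
        X≢ : ∀ w → w ∈ᵇ X → κ₁ w ≢ just (opp c)
        X≢ w w∈ κ₁w with in-X w w∈
        ... | inj₁ refl = ≡∅⇒≢ (κB t t∈) (κ₁-sub w _ κ₁w)
        ... | inj₂ refl = ≢opp κx (κ₁-sub w _ κ₁w)
        ready : ∀ {Y} (F : Close.Fourth y Y) → (∀ w → Any (w ∈ᵇ_) (Close.to-fill F) → κ₁ w ≡ nothing) → Close.Ready F κ₁
        ready (Close.nice _) f = λ w w∈ → f w (here w∈)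
        ready (Close.solo _) f = tt

      open Close.Centred (proj₂ (proj₂ found)) using () renaming
        (κ′ to κ₂; valid to val₂; centre to κ₂y; filled to filled₂; grow to grow₂; same to same₂; low to low₂) public

      y′ : Fin n
      y′ = proj₁ found

      unchanged : ∀ u → u ≢ y → ¬ u ∈ᵇ Y → All (λ B′ → ¬ Close.Near y B′ u) Bs → κ₂ u ≡ κ u
      unchanged u u≢y u∉Y far = trans (same₂ u u≢y u≢y′ far) (κ₁-out u (outside far))
        where
        u≢y′ : u ≢ y′
        u≢y′ u≡y′ with proj₁ (proj₂ found)
        ... | inj₁ y′≡y = u≢y (trans u≡y′ y′≡y)
        ... | inj₂ y′∈  = u∉Y (subst (_∈ᵇ Y) (sym u≡y′) y′∈)
        outside : ∀ {Bs} → All (λ B′ → ¬ Close.Near y B′ u) Bs → ¬ Any (u ∈ᵇ_) Bs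
        outside (p ∷ _)  (here u∈)  = p (u≢y , inj₁ u∈)
        outside (_ ∷ ps) (there u∈) = outside ps u∈

      κ₂-X : ∀ w → w ∈ᵇ X → κ₂ w ≡ κ w
      κ₂-X w w∈ = unchanged w (~⇒≢ (~-sym (member isX w∈))) (λ w∈Y → proj₁ (apY w w w∈ w∈Y) refl) (fars isBs apBs)
        where
        fars : ∀ {Bs} → All (IsBlock y) Bs → All (Apart X) Bs → All (λ B′ → ¬ Close.Near y B′ w) Bs
        fars []         []         = []
        fars (is ∷ iss) (ap ∷ aps) = Close.apart⇒far is isX (apart-sym ap) (inj₁ w∈) ∷ fars iss aps

      -- The jobs at `y` reach the neighbours of the neighbours of `y`, thus vertices at distance
      -- two from the block of `x`. This is what the last alternative of `Near` provides for.
      κ₂-far : ∀ u → u ≢ x → ¬ Near x B u → κ₂ u ≡ κ u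
      κ₂-far u u≢x ¬near = unchanged u (λ where refl → ¬near (u≢x , inj₁ y∈))
        (λ u∈Y → beside (member (All.lookup (Partition.valid part) Y∈) u∈Y)) (fars isBs apBs)
        where
        Y∈ : Any (Y ≡_) (X ∷ B₁ ∷ B₂ ∷ Y ∷ [])
        Y∈ = there (there (there (here refl)))
        beside : ¬ y ~ u
        beside y~u = ¬near (u≢x , inj₂ (inj₁ (y , y∈ , y~u)))
        fars : ∀ {Bs} → All (IsBlock y) Bs → All (Apart X) Bs → All (λ B′ → ¬ Close.Near y B′ u) Bs
        fars []         []         = []
        fars (is ∷ iss) (ap ∷ aps) = far ∷ fars iss aps
          where
          far : ¬ Close.Near y _ u
          far (_ , inj₁ u∈)                     = beside (member is u∈)
          far (_ , inj₂ (inj₁ (w , w∈ , w~u)))  = ¬near (u≢x , inj₂ (inj₂ (tt , y , w , y∈ , member is w∈ , w≢x , w~u)))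
            where
            w≢x : w ≢ x
            w≢x w≡x = proj₁ (ap x w x∈X w∈) (sym w≡x)
          far (_ , inj₂ (inj₂ (() , _)))

      κ₂x : κ₂ x ≡ just c
      κ₂x = trans (κ₂-X x x∈X) κx

      κ₂t : κ₂ t ≡ nothing
      κ₂t = trans (κ₂-X t t∈X) (κB t t∈)

      κ₂-nbr : ∀ w → x ~ w → κ₂ w ≡ just c → κ w ≡ just c
      κ₂-nbr w x~w κ₂w with w ∈ᵇ? B
      ... | no w∉ = trans (sym (κ₂-far w (~⇒≢ (~-sym x~w)) (w∉ ∘ near-member isB x~w))) κ₂w
      ... | yes w∈ with in-B w w∈
      ...   | inj₁ refl = contradiction κ₂w (≡∅⇒≢ κ₂t)
      ...   | inj₂ refl = contradiction κ₂w (opp≢ κ₂y)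

      κ₃ : Colouring
      κ₃ = κ₂ [ t ≔ just ● ]

      nbrs-t : ∀ w → t ~ w → w ≡ x ⊎ w ≡ y
      nbrs-t = proj₂ (proj₂ nbrs)

      done : ∀ k → Valid κ₃ → dg κ₃ x c ≤ dg κ x c + k → Done κ x c B k
      done k val₃ gain = record
        { κ′      = κ₃
        ; valid   = val₃
        ; colours = λ w w∈ → colours (in-B w w∈)
        ; same    = λ u ¬near → same u ¬near (u ≟ x)
        ; grow    = grow
        ; gain    = gain
        }
        where
        colours : ∀ {w} → w ≡ t ⊎ w ≡ y → Coloured κ₃ w
        colours (inj₁ refl) = ● , ≔-same κ₂ t (just ●)
        colours (inj₂ refl) = grow-≔ κ₂ t ● y (opp c , κ₂y)
        same : ∀ u → ¬ Near x B u → Dec (u ≡ x) → κ₃ u ≡ κ u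
        same u ¬near (yes refl) = trans (≔-other κ₂ (just ●) x≢t) (κ₂-X x x∈X)
        same u ¬near (no u≢x)   = trans (≔-other κ₂ (just ●) λ where refl → ¬near (u≢x , inj₁ t∈)) (κ₂-far u u≢x ¬near)
        grow : ∀ u → Coloured κ u → Coloured κ₃ u
        grow u (d , κu) with in? u
        ... | yes u∈ = grow-≔ κ₂ t ● u (filled₂ u u∈)
        ... | no u∉  = grow-≔ κ₂ t ● u (grow₂ u (d , trans (κ₁-out u u∉) κu))

    -- The vertex `y` takes the colour that `x` does not have and costs nothing; `t` becomes ● and
    -- costs a unit only if `x` is ● too. So the load does not depend on the colouring.
    job-needy : ∀ c → Job x c B
    job-needy c = record { load = λ _ → is ● (just c) ; load-cong = λ _ → refl ; run = go c }
      where
      go : ∀ c {κ} → Valid κ → κ x ≡ just c → Fresh κ B → dg κ x c + is ● (just c) ≤ cap c → Done κ x c B (is ● (just c))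
      go ○ {κ} val κx κB room = done 0 val₃ (≤-trans (dg-mono {κ} {κ₃} x ○ back) (m≤m+n _ _))
        where
        open Run val κx κB room
        val₃ : Valid κ₃
        -- The vertex `y` has been given at most three neighbours of its colour ●, so `t` is the
        -- fourth at most.
        val₃ = extend y val₂ only (λ _ _ → s≤s low₂) κ₂t
          where
          only : ∀ w → t ~ w → κ₂ w ≡ just ● → w ≡ y
          only w t~w κ₂w with nbrs-t w t~w
          ... | inj₁ refl = contradiction κ₂w (≢opp κ₂x)
          ... | inj₂ w≡y  = w≡y
        back : ∀ w → x ~ w → κ₃ w ≡ just ○ → κ w ≡ just ○
        back w x~w κ₃w = κ₂-nbr w x~w (≔-opp {κ₂} {t} w κ₃w)
      go ● {κ} val κx κB room = done 1 val₃ (dg-step {κ} {κ₃} x ● t split)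
        where
        open Run val κx κB room
        val₃ : Valid κ₃
        -- Now `y` is ○, so `t` is attached to `x`, which has room for it by assumption.
        val₃ = extend x val₂ only (λ _ _ → ≤-trans (s≤s (dg-mono {κ} {κ₂} x ● κ₂-nbr)) (≤-trans (≤-reflexive (+-comm 1 _)) room)) κ₂t
          where
          only : ∀ w → t ~ w → κ₂ w ≡ just ● → w ≡ x
          only w t~w κ₂w with nbrs-t w t~w
          ... | inj₁ w≡x  = w≡x
          ... | inj₂ refl = contradiction κ₂w (opp≢ κ₂y)
        split : ∀ w → x ~ w → κ₃ w ≡ just ● → κ w ≡ just ● ⊎ w ≡ t
        split w x~w κ₃w with ≔-cases κ₂ t (just ●) w
        ... | inj₁ (w≡t , _)  = inj₂ w≡t
        ... | inj₂ (_ , same) = inj₁ (κ₂-nbr w x~w (trans (sym same) κ₃w))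

    nice-needy : Nice x B
    nice-needy = record { job = job-needy ; load≤1 = λ where
      ○ κ → z≤n
      ● κ → ≤-refl }

-- Reducible vertices of degree at most three.

module Degrees {n : ℕ} (g : C45Free n) where
  open NeedyPair g public

  distinct≤deg : ∀ {v} ws → AllPairs _≢_ ws → All (v ~_) ws → length ws ≤ deg v
  distinct≤deg {v} ws dis adj = subst (_≤ deg v) (sum-marks adj) (sumₐ-mono v λ w _ → marks≤1 ws dis w)
    where
    marks : List (Fin n) → Fin n → ℕ
    marks ws w = ∑ᴸ (λ u → δ u w) ws
    marks-0 : ∀ {ws w} → All (w ≢_) ws → marks ws w ≡ 0
    marks-0 []         = refl
    marks-0 (w≢ ∷ w≢s) = cong₂ _+_ (δ-≢ w≢) (marks-0 w≢s)
    marks≤1 : ∀ ws → AllPairs _≢_ ws → ∀ w → marks ws w ≤ 1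
    marks≤1 []       []          w = z≤n
    marks≤1 (u ∷ us) (u≢ ∷ dis) w with w ≟ u
    ... | yes refl rewrite marks-0 u≢ = s≤s z≤n
    ... | no _     = marks≤1 us dis w
    sum-marks : ∀ {ws} → All (v ~_) ws → sumₐ v (marks ws) ≡ length ws
    sum-marks []              = sum-0 _ λ w → ·-0 (a v w)
    sum-marks (_∷_ {x = u} {xs = us} v~u adj) =
      trans (sumₐ-+ v (δ u) (marks us)) (cong₂ _+_ (sumₐ-δ v~u) (sum-marks adj))

  another-in : ∀ {v} (P : Fin n → Bool) ws → length ws < sumₐ v (λ w → P w · 1) → ∃ λ w → v ~ w × T (P w) × All (w ≢_) ws
  another-in {v} P ws few with any? (λ w → T? (a v w) ×-dec (T? (P w) ×-dec All.all? (λ u → ¬? (w ≟ u)) ws))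
  ... | yes found = found
  ... | no ∄w     = contradiction (≤-trans (sumₐ-mono v {λ w → P w · 1} {marks ws} λ w v~w → marked ws w (T? (P w)) λ Pw new → ∄w (w , v~w , Pw , new))
                      (bound ws)) (<⇒≱ few)
    where
    marks : List (Fin n) → Fin n → ℕ
    marks ws w = ∑ᴸ (λ u → δ u w) ws
    marked : ∀ ws w → Dec (T (P w)) → (T (P w) → ¬ All (w ≢_) ws) → P w · 1 ≤ marks ws w
    marked ws w (no ¬Pw) _ rewrite ¬T⇒≡false ¬Pw = z≤n
    marked ws w (yes Pw) old rewrite T⇒≡true Pw = once ws (old tt)
      where
      once : ∀ ws → ¬ All (w ≢_) ws → 1 ≤ marks ws w
      once []       old = contradiction [] old
      once (u ∷ us) old with w ≟ u
      ... | yes refl = s≤s z≤n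
      ... | no w≢u   = once us (λ new → old (w≢u ∷ new))
    bound : ∀ ws → sumₐ v (marks ws) ≤ length ws
    bound []       = ≤-reflexive (sum-0 _ λ w → ·-0 (a v w))
    bound (u ∷ us) = ≤-trans (≤-reflexive (sumₐ-+ v (δ u) (marks us))) (+-mono-≤ (sumₐ-δ≤1 v u) (bound us))

  another : ∀ {v} ws → length ws < deg v → ∃ λ w → v ~ w × All (w ≢_) ws
  another ws few = let w , v~w , _ , new = another-in (λ _ → true) ws few in w , v~w , new

  nbrs₂ : ∀ {v x} → deg v ≡ 2 → v ~ x → ∃ λ b → Nbrs₂ v x b × x ≢ b
  nbrs₂ {v} {x} deg≡2 v~x with another (x ∷ []) (subst (1 <_) (sym deg≡2) ≤-refl)
  ... | b , v~b , b≢x ∷ [] = b , (v~x , v~b , only) , b≢x ∘ sym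
    where
    only : ∀ w → v ~ w → w ≡ x ⊎ w ≡ b
    only w v~w with w ≟ x | w ≟ b
    ... | yes w≡x | _       = inj₁ w≡x
    ... | no _    | yes w≡b = inj₂ w≡b
    ... | no w≢x  | no w≢b  = contradiction (subst (3 ≤_) deg≡2
            (distinct≤deg (w ∷ x ∷ b ∷ []) ((w≢x ∷ w≢b ∷ []) ∷ ((b≢x ∘ sym) ∷ []) ∷ [] ∷ []) (v~w ∷ v~x ∷ v~b ∷ [])))
            λ where (s≤s (s≤s ()))

  nbrs₃ : ∀ {v x e} → deg v ≡ 3 → v ~ x → v ~ e → x ≢ e → ∃ λ f → Nbrs₃ v x e f
  nbrs₃ {v} {x} {e} deg≡3 v~x v~e x≢e with another (x ∷ e ∷ []) (subst (2 <_) (sym deg≡3) ≤-refl)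
  ... | f , v~f , f≢x ∷ f≢e ∷ [] = f , (v~x , v~e , v~f) , (x≢e , f≢x ∘ sym , f≢e ∘ sym) , only
    where
    only : ∀ w → v ~ w → w ≡ x ⊎ w ≡ e ⊎ w ≡ f
    only w v~w with w ≟ x | w ≟ e | w ≟ f
    ... | yes w≡x | _       | _       = inj₁ w≡x
    ... | no _    | yes w≡e | _       = inj₂ (inj₁ w≡e)
    ... | no _    | no _    | yes w≡f = inj₂ (inj₂ w≡f)
    ... | no w≢x  | no w≢e  | no w≢f  = contradiction (subst (4 ≤_) deg≡3
            (distinct≤deg (w ∷ x ∷ e ∷ f ∷ []) ((w≢x ∷ w≢e ∷ w≢f ∷ []) ∷ (x≢e ∷ (f≢x ∘ sym) ∷ []) ∷ ((f≢e ∘ sym) ∷ []) ∷ [] ∷ [])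
              (v~w ∷ v~x ∷ v~e ∷ v~f ∷ [])))
            λ where (s≤s (s≤s (s≤s ())))

  m≤deg : ∀ v → m v ≤ deg v
  m≤deg v = begin
    m v                            ≡⟨ trans (∑ᴸ-const 1 (blocks v)) (*-identityʳ (m v)) ⟨
    ∑ᴸ (λ _ → 1) (blocks v)        ≤⟨ ∑ᴸ-≤ (λ _ → 1) (weigh (λ _ → 1)) (All.universal 1≤weigh (blocks v)) ⟩
    ∑ᴸ (weigh (λ _ → 1)) (blocks v) ≡⟨ sum-blocks v (λ _ → 1) ⟩
    deg v                          ∎
    where
    open ≤-Reasoning
    1≤weigh : ∀ (B : Block n) → 1 ≤ weigh (λ _ → 1) B
    1≤weigh (one _)   = ≤-refl
    1≤weigh (two _ _) = s≤s z≤n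

  killer⇒4≤m : ∀ {v} → Killer v → 4 ≤ m v
  killer⇒4≤m (inj₁ 5≤m)       = <⇒≤ 5≤m
  killer⇒4≤m (inj₂ (m≡4 , _)) = ≤-reflexive (sym m≡4)

  killer⇒4≤deg : ∀ {v} → Killer v → 4 ≤ deg v
  killer⇒4≤deg {v} K = ≤-trans (killer⇒4≤m K) (m≤deg v)

  deg≤3⇒soft : ∀ {v} → deg v ≤ 3 → ¬ Killer v
  deg≤3⇒soft deg≤3 K = <⇒≱ (s≤s deg≤3) (killer⇒4≤deg K)

  deg≡2⇒soft : ∀ {v} → deg v ≡ 2 → ¬ Killer v
  deg≡2⇒soft deg≡2 = deg≤3⇒soft (subst (_≤ 3) (sym deg≡2) (s≤s (s≤s z≤n)))

  deg≡3⇒soft : ∀ {v} → deg v ≡ 3 → ¬ Killer v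
  deg≡3⇒soft deg≡3 = deg≤3⇒soft (≤-reflexive deg≡3)

  -- The third alternative covers a triangular 2-vertex between two killers that are not large: it
  -- can be ○ if both are ●, and otherwise ● beside at most one ● neighbour, which only has to be
  -- weak for ●.
  Bad : Fin n → Set
  Bad v = deg v ≤ 1
        ⊎ (deg v ≡ 2 × ∃ λ w → v ~ w × ¬ Killer w)
        ⊎ (deg v ≡ 2 × ∃ λ w → v ~ w × ¬ Large w × ∃ λ z → v ~ z × w ~ z × ¬ Large z)
        ⊎ (deg v ≡ 3 × ¬ ∃ λ w → v ~ w × Killer w)

  abstract
    bad? : ∀ v → Dec (Bad v)
    bad? v = (deg v ≤? 1)
      ⊎-dec (((deg v ≟ᴺ 2) ×-dec any? λ w → T? (a v w) ×-dec ¬? (killer? w))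
      ⊎-dec (((deg v ≟ᴺ 2) ×-dec any? λ w → T? (a v w) ×-dec (¬? (large? w) ×-dec any? λ z → T? (a v z) ×-dec (T? (a w z) ×-dec ¬? (large? z))))
      ⊎-dec ((deg v ≟ᴺ 3) ×-dec ¬? (any? λ w → T? (a v w) ×-dec killer? w))))

  module BadReducible (S : Fin n → Set) (S-~ : ∀ {u v : Fin n} → u ~ v → S u)
    (colour-rest : ∀ x → S x → (R : Fin n → Set) → (∀ u → Dec (R u)) → R x →
      Σ (Fin n → Maybe Col) λ κ → Valid κ × (∀ u → R u → κ u ≡ nothing) × (∀ u → S u → ¬ R u → ∃ λ c → κ u ≡ just c)) where

    Goal : Set₁
    Goal = Σ Colouring λ κ → Valid κ × (∀ u → S u → Coloured κ u)

    reinsert : ∀ {v} → S v → (∀ κ → ∃₂ λ c y → (∀ w → v ~ w → κ w ≡ just c → w ≡ y) × (v ~ y → Weak c y)) → Goal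
    reinsert {v} Sv choose with colour-rest v Sv (_≡ v) (_≟ v) refl
    ... | κ , val , off , on with choose κ
    ...   | c , y , only , weak = Step.κ′ s , Step.valid s , col
      where
      s : Step κ v c y
      s = colour-weak c y val (off v refl) only weak
      col : ∀ u → S u → Coloured (Step.κ′ s) u
      col u Su with u ≟ v
      ... | yes refl = c , Step.at s
      ... | no u≢v   = step-grow s u (on u Su u≢v)

    bad⇒goal : ∀ {v} → S v → Bad v → Goal
    bad⇒goal {v} Sv (inj₁ deg≤1) = reinsert Sv choose
      where
      choose : ∀ κ → ∃₂ λ c y → (∀ w → v ~ w → κ w ≡ just c → w ≡ y) × (v ~ y → Weak c y)
      choose κ with any? (λ w → T? (a v w) ×-dec just? (κ w) ○)
      ... | no ∄w = ○ , v , (λ w v~w κw → contradiction (w , v~w , κw) ∄w) , λ v~v → contradiction v~v ~-irr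
      ... | yes (z , v~z , κz) = ● , v , (λ w v~w κw → contradiction
              (distinct≤deg (w ∷ z ∷ []) (((λ where refl → ≢opp κz κw) ∷ []) ∷ [] ∷ []) (v~w ∷ v~z ∷ [])) (<⇒≱ (s≤s deg≤1)))
              , λ v~v → contradiction v~v ~-irr
    bad⇒goal {v} Sv (inj₂ (inj₁ (deg≡2 , z , v~z , soft))) with nbrs₂ deg≡2 v~z
    ... | b , (_ , _ , only) , _ = reinsert Sv choose
      where
      choose : ∀ κ → ∃₂ λ c y → (∀ w → v ~ w → κ w ≡ just c → w ≡ y) × (v ~ y → Weak c y)
      choose κ with just? (κ b) ●
      ... | yes κb = ○ , z , only-z , λ _ → soft
        where
        only-z : ∀ w → v ~ w → κ w ≡ just ○ → w ≡ z
        only-z w v~w κw with only w v~w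
        ... | inj₁ w≡z  = w≡z
        ... | inj₂ refl = contradiction κw (≢opp κb)
      ... | no ¬κb = ● , z , only-z , λ _ → soft ∘ inj₁
        where
        only-z : ∀ w → v ~ w → κ w ≡ just ● → w ≡ z
        only-z w v~w κw with only w v~w
        ... | inj₁ w≡z  = w≡z
        ... | inj₂ refl = contradiction κw ¬κb
    bad⇒goal {v} Sv (inj₂ (inj₂ (inj₁ (deg≡2 , p , v~p , ¬Lp , q , v~q , p~q , ¬Lq)))) with nbrs₂ deg≡2 v~p
    ... | b , (_ , v~b , only) , _ = reinsert Sv choose
      where
      b≡q : b ≡ q
      b≡q with only q v~q
      ... | inj₁ refl = contradiction p~q ~-irr
      ... | inj₂ q≡b  = sym q≡b
      choose : ∀ κ → ∃₂ λ c y → (∀ w → v ~ w → κ w ≡ just c → w ≡ y) × (v ~ y → Weak c y)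
      choose κ with just? (κ p) ● | just? (κ b) ●
      ... | no ¬κp | _ = ● , b , only-b , λ _ → subst (¬_ ∘ Large) (sym b≡q) ¬Lq
        where
        only-b : ∀ w → v ~ w → κ w ≡ just ● → w ≡ b
        only-b w v~w κw with only w v~w
        ... | inj₁ refl = contradiction κw ¬κp
        ... | inj₂ w≡b  = w≡b
      ... | yes _ | no ¬κb = ● , p , only-p , λ _ → ¬Lp
        where
        only-p : ∀ w → v ~ w → κ w ≡ just ● → w ≡ p
        only-p w v~w κw with only w v~w
        ... | inj₁ w≡p  = w≡p
        ... | inj₂ refl = contradiction κw ¬κb
      ... | yes κp | yes κb = ○ , v , none , λ v~v → contradiction v~v ~-irr
        where
        none : ∀ w → v ~ w → κ w ≡ just ○ → w ≡ v
        none w v~w κw with only w v~w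
        ... | inj₁ refl = contradiction κw (≢opp κp)
        ... | inj₂ refl = contradiction κw (≢opp κb)
    bad⇒goal {v} Sv (inj₂ (inj₂ (inj₂ (deg≡3 , none)))) with another [] (subst (0 <_) (sym deg≡3) (s≤s z≤n))
    ... | e , v~e , _ with another (e ∷ []) (subst (1 <_) (sym deg≡3) (s≤s (s≤s z≤n)))
    ...   | f , v~f , f≢e ∷ [] with nbrs₃ deg≡3 v~e v~f (f≢e ∘ sym)
    ...     | h , (_ , _ , v~h) , _ , only = reinsert Sv choose
      where
      weak : ∀ c y → v ~ y → Weak c y
      weak ○ y v~y K = none (y , v~y , K)
      weak ● y v~y L = none (y , v~y , inj₁ L)
      choose : ∀ κ → ∃₂ λ c y → (∀ w → v ~ w → κ w ≡ just c → w ≡ y) × (v ~ y → Weak c y)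
      -- Of the three neighbours, two are ● and at most one is ○, or two are not ● and at most one
      -- is ●.
      choose κ with just? (κ e) ● | just? (κ f) ● | just? (κ h) ●
      ... | yes κe | yes κf | _ = ○ , h , (λ w v~w κw → pick w κw (only w v~w)) , weak ○ h
        where
        pick : ∀ w → κ w ≡ just ○ → w ≡ e ⊎ w ≡ f ⊎ w ≡ h → w ≡ h
        pick w κw (inj₁ refl)        = contradiction κw (≢opp κe)
        pick w κw (inj₂ (inj₁ refl)) = contradiction κw (≢opp κf)
        pick w κw (inj₂ (inj₂ eq))   = eq
      ... | yes κe | no _ | yes κh = ○ , f , (λ w v~w κw → pick w κw (only w v~w)) , weak ○ f
        where
        pick : ∀ w → κ w ≡ just ○ → w ≡ e ⊎ w ≡ f ⊎ w ≡ h → w ≡ f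
        pick w κw (inj₁ refl)        = contradiction κw (≢opp κe)
        pick w κw (inj₂ (inj₁ eq))   = eq
        pick w κw (inj₂ (inj₂ refl)) = contradiction κw (≢opp κh)
      ... | yes _ | no ¬κf | no ¬κh = ● , e , (λ w v~w κw → pick w κw (only w v~w)) , weak ● e
        where
        pick : ∀ w → κ w ≡ just ● → w ≡ e ⊎ w ≡ f ⊎ w ≡ h → w ≡ e
        pick w κw (inj₁ eq)          = eq
        pick w κw (inj₂ (inj₁ refl)) = contradiction κw ¬κf
        pick w κw (inj₂ (inj₂ refl)) = contradiction κw ¬κh
      ... | no _ | yes κf | yes κh = ○ , e , (λ w v~w κw → pick w κw (only w v~w)) , weak ○ e
        where
        pick : ∀ w → κ w ≡ just ○ → w ≡ e ⊎ w ≡ f ⊎ w ≡ h → w ≡ e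
        pick w κw (inj₁ eq)          = eq
        pick w κw (inj₂ (inj₁ refl)) = contradiction κw (≢opp κf)
        pick w κw (inj₂ (inj₂ refl)) = contradiction κw (≢opp κh)
      ... | no ¬κe | yes _ | no ¬κh = ● , f , (λ w v~w κw → pick w κw (only w v~w)) , weak ● f
        where
        pick : ∀ w → κ w ≡ just ● → w ≡ e ⊎ w ≡ f ⊎ w ≡ h → w ≡ f
        pick w κw (inj₁ refl)        = contradiction κw ¬κe
        pick w κw (inj₂ (inj₁ eq))   = eq
        pick w κw (inj₂ (inj₂ refl)) = contradiction κw ¬κh
      ... | no ¬κe | no ¬κf | _ = ● , h , (λ w v~w κw → pick w κw (only w v~w)) , weak ● h
        where
        pick : ∀ w → κ w ≡ just ● → w ≡ e ⊎ w ≡ f ⊎ w ≡ h → w ≡ h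
        pick w κw (inj₁ refl)        = contradiction κw ¬κe
        pick w κw (inj₂ (inj₁ refl)) = contradiction κw ¬κf
        pick w κw (inj₂ (inj₂ eq))   = eq

-- Discharging

module Payments {n : ℕ} (g : C45Free n) (good : ∀ {v w : Fin n} → C45Free._~_ g v w → ¬ Degrees.Bad g v) where
  open Degrees g public

  two-killers : ∀ {v w} → deg v ≡ 2 → v ~ w → Killer w
  two-killers {w = w} deg≡2 v~w with killer? w
  ... | yes K = K
  ... | no ¬K = contradiction (inj₂ (inj₁ (deg≡2 , w , v~w , ¬K))) (good v~w)

  two-large : ∀ {v w z} → deg v ≡ 2 → v ~ w → v ~ z → w ~ z → ¬ Large w → Large z
  two-large {w = w} {z} deg≡2 v~w v~z w~z ¬Lw with large? z
  ... | yes L = L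
  ... | no ¬L = contradiction (inj₂ (inj₂ (inj₁ (deg≡2 , w , v~w , ¬Lw , z , v~z , w~z , ¬L)))) (good v~w)

  three-killer : ∀ {v x} → deg v ≡ 3 → v ~ x → ∃ λ w → v ~ w × Killer w
  three-killer {v} deg≡3 v~x with any? (λ w → T? (a v w) ×-dec killer? w)
  ... | yes found = found
  ... | no none   = contradiction (inj₂ (inj₂ (inj₂ (deg≡3 , none)))) (good v~x)

  Tri Q : Fin n → Set
  Tri v = ∃ λ w → v ~ w × Tr v w
  Q v   = deg v ≡ 2 × Tri v

  abstract
    tri? : ∀ v → Dec (Tri v)
    tri? v = any? λ w → T? (a v w) ×-dec tr? v w

  abstract
    Q? : ∀ v → Dec (Q v)
    Q? v = (deg v ≟ᴺ 2) ×-dec tri? v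

  OnKept : Fin n → Fin n → Set
  OnKept x w = ∃ λ z → x ~ z × w ~ z × ¬ Q z

  abstract
    onKept? : ∀ x w → Dec (OnKept x w)
    onKept? x w = any? λ z → T? (a x z) ×-dec (T? (a w z) ×-dec ¬? (Q? z))

  -- The charges are doubled, and the triangular 2-vertices are left out.
  base : Fin n → Fin n → ℕ
  base x w = not (does (Q? w)) · (3 + not (does (onKept? x w)) · 1)

  -- A mid vertex is excused from paying `v` if their edge lies in a triangle and `v` has a large
  -- neighbour, which then pays.
  Payer : Fin n → Fin n → Set
  Payer u v = Killer u × (Large u ⊎ ¬ (Tr v u × ∃ λ w → v ~ w × Large w))

  abstract
    payer? : ∀ u v → Dec (Payer u v)
    payer? u v = killer? u ×-dec (large? u ⊎-dec ¬? (tr? v u ×-dec any? λ w → T? (a v w) ×-dec large? w))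

  -- A triangular 3-vertex without a triangular 2-vertex beside it has at least 3 + 3 + 4 units. The
  -- missing two come from a single payer, or one each from several.
  npay share : Fin n → ℕ
  npay v  = sumₐ v λ u → does (payer? u v) · 1
  share v = 1 + does (npay v ≤? 1) · 1

  -- A 2-vertex off triangles has 4 + 4 units and two killer neighbours, so each of them pays it 2.
  Two Three : Fin n → Fin n → Set
  Two u v   = deg v ≡ 2 × ¬ Tri v × Killer u
  Three u v = deg v ≡ 3 × Tri v × Payer u v

  abstract
    two? : ∀ u v → Dec (Two u v)
    two? u v = (deg v ≟ᴺ 2) ×-dec (¬? (tri? v) ×-dec killer? u)

  abstract
    three? : ∀ u v → Dec (Three u v)
    three? u v = (deg v ≟ᴺ 3) ×-dec (tri? v ×-dec payer? u v)

  -- pay₀ u v and pay₁ u v: what u pays to its neighbour v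
  pay₀ : Fin n → Fin n → ℕ
  pay₀ u v = does (two? u v) · 2 + does (three? u v) · share v

  -- Need is measured against `pay₀` alone, so that the second round of payments `pay₁` may depend
  -- on it without circularity.
  Needy : Fin n → Set
  Needy v = Mid v × sumₐ v (base v) < 12 + sumₐ v (pay₀ v)

  abstract
    needy? : ∀ v → Dec (Needy v)
    needy? v = mid? v ×-dec (sumₐ v (base v) <? 12 + sumₐ v (pay₀ v))

  Helps : Fin n → Fin n → Set
  Helps u v = Large u × Needy v × ∃ λ t → u ~ t × v ~ t × Q t

  abstract
    helps? : ∀ u v → Dec (Helps u v)
    helps? u v = large? u ×-dec (needy? v ×-dec any? λ t → T? (a u t) ×-dec (T? (a v t) ×-dec Q? t))

  pay₁ pay : Fin n → Fin n → ℕ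
  pay₁ u v = does (helps? u v) · 2
  pay u v  = pay₀ u v + pay₁ u v

  does-no : ∀ {P : Set} (P? : Dec P) {k} → ¬ P → does P? · k ≡ 0
  does-no (yes p) ¬p = contradiction p ¬p
  does-no (no _)  _  = refl

  does-yes : ∀ {P : Set} (P? : Dec P) {k} → P → does P? · k ≡ k
  does-yes (yes _) _ = refl
  does-yes (no ¬p) p = contradiction p ¬p

  does-≤ : ∀ {P : Set} (P? : Dec P) {k} → does P? · k ≤ k
  does-≤ (yes _) = ≤-refl
  does-≤ (no _)  = z≤n

  not-does-yes : ∀ {P : Set} (P? : Dec P) {k} → ¬ P → not (does P?) · k ≡ k
  not-does-yes (yes p) ¬p = contradiction p ¬p
  not-does-yes (no _)  _  = refl

  3≤base : ∀ {x w} → ¬ Q w → 3 ≤ base x w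
  3≤base {x} {w} ¬Qw rewrite not-does-yes (Q? w) {3 + not (does (onKept? x w)) · 1} ¬Qw = m≤m+n 3 _

  4≤base : ∀ {x w} → ¬ Q w → ¬ OnKept x w → 4 ≤ base x w
  4≤base {x} {w} ¬Qw ¬on rewrite not-does-yes (Q? w) {3 + not (does (onKept? x w)) · 1} ¬Qw | not-does-yes (onKept? x w) {1} ¬on = ≤-refl

  pay₀-0 : ∀ {u v} → ¬ Two u v → ¬ Three u v → pay₀ u v ≡ 0
  pay₀-0 {u} {v} ¬2 ¬3 = cong₂ _+_ (does-no (two? u v) ¬2) (does-no (three? u v) ¬3)

  pay₀≤2 : ∀ u v → pay₀ u v ≤ 2
  pay₀≤2 u v with deg v ≟ᴺ 2
  ... | yes deg≡2 = subst (_≤ 2) (sym (trans (cong (does (two? u v) · 2 +_) (does-no (three? u v) λ where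
            (deg≡3 , _) → contradiction (trans (sym deg≡2) deg≡3) λ ())) (+-identityʳ _))) (does-≤ (two? u v))
  ... | no deg≢2 = subst (_≤ 2) (sym (cong (_+ does (three? u v) · share v) (does-no (two? u v) (deg≢2 ∘ proj₁))))
            (≤-trans (does-≤ (three? u v)) (s≤s (does-≤ (npay v ≤? 1))))

  pay₀≤1 : ∀ {x w y} → deg w ≡ 3 → w ~ x → w ~ y → y ≢ x → Payer y w → pay₀ x w ≤ 1
  pay₀≤1 {x} {w} {y} deg≡3 w~x w~y y≢x py with payer? x w
  ... | no ¬px = ≤-trans (≤-reflexive (pay₀-0 {x} {w} (λ where (deg≡2 , _) → contradiction (trans (sym deg≡2) deg≡3) λ ())
                   (¬px ∘ proj₂ ∘ proj₂))) z≤n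
  ... | yes px = subst (_≤ 1) (sym (cong (_+ does (three? x w) · share w) (does-no (two? x w)
                   λ where (deg≡2 , _) → contradiction (trans (sym deg≡2) deg≡3) λ ())))
                   (≤-trans (does-≤ (three? x w)) (≤-reflexive (cong suc (does-no (npay w ≤? 1) (<⇒≱ 2≤npay)))))
    where
    at : ∀ {u} → w ~ u → Payer u w → a w u · (does (payer? u w) · 1) ≡ 1
    at {u} w~u pu rewrite T⇒≡true w~u = does-yes (payer? u w) pu
    2≤npay : 2 ≤ npay w
    2≤npay = subst (_≤ npay w) (cong₂ _+_ (at w~y py) (at w~x px)) (two-terms≤sum (λ u → a w u · (does (payer? u w) · 1)) y≢x)

  mid⇒¬large : ∀ {x} → Mid x → ¬ Large x
  mid⇒¬large (m≡4 , _) L = <⇒≢ L (sym m≡4)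

  -- A large neighbour of `w` pays, and differs from the mid vertex `x`. If there is none, the
  -- killer `e` is not excused.
  other-payer : ∀ {x w e} → Mid x → w ~ e → Killer e → e ≢ x → ∃ λ y → y ≢ x × w ~ y × Payer y w
  other-payer {x} {w} {e} Mx w~e Ke e≢x with any? (λ y → T? (a w y) ×-dec large? y)
  ... | yes (y , w~y , Ly) = y , (λ where refl → mid⇒¬large Mx Ly) , w~y , inj₁ Ly , inj₁ Ly
  ... | no none            = e , e≢x , w~e , Ke , inj₂ (none ∘ proj₂)

  Val : (Fin n → Fin n → ℕ) → Fin n → Block n → ℕ → Set
  Val p x B k = weigh (p x) B + k ≤ weigh (base x) B

  -- The index is a lower bound on what the block leaves to `x` after the payments `pay₀`. A single
  -- vertex brings 4, a pair without a triangular 2-vertex at least 3 + 3, a pair with one 4. Four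
  -- blocks have to leave 12, so only the cheap kinds cause a deficit, and these carry what the
  -- recolouring needs.
  data MidKind (x : Fin n) : Block n → ℕ → Set₁ where
    N  : ∀ {B} → Close.Nice x B → (∀ w → w ∈ᵇ B → ¬ Killer w) → MidKind x B 2
    S₁ : ∀ {w} → ¬ Killer w → MidKind x (one w) 3
    U  : ∀ {u} → MidKind x (one u) 4
    P₄ : ∀ {r f} → ¬ Killer r → ¬ Killer f → MidKind x (two r f) 4
    P₅ : ∀ {r f} → ¬ Large r → ¬ Large f → MidKind x (two r f) 5
    Q₄ : ∀ {B t u} → t ∈ᵇ B → u ∈ᵇ B → (∀ w → w ∈ᵇ B → w ≡ t ⊎ w ≡ u) → Q t → Nbrs₂ t x u → MidKind x B 4
    H  : ∀ {B} → MidKind x B 6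

  ¬≡2∧≡3 : ∀ {k} → k ≡ 2 → k ≢ 3
  ¬≡2∧≡3 refl ()

  -- The edge from `w` to `x` lies in no triangle, so a triangle at `w` uses its other two
  -- neighbours.
  Tri-other : ∀ {w x e f} → Nbrs₃ w x e f → Tri w → (∀ z → x ~ z → ¬ w ~ z) → e ~ f
  Tri-other {w} {x} {e} {f} (_ , _ , only) (u , w~u , z , t) alone with common w u z t
  ... | w~z , u~z with only u w~u | only z w~z
  ...   | inj₁ refl        | _                = contradiction w~z (alone z u~z)
  ...   | _                | inj₁ refl        = contradiction w~u (alone u (~-sym u~z))
  ...   | inj₂ (inj₁ refl) | inj₂ (inj₁ refl) = contradiction u~z ~-irr
  ...   | inj₂ (inj₁ refl) | inj₂ (inj₂ refl) = u~z
  ...   | inj₂ (inj₂ refl) | inj₂ (inj₁ refl) = ~-sym u~z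
  ...   | inj₂ (inj₂ refl) | inj₂ (inj₂ refl) = contradiction u~z ~-irr

  someNbrs₃ : ∀ {w x} → deg w ≡ 3 → w ~ x → ∃₂ λ e f → Nbrs₃ w x e f
  someNbrs₃ {w} {x} deg≡3 w~x with another (x ∷ []) (subst (1 <_) (sym deg≡3) (s≤s (s≤s z≤n)))
  ... | e , w~e , e≢x ∷ [] = e , nbrs₃ deg≡3 w~x w~e (e≢x ∘ sym)

  -- If `w` were a triangular 2-vertex, its triangle would use both its neighbours, hence contain
  -- `x`; but a single block has no common neighbour with `x`.
  single-base : ∀ {x w} → IsBlock x (one w) → 4 ≤ base x w
  single-base {x} {w} (x~w , alone) = 4≤base ¬Qw (λ where (z , x~z , w~z , _) → alone z x~z w~z)
    where
    ¬Qw : ¬ Q w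
    ¬Qw (deg≡2 , u , w~u , z , t) with nbrs₂ deg≡2 (~-sym x~w) | common w u z t
    ... | b , (_ , _ , only) , _ | w~z , u~z with only u w~u | only z w~z
    ...   | inj₁ refl | _         = alone z u~z w~z
    ...   | _         | inj₁ refl = alone u (~-sym u~z) w~u
    ...   | inj₂ refl | inj₂ refl = ~-irr u~z

  -- For a triangular 3-vertex, either both other neighbours are soft and `job-3` applies, or a
  -- killer among them guarantees a second payer and halves the share of `x`.
  mid-one : ∀ {x w} → Mid x → IsBlock x (one w) → ∃ λ k → MidKind x (one w) k × Val pay₀ x (one w) k
  mid-one {x} {w} Mx isB@(x~w , alone) with deg w ≟ᴺ 2 | deg w ≟ᴺ 3 | tri? w
  ... | yes deg≡2 | _ | _ with nbrs₂ deg≡2 (~-sym x~w)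
  ...   | b , nb , x≢b = 2 , N (record { job = λ c → Close.job-2 isB nb x≢b ; load≤1 = λ c κ → is≤1 (opp c) (κ b) }) (λ where _ refl → deg≡2⇒soft deg≡2)
                           , ≤-trans (+-monoˡ-≤ 2 (pay₀≤2 x w)) (single-base isB)
  mid-one {x} {w} Mx isB@(x~w , alone) | no deg≢2 | yes deg≡3 | yes Tw with someNbrs₃ deg≡3 (~-sym x~w)
  ...   | e , f , nb@((_ , w~e , w~f) , (x≢e , x≢f , _) , _) with killer? e | killer? f
  ...     | no ¬Ke | no ¬Kf = 2 , N (record
            { job    = λ c → Close.job-3 isB nb (Close.soft⇒weak (opp c) ¬Ke) (Close.soft⇒weak (opp c) ¬Kf)
            ; load≤1 = λ c κ → *-mono-≤ (is≤1 (opp c) (κ e)) (is≤1 (opp c) (κ f)) }) (λ where _ refl → deg≡3⇒soft deg≡3)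
            , ≤-trans (+-monoˡ-≤ 2 (pay₀≤2 x w)) (single-base isB)
  ...     | yes Ke | _ with other-payer Mx w~e Ke (x≢e ∘ sym)
  ...       | y , y≢x , w~y , py = 3 , S₁ (deg≡3⇒soft deg≡3) , ≤-trans (+-monoˡ-≤ 3 (pay₀≤1 deg≡3 (~-sym x~w) w~y y≢x py)) (single-base isB)
  mid-one {x} {w} Mx isB@(x~w , alone) | no deg≢2 | yes deg≡3 | yes Tw | e , f , nb@((_ , w~e , w~f) , (x≢e , x≢f , _) , _) | no _ | yes Kf
      with other-payer Mx w~f Kf (x≢f ∘ sym)
  ... | y , y≢x , w~y , py = 3 , S₁ (deg≡3⇒soft deg≡3) , ≤-trans (+-monoˡ-≤ 3 (pay₀≤1 deg≡3 (~-sym x~w) w~y y≢x py)) (single-base isB)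
  mid-one {x} {w} Mx isB | no deg≢2 | no deg≢3 | _ = 4 , U ,
    subst (λ k → k + 4 ≤ base x w) (sym (pay₀-0 {x} {w} (deg≢2 ∘ proj₁) (deg≢3 ∘ proj₁))) (single-base isB)
  mid-one {x} {w} Mx isB | no deg≢2 | yes _ | no ¬Tw = 4 , U ,
    subst (λ k → k + 4 ≤ base x w) (sym (pay₀-0 {x} {w} (deg≢2 ∘ proj₁) (¬Tw ∘ proj₁ ∘ proj₂))) (single-base isB)

  pair-Tri : ∀ {x p q} → x ~ p → x ~ q → p ~ q → Tri p
  pair-Tri {x} {p} {q} x~p x~q p~q = x , ~-sym x~p , q , ∧-intro {a p q} p~q x~q

  third-alone : ∀ {x p q y} → Nbrs₃ p x q y → x ~ q → ¬ Tr p y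
  third-alone {x} {p} {q} {y} ((p~x , p~q , p~y) , (_ , x≢y , q≢y) , only) x~q (z , t) with common p y z t
  ... | p~z , y~z with only z p~z
  ...   | inj₁ refl        = q≢y (third-unique p~x p~q x~q p~y (~-sym y~z))
  ...   | inj₂ (inj₁ refl) = x≢y (third-unique p~q p~x (~-sym x~q) p~y (~-sym y~z))
  ...   | inj₂ (inj₂ refl) = ~-irr y~z

  module Pair33 {x p q} (x~p : x ~ p) (x~q : x ~ q) (p~q : p ~ q) (deg-p : deg p ≡ 3) (deg-q : deg q ≡ 3) where

    third-p : ∃ λ y → Nbrs₃ p x q y
    third-p = nbrs₃ deg-p (~-sym x~p) p~q (~⇒≢ x~q)
    third-q : ∃ λ z → Nbrs₃ q x p z
    third-q = nbrs₃ deg-q (~-sym x~q) (~-sym p~q) (~⇒≢ x~p)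

    -- The edge from `p` to its third neighbour lies in no triangle, so a killer there is never
    -- excused and `x` is not the only payer of `p`.
    half : ∀ {p q y} → x ~ p → x ~ q → deg p ≡ 3 → Nbrs₃ p x q y → Killer y → pay₀ x p ≤ 1
    half x~p x~q deg-p nb@((_ , _ , p~y) , (_ , x≢y , _) , _) Ky =
      pay₀≤1 deg-p (~-sym x~p) p~y (x≢y ∘ sym) (Ky , inj₂ (third-alone nb x~q ∘ proj₁))

    both-killers : Killer (proj₁ third-p) → Killer (proj₁ third-q) → pay₀ x p + pay₀ x q ≤ 2
    both-killers Ky Kz = +-mono-≤ (half x~p x~q deg-p (proj₂ third-p) Ky) (half x~q x~p deg-q (proj₂ third-q) Kz)

  6≤base : ∀ {x p q} → ¬ Q p → ¬ Q q → 6 ≤ base x p + base x q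
  6≤base ¬Qp ¬Qq = +-mono-≤ (3≤base ¬Qp) (3≤base ¬Qq)

  pay-sum : ∀ {x p q i j k} → pay₀ x p ≤ i → pay₀ x q ≤ j → ¬ Q p → ¬ Q q → i + j + k ≤ 6 →
            pay₀ x p + pay₀ x q + k ≤ base x p + base x q
  pay-sum {k = k} pp pq ¬Qp ¬Qq small = ≤-trans (+-monoˡ-≤ k (+-mono-≤ pp pq)) (≤-trans small (6≤base ¬Qp ¬Qq))

  Q-pay : ∀ {x t} → Q t → pay₀ x t ≡ 0
  Q-pay {x} {t} (deg≡2 , T) = pay₀-0 {x} {t} (λ where (_ , ¬T , _) → ¬T T) (λ where (deg≡3 , _) → ¬≡2∧≡3 deg≡2 deg≡3)

  killer-pay : ∀ {x u} → Killer u → pay₀ x u ≡ 0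
  killer-pay {x} {u} K = pay₀-0 {x} {u} (λ where (deg≡2 , _) → deg≡2⇒soft deg≡2 K) (λ where (deg≡3 , _) → deg≡3⇒soft deg≡3 K)

  killer⇒¬Q : ∀ {u} → Killer u → ¬ Q u
  killer⇒¬Q K (deg≡2 , _) = deg≡2⇒soft deg≡2 K

  -- The only triangle on the edge `x u` is the one through `t`, which is left out, so this edge
  -- counts as one off triangles.
  Q-base : ∀ {x t u} → x ~ t → x ~ u → t ~ u → Q t → 4 ≤ base x u
  Q-base x~t x~u t~u Qt = 4≤base (killer⇒¬Q (two-killers (proj₁ Qt) t~u))
    (λ where (z , x~z , u~z , ¬Qz) → ¬Qz (subst Q (third-unique x~u x~t (~-sym t~u) x~z u~z) Qt))

  Q-nbrs : ∀ {x t u} → x ~ t → x ~ u → t ~ u → Q t → Nbrs₂ t x u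
  Q-nbrs {x} {t} {u} x~t x~u t~u (deg≡2 , _) with nbrs₂ deg≡2 (~-sym x~t)
  ... | b , nb@(_ , _ , only) , _ with only u t~u
  ...   | inj₁ refl = contradiction x~u ~-irr
  ...   | inj₂ refl = nb

  mid-two : ∀ {x p q} → Mid x → IsBlock x (two p q) → ∃ λ k → MidKind x (two p q) k × Val pay₀ x (two p q) k
  mid-two {x} {p} {q} Mx isB@(x~p , x~q , p~q) = by-degree (Q? p) (Q? q) (deg p ≟ᴺ 3) (deg q ≟ᴺ 3)
    where
    not-2 : ∀ {p q} → x ~ p → x ~ q → p ~ q → ¬ Q p → deg p ≢ 2
    not-2 x~p x~q p~q ¬Qp deg≡2 = ¬Qp (deg≡2 , pair-Tri x~p x~q p~q)

    swapped : ∀ {k} → pay₀ x q + pay₀ x p + k ≤ base x q + base x p → Val pay₀ x (two p q) k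
    swapped {k} = subst₂ _≤_ (cong (_+ k) (+-comm (pay₀ x q) _)) (+-comm (base x q) _)

    -- If `q` is large, `x` is excused and all 6 units remain. If `q` is a killer but not large, `p`
    -- has a payer besides `x`, which thus pays 1. If `q` is no killer, `x` pays at most 2.
    lopsided : ∀ {p q} → x ~ p → x ~ q → p ~ q → ¬ Q p → ¬ Q q → deg p ≡ 3 → deg q ≢ 3 →
               (¬ Killer q × pay₀ x p + pay₀ x q + 4 ≤ base x p + base x q)
               ⊎ (¬ Large q × pay₀ x p + pay₀ x q + 5 ≤ base x p + base x q)
               ⊎ (pay₀ x p + pay₀ x q + 6 ≤ base x p + base x q)
    lopsided {p} {q} x~p x~q p~q ¬Qp ¬Qq deg-p deg-q with large? q | killer? q
    ... | yes Lq | _ = inj₂ (inj₂ (pay-sum {x} {p} {q} (≤-reflexive none) (≤-reflexive pay-q) ¬Qp ¬Qq ≤-refl))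
      where
      pay-q = killer-pay {x} {q} (inj₁ Lq)
      none : pay₀ x p ≡ 0
      none = pay₀-0 {x} {p} (λ where (deg≡2 , _) → ¬≡2∧≡3 deg≡2 deg-p) λ where
        (_ , _ , _ , inj₁ Lx)     → mid⇒¬large Mx Lx
        (_ , _ , _ , inj₂ ¬both) → ¬both ((q , ∧-intro {a p q} p~q x~q) , q , p~q , Lq)
    ... | no ¬Lq | yes Kq with other-payer Mx p~q Kq (~⇒≢ (~-sym x~q))
    ...   | y , y≢x , p~y , py = inj₂ (inj₁ (¬Lq , pay-sum {x} {p} {q} (pay₀≤1 deg-p (~-sym x~p) p~y y≢x py)
                                   (≤-reflexive (killer-pay {x} {q} Kq)) ¬Qp ¬Qq ≤-refl))
    lopsided {p} {q} x~p x~q p~q ¬Qp ¬Qq deg-p deg-q | no ¬Lq | no ¬Kq =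
      inj₁ (¬Kq , pay-sum {x} {p} {q} (pay₀≤2 x p) (≤-reflexive none) ¬Qp ¬Qq ≤-refl)
      where
      none : pay₀ x q ≡ 0
      none = pay₀-0 {x} {q} (not-2 x~q x~p (~-sym p~q) ¬Qq ∘ proj₁) (deg-q ∘ proj₁)

    by-degree : Dec (Q p) → Dec (Q q) → Dec (deg p ≡ 3) → Dec (deg q ≡ 3) →
                ∃ λ k → MidKind x (two p q) k × Val pay₀ x (two p q) k
    by-degree (yes Qp) _ _ _ = 4 , Q₄ (inj₁ refl) (inj₂ refl) (λ _ → id) Qp (Q-nbrs x~p x~q p~q Qp) ,
      subst₂ (λ i j → i + j + 4 ≤ base x p + base x q) (sym (Q-pay {x} {p} Qp)) (sym (killer-pay {x} {q} (two-killers (proj₁ Qp) p~q)))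
        (≤-trans (Q-base x~p x~q p~q Qp) (m≤n+m _ (base x p)))
    by-degree (no _) (yes Qq) _ _ = 4 , Q₄ (inj₂ refl) (inj₁ refl) (λ _ → ⊎-swap) Qq (Q-nbrs x~q x~p (~-sym p~q) Qq) ,
      subst₂ (λ i j → i + j + 4 ≤ base x p + base x q) (sym (killer-pay {x} {p} (two-killers (proj₁ Qq) (~-sym p~q)))) (sym (Q-pay {x} {q} Qq))
        (≤-trans (Q-base x~q x~p (~-sym p~q) Qq) (m≤m+n _ _))
    by-degree (no ¬Qp) (no ¬Qq) (yes deg-p) (yes deg-q) = by-third (killer? (proj₁ third-p)) (killer? (proj₁ third-q))
      where
      open Pair33 x~p x~q p~q deg-p deg-q
      softs : ∀ w → w ≡ p ⊎ w ≡ q → ¬ Killer w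
      softs w (inj₁ refl) = deg≡3⇒soft deg-p
      softs w (inj₂ refl) = deg≡3⇒soft deg-q
      by-third : Dec (Killer (proj₁ third-p)) → Dec (Killer (proj₁ third-q)) → ∃ λ k → MidKind x (two p q) k × Val pay₀ x (two p q) k
      by-third (no soft) _ = 2 , N (record
        { job    = λ c → Close.job-33 isB (inj₁ refl) (inj₂ refl) (λ _ → id) (proj₂ third-p) (proj₂ third-q) soft
        ; load≤1 = λ c κ → is≤1 (opp c) _ }) softs , pay-sum {x} {p} {q} (pay₀≤2 x p) (pay₀≤2 x q) ¬Qp ¬Qq ≤-refl
      by-third (yes _) (no soft) = 2 , N (record
        { job    = λ c → Close.job-33 isB (inj₂ refl) (inj₁ refl) (λ _ → ⊎-swap) (proj₂ third-q) (proj₂ third-p) soft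
        ; load≤1 = λ c κ → is≤1 (opp c) _ }) softs , pay-sum {x} {p} {q} (pay₀≤2 x p) (pay₀≤2 x q) ¬Qp ¬Qq ≤-refl
      by-third (yes Ky) (yes Kz) = 4 , P₄ (deg≡3⇒soft deg-p) (deg≡3⇒soft deg-q) ,
        ≤-trans (+-monoˡ-≤ 4 (both-killers Ky Kz)) (6≤base ¬Qp ¬Qq)
    by-degree (no ¬Qp) (no ¬Qq) (yes deg-p) (no deg-q) with lopsided x~p x~q p~q ¬Qp ¬Qq deg-p deg-q
    ... | inj₁ (soft , v)         = 4 , P₄ (deg≡3⇒soft deg-p) soft , v
    ... | inj₂ (inj₁ (¬Lq , v)) = 5 , P₅ (deg≡3⇒soft deg-p ∘ inj₁) ¬Lq , v
    ... | inj₂ (inj₂ v)         = 6 , H , v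
    by-degree (no ¬Qp) (no ¬Qq) (no deg-p) (yes deg-q) with lopsided x~q x~p (~-sym p~q) ¬Qq ¬Qp deg-q deg-p
    ... | inj₁ (soft , v)         = 4 , P₄ soft (deg≡3⇒soft deg-q) , swapped v
    ... | inj₂ (inj₁ (¬Lp , v)) = 5 , P₅ ¬Lp (deg≡3⇒soft deg-q ∘ inj₁) , swapped v
    ... | inj₂ (inj₂ v)         = 6 , H , swapped v
    by-degree (no ¬Qp) (no ¬Qq) (no deg-p) (no deg-q) = 6 , H ,
      pay-sum {x} {p} {q} (≤-reflexive (pay₀-0 {x} {p} (not-2 x~p x~q p~q ¬Qp ∘ proj₁) (deg-p ∘ proj₁)))
        (≤-reflexive (pay₀-0 {x} {q} (not-2 x~q x~p (~-sym p~q) ¬Qq ∘ proj₁) (deg-q ∘ proj₁))) ¬Qp ¬Qq ≤-refl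

  mid-block : ∀ {x B} → Mid x → IsBlock x B → ∃ λ k → MidKind x B k × Val pay₀ x B k
  mid-block {B = one _}   Mx isB = mid-one Mx isB
  mid-block {B = two _ _} Mx isB = mid-two Mx isB

-- The balance of mid vertices.

module Charges {n : ℕ} (g : C45Free n) (S : Fin n → Set) (S-~ : ∀ {u v : Fin n} → C45Free._~_ g u v → S u)
  (colour-rest : ∀ x → S x → (R : Fin n → Set) → (∀ u → Dec (R u)) → R x →
    Σ (Fin n → Maybe Col) λ κ → Colouring.Valid g κ × (∀ u → R u → κ u ≡ nothing) ×
      (∀ u → S u → ¬ R u → ∃ λ c → κ u ≡ just c))
  (good : ∀ {v : Fin n} → S v → ¬ Degrees.Bad g v) where
  open Payments g (λ v~w → good (S-~ v~w)) public
  module Four = Reducible false g S S-~ colour-rest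
  open Reducible₅ g S S-~ colour-rest public
    using (Goal; Pure; nice; tip; Solo; solo; module FiveBlocks)

  In Out₀ Out Rec : Fin n → ℕ
  In v   = sumₐ v (base v)
  Out₀ v = sumₐ v (pay₀ v)
  Out v  = sumₐ v (pay v)
  Rec v  = sumₐ v (λ w → pay w v)

  data Kinds (K : Block n → ℕ → Set₁) (p : Block n → ℕ → Set) : List (Block n) → ℕ → Set₁ where
    []  : Kinds K p [] 0
    _∷_ : ∀ {B Bs k s} → K B k × p B k → Kinds K p Bs s → Kinds K p (B ∷ Bs) (k + s)

  kinds-sum : ∀ {K} q {x Bs s} → Kinds K (Val q x) Bs s → ∑ᴸ (weigh (q x)) Bs + s ≤ ∑ᴸ (weigh (base x)) Bs
  kinds-sum q []                           = z≤n
  kinds-sum q {x} (_∷_ {B} {k = k} (_ , v) ks) =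
    ≤-trans (≤-reflexive (+-interchange (weigh (q x) B) _ k _)) (+-mono-≤ v (kinds-sum q ks))

  kinds-total : ∀ {K} q {x s} → Kinds K (Val q x) (blocks x) s → sumₐ x (q x) + s ≤ In x
  kinds-total q {x} {s} ks = subst₂ (λ i j → i + s ≤ j) (sum-blocks x (q x)) (sum-blocks x (base x)) (kinds-sum q ks)

  MidKinds : Fin n → List (Block n) → ℕ → Set₁
  MidKinds x = Kinds (MidKind x) (Val pay₀ x)

  mid-kinds : ∀ {x} → Mid x → ∀ {Bs} → All (IsBlock x) Bs → ∃ λ s → MidKinds x Bs s
  mid-kinds Mx []           = 0 , []
  mid-kinds Mx (isB ∷ isBs) = let k , K , v = mid-block Mx isB ; s , ks = mid-kinds Mx isBs in k + s , (K , v) ∷ ks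

  IsSingle : Block n → Set
  IsSingle B = ∃ λ w → B ≡ one w

  record Picked (x : Fin n) (Bs : List (Block n)) (s : ℕ) : Set₁ where
    field
      {B}   : Block n
      {Bs′} : List (Block n)
      {s′}  : ℕ
      perm  : Bs ↭ B ∷ Bs′
      niceB : Close.Nice x B
      softB : ∀ w → w ∈ᵇ B → ¬ Killer w
      rest  : MidKinds x Bs′ s′
      sum≡  : s ≡ 2 + s′

  -- If no block has value 2, all of them have at least 3, with equality only for single vertices.
  pick : ∀ {x Bs s} → MidKinds x Bs s → Picked x Bs s ⊎ (length Bs * 3 ≤ s × (s ≤ length Bs * 3 → All IsSingle Bs))
  pick [] = inj₂ (z≤n , λ _ → [])
  pick ((N nc soft , v) ∷ ks) = inj₁ record
    { perm = ↭-refl ; niceB = nc ; softB = soft ; rest = ks ; sum≡ = refl }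
  pick {Bs = B ∷ Bs} (_∷_ {k = k} {s} (K , v) ks) with pick ks
  ... | inj₁ p = inj₁ record
    { perm = ↭-trans (prep B (Picked.perm p)) (swap B _ ↭-refl) ; niceB = Picked.niceB p ; softB = Picked.softB p
    ; rest = (K , v) ∷ Picked.rest p ; sum≡ = trans (cong (k +_) (Picked.sum≡ p)) (+-left k 2 _) }
    where
    +-left : ∀ p q r → p + (q + r) ≡ q + (p + r)
    +-left = solve-∀
  ... | inj₂ (lower , tight) with 3≤ K
    where
    3≤ : ∀ {x B k} → MidKind x B k → k ≡ 2 ⊎ (3 ≤ k × (k ≤ 3 → IsSingle B))
    3≤ (N _ _)        = inj₁ refl
    3≤ (S₁ {w} _)     = inj₂ (≤-refl , λ _ → w , refl)
    3≤ U              = inj₂ (s≤s (s≤s (s≤s z≤n)) , λ _ → _ , refl)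
    3≤ (P₄ _ _)       = inj₂ (s≤s (s≤s (s≤s z≤n)) , λ where (s≤s (s≤s (s≤s ()))))
    3≤ (P₅ _ _)       = inj₂ (s≤s (s≤s (s≤s z≤n)) , λ where (s≤s (s≤s (s≤s ()))))
    3≤ (Q₄ _ _ _ _ _) = inj₂ (s≤s (s≤s (s≤s z≤n)) , λ where (s≤s (s≤s (s≤s ()))))
    3≤ H              = inj₂ (s≤s (s≤s (s≤s z≤n)) , λ where (s≤s (s≤s (s≤s ()))))
  ...   | inj₂ (3≤k , one-vertex) = inj₂ (+-mono-≤ 3≤k lower , λ small →
          one-vertex (+-cancelʳ-≤ (length Bs * 3) _ _ (≤-trans (+-monoʳ-≤ k lower) small))
          ∷ tight (+-cancelˡ-≤ 3 _ _ (≤-trans (+-monoˡ-≤ s 3≤k) small)))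
  pick {Bs = B ∷ Bs} (_∷_ {k = .2} {s} (K@(N nc soft) , v) ks) | inj₂ _ | inj₁ refl = inj₁ record
    { perm = ↭-refl ; niceB = nc ; softB = soft ; rest = ks ; sum≡ = refl }

  record QBlock (x : Fin n) (B : Block n) : Set where
    field
      {t u}  : Fin n
      t∈     : t ∈ᵇ B
      u∈     : u ∈ᵇ B
      within : ∀ w → w ∈ᵇ B → w ≡ t ⊎ w ≡ u
      Qt     : Q t
      nbrs   : Nbrs₂ t x u

  Arranged : Fin n → Block n → Block n → ℕ → Set₁
  Arranged x X Y j = Σ (Close.Fourth x Y) λ F → (∀ w → w ∈ᵇ Y → ¬ Killer w) × (Close.First F X ⊎ (QBlock x X × 6 ≤ j))

  -- In a deficit of at most 11 units two nice blocks take 4, so the other two have at most 7. A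
  -- nice fourth block accounts for 2 of these and a solo one for 3.
  Limit : ∀ {x Y} → Close.Fourth x Y → ℕ
  Limit (Close.nice _) = 5
  Limit (Close.solo _) = 4

  data View (x : Fin n) : Block n → ℕ → Set₁ where
    is-N : ∀ {B} → Close.Nice x B → (∀ w → w ∈ᵇ B → ¬ Killer w) → View x B 2
    is-S : ∀ {w} → ¬ Killer w → View x (one w) 3
    big  : ∀ {B k} → 4 ≤ k → (∀ {Y} (F : Close.Fourth x Y) → k ≤ Limit F → Close.First F B ⊎ QBlock x B) → View x B k

  view : ∀ {x B k} → MidKind x B k → View x B k
  view (N nc soft) = is-N nc soft
  view (S₁ soft)     = is-S soft
  view U             = big ≤-refl λ _ _ → inj₁ Close.single
  view {x} (P₄ {r} {f} soft soft′) = big ≤-refl λ F _ → inj₁ (Close.pair (soft ∘ inj₁) (soft′ ∘ inj₁) (either F soft) (either F soft′))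
    where
    either : ∀ {Y v} (F : Close.Fourth x Y) → ¬ Killer v → Close.SoftIfSolo F v
    either (Close.nice _) _    = tt
    either (Close.solo _) soft = soft
  view {x} (P₅ {r} {f} ¬L ¬L′) = big (s≤s (s≤s (s≤s (s≤s z≤n)))) only-nice
    where
    only-nice : ∀ {Y} (F : Close.Fourth x Y) → 5 ≤ Limit F → Close.First F (two r f) ⊎ QBlock x (two r f)
    only-nice (Close.nice _) _ = inj₁ (Close.pair ¬L ¬L′ tt tt)
    only-nice (Close.solo _) (s≤s (s≤s (s≤s (s≤s ()))))
  view (Q₄ t∈ u∈ w q nb) = big ≤-refl λ _ _ → inj₂ record { t∈ = t∈ ; u∈ = u∈ ; within = w ; Qt = q ; nbrs = nb }
  view {x} {B} H = big (s≤s (s≤s (s≤s (s≤s z≤n)))) λ F 6≤ → contradiction (limit F) (<⇒≱ 6≤)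
    where
    limit : ∀ {Y} (F : Close.Fourth x Y) → Limit F ≤ 5
    limit (Close.nice _) = ≤-refl
    limit (Close.solo _) = s≤s (s≤s (s≤s (s≤s z≤n)))

  attach : ∀ {A : Set₁} {B C : Set} → A ⊎ B → C → A ⊎ (B × C)
  attach (inj₁ a) _ = inj₁ a
  attach (inj₂ b) c = inj₂ (b , c)

  -- Two values of at least 4 exceed 7, so one of the two blocks is nice or a soft single vertex and
  -- serves as the fourth. The limit left to the other one excludes the kinds that `First` cannot
  -- handle.
  arrange : ∀ {x B C k l} → View x B k → View x C l → k + l ≤ 7 → Arranged x B C (k + l) ⊎ Arranged x C B (k + l)
  arrange (is-N n soft) (is-N n′ soft′) _ = inj₁ (Close.nice n′ , soft′ , inj₁ (Close.nice n))
  arrange (is-N n soft) (is-S _)        _ = inj₂ (Close.nice n , soft , inj₁ Close.single)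
  arrange (is-S _)      (is-N n soft)   _ = inj₁ (Close.nice n , soft , inj₁ Close.single)
  arrange (is-S soft)   (is-S soft′)    _ = inj₁ (Close.solo soft′ , (λ where _ refl → soft′) , inj₁ Close.single)
  arrange (is-N n soft) (big 4≤ first)  l =
    inj₂ (Close.nice n , soft , attach (first (Close.nice n) (+-cancelˡ-≤ 2 _ _ l)) (+-monoʳ-≤ 2 4≤))
  arrange (big {k = k} 4≤ first) (is-N n soft) l =
    inj₁ (Close.nice n , soft , attach (first (Close.nice n) (+-cancelʳ-≤ 2 k 5 l)) (+-monoˡ-≤ 2 4≤))
  arrange (is-S soft)   (big 4≤ first)  l =
    inj₂ (Close.solo soft , (λ where _ refl → soft) , attach (first (Close.solo soft) (+-cancelˡ-≤ 3 _ _ l)) (+-mono-≤ {2} (s≤s (s≤s z≤n)) 4≤))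
  arrange (big {k = k} 4≤ first) (is-S soft) l =
    inj₁ (Close.solo soft , (λ where _ refl → soft) , attach (first (Close.solo soft) (+-cancelʳ-≤ 3 k 4 l)) (+-mono-≤ {y = k} {u = 2} 4≤ (s≤s (s≤s z≤n))))
  arrange (big 4≤k _)   (big 4≤l _)     l = contradiction (≤-trans (+-mono-≤ 4≤k 4≤l) l) λ where
    (s≤s (s≤s (s≤s (s≤s (s≤s (s≤s (s≤s ())))))))

  -- A mid vertex that is one or two units short: its only way out is a
  -- triangular 2-vertex.
  record Short (x : Fin n) : Set₁ where
    field
      {X B₁ B₂ Y} : Block n
      perm        : blocks x ↭ X ∷ B₁ ∷ B₂ ∷ Y ∷ []
      qblock      : QBlock x X
      N₁          : Close.Nice x B₁
      N₂          : Close.Nice x B₂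
      F           : Close.Fourth x Y
      soft₁       : ∀ w → w ∈ᵇ B₁ → ¬ Killer w
      soft₂       : ∀ w → w ∈ᵇ B₂ → ¬ Killer w
      softY       : ∀ w → w ∈ᵇ Y → ¬ Killer w
      enough      : Out₀ x + 10 ≤ In x

  mid-outcome : ∀ {x} → Mid x → S x → (12 + Out₀ x ≤ In x) ⊎ Goal ⊎ Short x
  mid-outcome {x} Mx Sx with mid-kinds Mx (blocks-valid x)
  ... | s , ks with 12 ≤? s
  ...   | yes 12≤s = inj₁ (≤-trans (≤-reflexive (+-comm 12 _)) (≤-trans (+-monoʳ-≤ (Out₀ x) 12≤s) (kinds-total pay₀ ks)))
  ...   | no 12≰s = inj₂ (four (blocks x) ↭-refl (proj₁ Mx) ks (≰⇒> 12≰s) (kinds-total pay₀ ks))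
    where
    last-two : ∀ {B₁ B₂ Bs t} → Close.Nice x B₁ → Close.Nice x B₂ → (∀ w → w ∈ᵇ B₁ → ¬ Killer w) → (∀ w → w ∈ᵇ B₂ → ¬ Killer w) →
               MidKinds x Bs t → blocks x ↭ B₁ ∷ B₂ ∷ Bs → length Bs ≡ 2 → t ≤ 7 → Out₀ x + (4 + t) ≤ In x → Goal ⊎ Short x
    last-two {B₁} {B₂} {C ∷ D ∷ []} n₁ n₂ s₁ s₂ ((_∷_ {k = k} (K , _) (_∷_ {k = l} (L , _) []))) perm len t≤7 tot
      rewrite +-identityʳ l with arrange (view K) (view L) t≤7
    ... | inj₁ (F , sY , inj₁ first) = inj₁ (Four.FourBlocks.goal (↭⇒Partition perm′) Sx n₁ n₂ F first)
      where perm′ = ↭-trans perm (↭-trans (prep B₁ (swap B₂ C ↭-refl)) (swap B₁ C ↭-refl))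
    ... | inj₁ (F , sY , inj₂ (qb , 6≤)) = inj₂ record
      { perm = ↭-trans perm (↭-trans (prep B₁ (swap B₂ C ↭-refl)) (swap B₁ C ↭-refl)) ; qblock = qb ; N₁ = n₁ ; N₂ = n₂ ; F = F
      ; soft₁ = s₁ ; soft₂ = s₂ ; softY = sY ; enough = ≤-trans (+-monoʳ-≤ (Out₀ x) (+-monoʳ-≤ 4 6≤)) tot }
    ... | inj₂ (F , sY , inj₁ first) = inj₁ (Four.FourBlocks.goal (↭⇒Partition perm′) Sx n₁ n₂ F first)
      where perm′ = ↭-trans perm (↭-trans (prep B₁ (prep B₂ (swap C D ↭-refl))) (↭-trans (prep B₁ (swap B₂ D ↭-refl)) (swap B₁ D ↭-refl)))
    ... | inj₂ (F , sY , inj₂ (qb , 6≤)) = inj₂ record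
      { perm = ↭-trans perm (↭-trans (prep B₁ (prep B₂ (swap C D ↭-refl))) (↭-trans (prep B₁ (swap B₂ D ↭-refl)) (swap B₁ D ↭-refl)))
      ; qblock = qb ; N₁ = n₁ ; N₂ = n₂ ; F = F
      ; soft₁ = s₁ ; soft₂ = s₂ ; softY = sY ; enough = ≤-trans (+-monoʳ-≤ (Out₀ x) (+-monoʳ-≤ 4 6≤)) tot }

    -- Three single vertices and one block of at most two give degree at most 5, and the only
    -- possible triangle at `x` has no killer besides `x`. Both contradict the definition of mid.
    no-three-singles : ∀ {B Bs} → blocks x ↭ B ∷ Bs → length Bs ≡ 3 → (∀ w → w ∈ᵇ B → ¬ Killer w) → All IsSingle Bs → Empty
    no-three-singles {B} {Bs} perm len softB singles = impossible (proj₂ Mx)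
      where
      part : Partition x (B ∷ Bs)
      part = ↭⇒Partition perm
      weigh≤2 : ∀ (B : Block n) → weigh (λ _ → 1) B ≤ 2
      weigh≤2 (one _)   = s≤s z≤n
      weigh≤2 (two _ _) = ≤-refl
      weigh-singles : ∀ {Bs} → All IsSingle Bs → ∑ᴸ (weigh (λ _ → 1)) Bs ≡ length Bs
      weigh-singles []                 = refl
      weigh-singles ((_ , refl) ∷ sgs) = cong suc (weigh-singles sgs)
      impossible : (6 ≤ deg x ⊎ ∃ λ w → x ~ w × Tr x w × Large w) → Empty
      impossible (inj₁ 6≤deg) = <⇒≱ 6≤deg (≤-trans (≤-reflexive (sym (Partition.total part (λ _ → 1))))
        (+-mono-≤ (weigh≤2 B) (≤-reflexive (trans (weigh-singles singles) len))))
      impossible (inj₂ (w , x~w , (z , t) , Lw)) = where-w (cover part x~w)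
        where
        on-single : ∀ {Bs} → All IsSingle Bs → All (IsBlock x) Bs → ¬ Any (w ∈ᵇ_) Bs
        on-single ((_ , refl) ∷ _) ((_ , alone) ∷ _) (here refl) = alone z (proj₁ (common x w z t)) (proj₂ (common x w z t))
        on-single (_ ∷ sgs) (_ ∷ isBs) (there w∈) = on-single sgs isBs w∈
        where-w : ¬ Any (w ∈ᵇ_) (B ∷ Bs)
        where-w (here w∈)  = softB w w∈ (inj₁ Lw)
        where-w (there w∈) = on-single singles (All.tail (Partition.valid part)) w∈

    four : ∀ Bs {s} → blocks x ↭ Bs → length Bs ≡ 4 → MidKinds x Bs s → s < 12 → Out₀ x + s ≤ In x → Goal ⊎ Short x
    four Bs {s} perm len ks s<12 tot with pick ks
    ... | inj₂ (lower , _) = contradiction (subst (λ l → l * 3 ≤ s) len lower) (<⇒≱ s<12)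
    ... | inj₁ record { Bs′ = Bs₁ ; s′ = s₁ ; perm = p₁ ; niceB = n₁ ; softB = soft₁ ; rest = ks₁ ; sum≡ = refl }
        with pick ks₁ | suc-injective (trans (sym (↭-length p₁)) len)
    -- After one block of value 2, the other three have at most 9 units, so each has exactly 3 and
    -- is a single vertex.
    ...   | inj₂ (_ , tight) | len₁ = ⊥-elim (no-three-singles (↭-trans perm p₁) len₁ soft₁
            (tight (subst (λ l → s₁ ≤ l * 3) (sym len₁) (+-cancelˡ-≤ 3 _ _ s<12))))
    ...   | inj₁ record { perm = p₂ ; niceB = n₂ ; softB = soft₂ ; rest = ks₂ ; sum≡ = refl } | len₁ =
            last-two n₁ n₂ soft₁ soft₂ ks₂ (↭-trans perm (↭-trans p₁ (prep _ p₂)))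
              (suc-injective (trans (sym (↭-length p₂)) len₁)) (+-cancelˡ-≤ 5 _ _ s<12) tot

  pay₁-0 : ∀ {u v} → ¬ Helps u v → pay₁ u v ≡ 0
  pay₁-0 {u} {v} ¬h = does-no (helps? u v) ¬h

  pay≤ : ∀ {u v k} → pay₀ u v ≤ k → ¬ Helps u v → pay u v ≤ k
  pay≤ {u} {v} {k} p ¬h = subst (_≤ k) (sym (trans (cong (pay₀ u v +_) (pay₁-0 {u} {v} ¬h)) (+-identityʳ _))) p

  -- A deficit of at most two units comes with a triangular 2-vertex. As `x` is not large, the other
  -- neighbour of that 2-vertex is, and it sends exactly two units as help.
  mid-charge : ∀ {x} → Mid x → S x → Goal ⊎ (12 + Out x ≤ In x + Rec x)
  mid-charge {x} Mx Sx with mid-outcome Mx Sx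
  ... | inj₁ enough     = inj₂ (≤-trans (+-monoʳ-≤ 12 out≤) (≤-trans enough (m≤m+n _ _)))
    where
    out≤ : Out x ≤ Out₀ x
    out≤ = sumₐ-mono x λ w _ → pay≤ {x} {w} ≤-refl (mid⇒¬large Mx ∘ proj₁)
  ... | inj₂ (inj₁ goal) = inj₁ goal
  ... | inj₂ (inj₂ sh) with 12 + Out₀ x ≤? In x
  ...   | yes enough = inj₂ (≤-trans (+-monoʳ-≤ 12 out≤) (≤-trans enough (m≤m+n _ _)))
    where
    out≤ : Out x ≤ Out₀ x
    out≤ = sumₐ-mono x λ w _ → pay≤ {x} {w} ≤-refl (mid⇒¬large Mx ∘ proj₁)
  ...   | no short = inj₂ (begin
    12 + Out x            ≤⟨ +-monoʳ-≤ 12 out≤ ⟩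
    12 + Out₀ x           ≡⟨ +-left 2 10 (Out₀ x) ⟩
    Out₀ x + 10 + 2       ≤⟨ +-mono-≤ (Short.enough sh) 2≤rec ⟩
    In x + Rec x          ∎)
    where
    open ≤-Reasoning
    +-left : ∀ p q r → p + q + r ≡ r + q + p
    +-left = solve-∀
    out≤ : Out x ≤ Out₀ x
    out≤ = sumₐ-mono x λ w _ → pay≤ {x} {w} ≤-refl (mid⇒¬large Mx ∘ proj₁)
    open QBlock (Short.qblock sh)
    isX : IsBlock x (Short.X sh)
    isX = All.head (Partition.valid (↭⇒Partition (Short.perm sh)))
    x~t : x ~ t
    x~t = member isX t∈
    x~u : x ~ u
    x~u = member isX u∈
    t~u : t ~ u
    t~u = proj₁ (proj₂ nbrs)
    helps : Helps u x
    helps = two-large (proj₁ Qt) (~-sym x~t) t~u x~u (mid⇒¬large Mx) , (Mx , ≰⇒> short) , t , ~-sym t~u , x~t , Qt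
    2≤rec : 2 ≤ Rec x
    2≤rec = ≤-trans (≤-trans (≤-reflexive (sym (does-yes (helps? u x) helps))) (m≤n+m _ (pay₀ u x)))
      (subst (_≤ Rec x) (cong (_· pay u x) (T⇒≡true x~u)) (term≤sum (λ w → a x w · pay w x) u))

-- The balance of large vertices and of the remaining ones.

module AllCharges {n : ℕ} (g : C45Free n) (S : Fin n → Set) (S-~ : ∀ {u v : Fin n} → C45Free._~_ g u v → S u)
  (colour-rest : ∀ x → S x → (R : Fin n → Set) → (∀ u → Dec (R u)) → R x →
    Σ (Fin n → Maybe Col) λ κ → Colouring.Valid g κ × (∀ u → R u → κ u ≡ nothing) ×
      (∀ u → S u → ¬ R u → ∃ λ c → κ u ≡ just c))
  (good : ∀ {v : Fin n} → S v → ¬ Degrees.Bad g v) where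
  open Charges g S S-~ colour-rest good public

  -- Every block leaves at least 2 units, so six blocks suffice. With five blocks only the totals 10
  -- and 11 fall short, which allow at most one block that is not pure, a soft single vertex.
  data LargeKind (x : Fin n) : Block n → ℕ → Set₁ where
    N  : ∀ {B} → Pure x B → LargeKind x B 2
    S₁ : ∀ {w} → ¬ Killer w → LargeKind x (one w) 3
    H  : ∀ {B} → LargeKind x B 4

  ○●-disjoint′ : ∀ x → is (opp ○) x + is (opp ●) x ≤ 1
  ○●-disjoint′ x = subst (_≤ 1) (+-comm (is ○ x) _) (○●-disjoint x)

  large-one : ∀ {x w} → IsBlock x (one w) → ∃ λ k → LargeKind x (one w) k × Val pay x (one w) k
  large-one {x} {w} isB@(x~w , alone) = by-degree (deg w ≟ᴺ 2) (deg w ≟ᴺ 3) (tri? w)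
    where
    ¬helps : ¬ Helps x w
    ¬helps (_ , _ , t , x~t , w~t , _) = alone t x~t w~t
    val : ∀ {i} → pay₀ x w ≤ i → ∀ k → i + k ≤ 4 → Val pay x (one w) k
    val p k i+k≤4 = ≤-trans (+-monoˡ-≤ k (pay≤ {x} {w} p ¬helps)) (≤-trans i+k≤4 (single-base isB))
    by-degree : Dec (deg w ≡ 2) → Dec (deg w ≡ 3) → Dec (Tri w) → ∃ λ k → LargeKind x (one w) k × Val pay x (one w) k
    by-degree (yes deg≡2) _ _ with nbrs₂ deg≡2 (~-sym x~w)
    ... | b , nb , x≢b = 2 , N (nice (record { job = λ c → job-2 isB nb x≢b ; load≤1 = λ c κ → is≤1 (opp c) (κ b) })
                                     (λ κ → ○●-disjoint′ (κ b))) , val (pay₀≤2 x w) 2 ≤-refl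
    by-degree (no _) (yes deg≡3) (yes Tw) with someNbrs₃ deg≡3 (~-sym x~w)
    ... | e , f , nb@((_ , w~e , w~f) , (x≢e , x≢f , _) , _) with large? e | large? f
    ...   | yes Le | _ = 3 , S₁ (deg≡3⇒soft deg≡3) ,
            val (pay₀≤1 deg≡3 (~-sym x~w) w~e (x≢e ∘ sym) (inj₁ Le , inj₁ Le)) 3 ≤-refl
    ...   | no _ | yes Lf = 3 , S₁ (deg≡3⇒soft deg≡3) ,
            val (pay₀≤1 deg≡3 (~-sym x~w) w~f (x≢f ∘ sym) (inj₁ Lf , inj₁ Lf)) 3 ≤-refl
    -- The neighbours may be killers here, so they are weak for ● only; the job exists for `x` of
    -- colour ○ and the block is merely a tip.
    ...   | no ¬Le | no ¬Lf = 2 , N (tip (job-3 {c = ○} isB nb ¬Le ¬Lf) excl (deg≡3⇒soft deg≡3)) , val (pay₀≤2 x w) 2 ≤-refl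
      where
      excl : ∀ {κ} → Valid κ → is ● (κ e) * is ● (κ f) + is ● (κ w) ≤ 1
      excl {κ} v with is-cases ● (κ w)
      ... | inj₂ (_ , ≡0) rewrite ≡0 | +-identityʳ (is ● (κ e) * is ● (κ f)) = *-mono-≤ (is≤1 ● (κ e)) (is≤1 ● (κ f))
      ... | inj₁ (κw , ≡1) rewrite ≡1 with is-cases ● (κ e) | is-cases ● (κ f)
      -- The vertices `w`, `e` and `f` form a triangle, which cannot be monochromatic.
      ...   | inj₁ (κe , _)   | inj₁ (κf , _)   = ⊥-elim (no-mono-triangle v w~e (Tri-other nb Tw alone) w~f κw κe κf)
      ...   | inj₂ (_ , e≡0) | _                rewrite e≡0 = ≤-refl
      ...   | inj₁ (_ , e≡1) | inj₂ (_ , f≡0)  rewrite e≡1 | f≡0 = ≤-refl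
    by-degree (no deg≢2) (yes _) (no ¬Tw) = 4 , H , val (≤-reflexive (pay₀-0 {x} {w} (deg≢2 ∘ proj₁) (¬Tw ∘ proj₁ ∘ proj₂))) 4 ≤-refl
    by-degree (no deg≢2) (no deg≢3) _     = 4 , H , val (≤-reflexive (pay₀-0 {x} {w} (deg≢2 ∘ proj₁) (deg≢3 ∘ proj₁))) 4 ≤-refl

  -- The deficit of `u` makes `u` recolourable, unless the goal is reached anyway. The block of `t`
  -- at `u` contains the large vertex `x`, whereas the three other blocks of the arrangement have no
  -- killer; so the special pair of `u` is `t` and `x`.
  Q-partner : ∀ {x B t u} → Large x → IsBlock x B → t ∈ᵇ B → u ∈ᵇ B → (∀ w → w ∈ᵇ B → w ≡ t ⊎ w ≡ u) →
              t ~ u → Q t → Needy u → Goal ⊎ Pure x B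
  Q-partner {x} {B} {t} {u} Lx isB t∈ u∈ in-B t~u Qt (Mu , short) with mid-outcome Mu (S-~ (~-sym (member isB u∈)))
  ... | inj₁ enough      = contradiction enough (<⇒≱ short)
  ... | inj₂ (inj₁ goal) = inj₁ goal
  ... | inj₂ (inj₂ sh)   = inj₂ (nice (nice-needy isB t∈ u∈ in-B (Q-nbrs x~t x~u t~u Qt) part t∈X x∈X in-X N₁ N₂ F) λ κ → ≤-refl)
    where
    open Short sh
    part = ↭⇒Partition perm
    x~t : x ~ t
    x~t = member isB t∈
    x~u : x ~ u
    x~u = member isB u∈
    u-blocks : IsBlock u X × IsBlock u B₁ × IsBlock u B₂ × IsBlock u Y
    u-blocks with Partition.valid part
    ... | p ∷ q ∷ r ∷ s ∷ [] = p , q , r , s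
    not-soft : ∀ {C} → IsBlock u C → (∀ w → w ∈ᵇ C → ¬ Killer w) → ¬ t ∈ᵇ C
    not-soft isC soft t∈C = soft x (partner-member isC t∈C (~-sym x~u) (~-sym x~t)) (inj₁ Lx)
    t∈X : t ∈ᵇ X
    t∈X with cover part (~-sym t~u)
    ... | here t∈                         = t∈
    ... | there (here t∈)                 = contradiction t∈ (not-soft (proj₁ (proj₂ u-blocks)) soft₁)
    ... | there (there (here t∈))         = contradiction t∈ (not-soft (proj₁ (proj₂ (proj₂ u-blocks))) soft₂)
    ... | there (there (there (here t∈))) = contradiction t∈ (not-soft (proj₂ (proj₂ (proj₂ u-blocks))) softY)
    x∈X : x ∈ᵇ X
    x∈X = partner-member (proj₁ u-blocks) t∈X (~-sym x~u) (~-sym x~t)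
    in-X : ∀ w → w ∈ᵇ X → w ≡ t ⊎ w ≡ x
    in-X w w∈ = conclude (within t t∈X) (within x x∈X) (within w w∈)
      where
      open QBlock qblock using (within) renaming (t to t′; u to u′; Qt to Qt′; nbrs to nbrs′)
      soft-t′ : ¬ Killer t′
      soft-t′ = deg≡2⇒soft (proj₁ Qt′)
      conclude : t ≡ t′ ⊎ t ≡ u′ → x ≡ t′ ⊎ x ≡ u′ → w ≡ t′ ⊎ w ≡ u′ → w ≡ t ⊎ w ≡ x
      conclude (inj₂ t≡u′) _ _ = contradiction (two-killers (proj₁ Qt′) (proj₁ (proj₂ nbrs′)))
        (subst (λ v → ¬ Killer v) t≡u′ (deg≡2⇒soft (proj₁ Qt)))
      conclude (inj₁ _) (inj₁ x≡t′) _ = contradiction (inj₁ (subst Large x≡t′ Lx)) soft-t′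
      conclude (inj₁ t≡t′) (inj₂ x≡u′) (inj₁ w≡t′) = inj₁ (trans w≡t′ (sym t≡t′))
      conclude (inj₁ t≡t′) (inj₂ x≡u′) (inj₂ w≡u′) = inj₂ (trans w≡u′ (sym x≡u′))
    open QBlock qblock using (within)

  large-two : ∀ {x p q} → Large x → IsBlock x (two p q) → Goal ⊎ ∃ λ k → LargeKind x (two p q) k × Val pay x (two p q) k
  large-two {x} {p} {q} Lx isB@(x~p , x~q , p~q) = by-degree (Q? p) (Q? q) (deg p ≟ᴺ 3) (deg q ≟ᴺ 3)
    where
    Outcome : Set₁
    Outcome = Goal ⊎ ∃ λ k → LargeKind x (two p q) k × Val pay x (two p q) k

    help≤2 : ∀ u v → pay₁ u v ≤ 2
    help≤2 u v = does-≤ (helps? u v)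

    with-Q : ∀ {t u} → x ~ t → x ~ u → t ~ u → Q t → t ∈ᵇ two p q → u ∈ᵇ two p q → (∀ w → w ∈ᵇ two p q → w ≡ t ⊎ w ≡ u) →
             (∀ {k} → pay x t + pay x u + k ≤ base x t + base x u → Val pay x (two p q) k) → Outcome
    with-Q {t} {u} x~t x~u t~u Qt t∈ u∈ in-B close with needy? u
    ... | no ¬needy = inj₂ (4 , H , close (subst₂ (λ i j → i + j + 4 ≤ base x t + base x u) (sym pay-t) (sym pay-u) bound))
      where
      pay-t : pay x t ≡ 0
      pay-t = cong₂ _+_ (Q-pay {x} Qt) (pay₁-0 {x} {t} λ where (_ , (Mt , _) , _) → deg≡2⇒soft (proj₁ Qt) (inj₂ Mt))
      pay-u : pay x u ≡ 0
      pay-u = cong₂ _+_ (killer-pay {x} {u} (two-killers (proj₁ Qt) t~u)) (pay₁-0 {x} {u} (¬needy ∘ proj₁ ∘ proj₂))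
      bound : 4 ≤ base x t + base x u
      bound = ≤-trans (Q-base x~t x~u t~u Qt) (m≤n+m _ (base x t))
    ... | yes needy with Q-partner Lx isB t∈ u∈ in-B t~u Qt needy
    ...   | inj₁ goal = inj₁ goal
    ...   | inj₂ pure = inj₂ (2 , N pure , close (≤-trans (+-monoˡ-≤ 2 (+-mono-≤ (≤-reflexive pay-t) pay-u)) bound))
      where
      pay-t : pay x t ≡ 0
      pay-t = cong₂ _+_ (Q-pay {x} Qt) (pay₁-0 {x} {t} λ where (_ , (Mt , _) , _) → deg≡2⇒soft (proj₁ Qt) (inj₂ Mt))
      pay-u : pay x u ≤ 2
      pay-u = subst (_≤ 2) (cong (_+ pay₁ x u) (sym (killer-pay {x} {u} (two-killers (proj₁ Qt) t~u)))) (help≤2 x u)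
      bound : 4 ≤ base x t + base x u
      bound = ≤-trans (Q-base x~t x~u t~u Qt) (m≤n+m _ (base x t))

    no-help : ∀ {p q} → x ~ p → x ~ q → p ~ q → ¬ Q q → ¬ Helps x p
    no-help x~p x~q p~q ¬Qq (_ , _ , t , x~t , p~t , Qt) = ¬Qq (subst Q (third-unique x~p x~t p~t x~q p~q) Qt)

    plain-pays : ∀ {i j k} → pay₀ x p ≤ i → pay₀ x q ≤ j → ¬ Q p → ¬ Q q → i + j + k ≤ 6 → Val pay x (two p q) k
    plain-pays {k = k} pp pq ¬Qp ¬Qq small = ≤-trans (+-monoˡ-≤ k (+-mono-≤
      (pay≤ {x} {p} pp (no-help x~p x~q p~q ¬Qq)) (pay≤ {x} {q} pq (no-help x~q x~p (~-sym p~q) ¬Qp))))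
      (≤-trans small (6≤base ¬Qp ¬Qq))

    zero-pay : ∀ {p q} → x ~ p → x ~ q → p ~ q → ¬ Q p → deg p ≢ 3 → pay₀ x p ≤ 0
    zero-pay {p} x~p x~q p~q ¬Qp deg≢3 = ≤-reflexive (pay₀-0 {x} {p} (λ where
      (deg≡2 , _) → ¬Qp (deg≡2 , pair-Tri x~p x~q p~q)) (deg≢3 ∘ proj₁))

    by-degree : Dec (Q p) → Dec (Q q) → Dec (deg p ≡ 3) → Dec (deg q ≡ 3) → Outcome
    by-degree (yes Qp) _ _ _ = with-Q x~p x~q p~q Qp (inj₁ refl) (inj₂ refl) (λ _ → id) id
    by-degree (no _) (yes Qq) _ _ = with-Q x~q x~p (~-sym p~q) Qq (inj₂ refl) (inj₁ refl) (λ _ → ⊎-swap)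
      λ {k} → subst₂ _≤_ (cong (_+ k) (+-comm (pay x q) _)) (+-comm (base x q) _)
    by-degree (no ¬Qp) (no ¬Qq) (yes deg-p) (yes deg-q) = by-third (killer? (proj₁ third-p)) (killer? (proj₁ third-q))
      where
      open Pair33 x~p x~q p~q deg-p deg-q
      by-third : Dec (Killer (proj₁ third-p)) → Dec (Killer (proj₁ third-q)) → Outcome
      by-third (no soft) _ = inj₂ (2 , N (nice (record
        { job    = λ c → job-33 isB (inj₁ refl) (inj₂ refl) (λ _ → id) (proj₂ third-p) (proj₂ third-q) soft
        ; load≤1 = λ c κ → is≤1 (opp c) _ }) (λ κ → ○●-disjoint′ (κ (proj₁ third-q)))) , plain-pays (pay₀≤2 x p) (pay₀≤2 x q) ¬Qp ¬Qq ≤-refl)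
      by-third (yes _) (no soft) = inj₂ (2 , N (nice (record
        { job    = λ c → job-33 isB (inj₂ refl) (inj₁ refl) (λ _ → ⊎-swap) (proj₂ third-q) (proj₂ third-p) soft
        ; load≤1 = λ c κ → is≤1 (opp c) _ }) (λ κ → ○●-disjoint′ (κ (proj₁ third-p)))) , plain-pays (pay₀≤2 x p) (pay₀≤2 x q) ¬Qp ¬Qq ≤-refl)
      by-third (yes Ky) (yes Kz) = inj₂ (4 , H , plain-pays (half x~p x~q deg-p (proj₂ third-p) Ky)
        (half x~q x~p deg-q (proj₂ third-q) Kz) ¬Qp ¬Qq ≤-refl)
    by-degree (no ¬Qp) (no ¬Qq) (yes _) (no deg-q) = inj₂ (4 , H ,
      plain-pays (pay₀≤2 x p) (zero-pay x~q x~p (~-sym p~q) ¬Qq deg-q) ¬Qp ¬Qq ≤-refl)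
    by-degree (no ¬Qp) (no ¬Qq) (no deg-p) _ = inj₂ (4 , H ,
      plain-pays (zero-pay x~p x~q p~q ¬Qp deg-p) (pay₀≤2 x q) ¬Qp ¬Qq ≤-refl)

  LargeKinds : Fin n → List (Block n) → ℕ → Set₁
  LargeKinds x = Kinds (LargeKind x) (Val pay x)

  large-kinds : ∀ {x} → Large x → ∀ {Bs} → All (IsBlock x) Bs → Goal ⊎ ∃ λ s → LargeKinds x Bs s
  large-kinds Lx [] = inj₂ (0 , [])
  large-kinds {x} Lx (_∷_ {x = B} isB isBs) with large-block B isB | large-kinds Lx isBs
    where
    large-block : ∀ B → IsBlock x B → Goal ⊎ ∃ λ k → LargeKind x B k × Val pay x B k
    large-block (one _)   isB = inj₂ (large-one isB)
    large-block (two _ _) isB = large-two Lx isB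
  ... | inj₁ goal        | _             = inj₁ goal
  ... | inj₂ _           | inj₁ goal     = inj₁ goal
  ... | inj₂ (k , K , v) | inj₂ (s , ks) = inj₂ (k + s , (K , v) ∷ ks)

  2≤large : ∀ {x B k} → LargeKind x B k → 2 ≤ k
  2≤large (N _)  = ≤-refl
  2≤large (S₁ _) = s≤s (s≤s z≤n)
  2≤large H      = s≤s (s≤s z≤n)

  2*≤large : ∀ {x Bs s} → LargeKinds x Bs s → length Bs * 2 ≤ s
  2*≤large []             = z≤n
  2*≤large ((K , _) ∷ ks) = +-mono-≤ (2≤large K) (2*≤large ks)

  all-pure : ∀ {x Bs s} → LargeKinds x Bs s → s ≤ length Bs * 2 → All (Pure x) Bs
  all-pure []                  _     = []
  all-pure ((N pure , _) ∷ ks) small = pure ∷ all-pure ks (+-cancelˡ-≤ 2 _ _ small)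
  all-pure ((S₁ _ , _) ∷ ks)   small = contradiction (+-cancelˡ-≤ 2 _ _ small) (<⇒≱ (s≤s (2*≤large ks)))
  all-pure ((H , _) ∷ ks)      small = contradiction (+-cancelˡ-≤ 2 _ _ small) (<⇒≱ (s≤s (≤-trans (2*≤large ks) (n≤1+n _))))

  record SoloPure (x : Fin n) (Bs : List (Block n)) : Set₁ where
    field
      {solos pures} : List (Block n)
      perm          : Bs ↭ solos ++ pures
      all-solo      : All Solo solos
      ≤1            : length solos ≤ 1
      all-pures     : All (Pure x) pures

  -- A total of one above the minimum leaves room for a single block of value 3 and for none of
  -- value 4.
  solo-pure : ∀ {x Bs s} → LargeKinds x Bs s → s ≤ suc (length Bs * 2) → SoloPure x Bs
  solo-pure [] _ = record { solos = [] ; perm = ↭-refl ; all-solo = [] ; ≤1 = z≤n ; all-pures = [] }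
  solo-pure {Bs = B ∷ Bs} ((N pure , _) ∷ ks) small with solo-pure ks (+-cancelˡ-≤ 2 _ _ small)
  ... | record { solos = Q ; perm = p ; all-solo = sl ; ≤1 = le ; all-pures = ps } = record
    { perm = ↭-trans (prep B p) (↭-sym (shift B Q _)) ; all-solo = sl ; ≤1 = le ; all-pures = pure ∷ ps }
  solo-pure {Bs = B ∷ Bs} ((S₁ soft , _) ∷ ks) small = record
    { solos = B ∷ [] ; perm = ↭-refl ; all-solo = solo soft ∷ [] ; ≤1 = ≤-refl ; all-pures = all-pure ks (+-cancelˡ-≤ 3 _ _ small) }
  solo-pure ((H , _) ∷ ks) small = contradiction (+-cancelˡ-≤ 3 _ _ small) (<⇒≱ (s≤s (2*≤large ks)))

  large-charge : ∀ {x} → Large x → S x → Goal ⊎ (12 + Out x ≤ In x + Rec x)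
  large-charge {x} Lx Sx with large-kinds Lx (blocks-valid x)
  ... | inj₁ goal = inj₁ goal
  ... | inj₂ (s , ks) with 12 ≤? s
  ...   | yes 12≤s = inj₂ (≤-trans (≤-reflexive (+-comm 12 _)) (≤-trans (+-monoʳ-≤ (Out x) 12≤s)
            (≤-trans (kinds-total pay ks) (m≤m+n _ _))))
  ...   | no 12≰s = inj₁ (FiveBlocks.goal (↭⇒Partition perm) Sx all-solo ≤1 all-pures
            (trans (sym (length-++ solos)) (trans (sym (↭-length perm)) m≡5)))
    where
    m≡5 : m x ≡ 5
    m≡5 = ≤-antisym (≤-pred (*-cancelʳ-< 2 (m x) 6 (≤-trans (s≤s (2*≤large ks)) (≰⇒> 12≰s)))) Lx
    open SoloPure (solo-pure ks (subst (λ l → s ≤ suc (l * 2)) (sym m≡5) (≤-pred (≰⇒> 12≰s))))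

  -- A vertex that is no killer pays nothing, and it has no triangular 2-vertex beside it, so none
  -- of its edges is missing. The cases are 8 + 4 for degree 2, 12 or 10 + 2 for degree 3, and at
  -- least 3 per edge from degree 4 on.
  soft-charge : ∀ {v} → S v → ¬ Killer v → ¬ Q v → 12 + Out v ≤ In v + Rec v
  soft-charge {v} Sv soft ¬Qv = subst (λ k → 12 + k ≤ In v + Rec v) (sym out≡0) (by-degree (deg v ≟ᴺ 2) (deg v ≟ᴺ 3))
    where
    out≡0 : Out v ≡ 0
    out≡0 = n≤0⇒n≡0 (≤-trans (sumₐ-mono v {pay v} {λ _ → 0} λ w _ → pay≤ {v} {w} (≤-reflexive (pay₀-0 {v} {w}
      (soft ∘ proj₂ ∘ proj₂) (soft ∘ proj₁ ∘ proj₂ ∘ proj₂))) (soft ∘ inj₁ ∘ proj₁)) (≤-reflexive (sum-0 _ λ w → ·-0 (a v w))))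
    ¬Q-nbr : ∀ {w} → v ~ w → ¬ Q w
    ¬Q-nbr v~w (deg≡2 , _) = soft (two-killers deg≡2 (~-sym v~w))
    sumₐ-const : ∀ k → sumₐ v (λ _ → k) ≡ deg v * k
    sumₐ-const k = trans (sum-cong λ w → scale (a v w)) (sum-* (λ w → a v w · 1))
      where
      scale : ∀ b → b · k ≡ (b · 1) * k
      scale true  = sym (+-identityʳ k)
      scale false = refl
      sum-* : ∀ {l} (f : Fin l → ℕ) → sum (λ w → f w * k) ≡ sum f * k
      sum-* {zero}  f = refl
      sum-* {suc l} f = trans (cong (f zero * k +_) (sum-* (f ∘ suc))) (sym (*-distribʳ-+ k (f zero) (sum (f ∘ suc))))
    in≥ : ∀ k → (∀ w → v ~ w → k ≤ base v w) → deg v * k ≤ In v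
    in≥ k k≤ = subst (_≤ In v) (sumₐ-const k) (sumₐ-mono v k≤)
    rec≥ : ∀ {w} → v ~ w → pay w v ≤ Rec v
    rec≥ {w} v~w = subst (_≤ Rec v) (cong (_· pay w v) (T⇒≡true v~w)) (term≤sum (λ u → a v u · pay u v) w)
    no-common : ¬ Tri v → ∀ w → v ~ w → ¬ OnKept v w
    no-common ¬T w v~w (z , v~z , w~z , _) = ¬T (w , v~w , z , ∧-intro {a v z} v~z w~z)

    by-degree : Dec (deg v ≡ 2) → Dec (deg v ≡ 3) → 12 ≤ In v + Rec v
    by-degree (yes deg≡2) _ = +-mono-≤ {8} {In v} {4}
      (subst (λ d → d * 4 ≤ In v) deg≡2 (in≥ 4 λ w v~w → 4≤base (¬Q-nbr v~w) (no-common (λ T → ¬Qv (deg≡2 , T)) w v~w)))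
      (subst (λ d → d * 2 ≤ Rec v) deg≡2 (subst (_≤ Rec v) (sumₐ-const 2) (sumₐ-mono v λ w v~w → pays w v~w)))
      where
      pays : ∀ w → v ~ w → 2 ≤ pay w v
      pays w v~w = ≤-trans (≤-reflexive (sym (does-yes (two? w v) (deg≡2 , (λ T → ¬Qv (deg≡2 , T)) , two-killers deg≡2 v~w))))
        (≤-trans (m≤m+n _ _) (m≤m+n _ (pay₁ w v)))
    by-degree (no deg≢2) (no deg≢3) = ≤-trans (*-monoˡ-≤ 3 4≤deg) (≤-trans (in≥ 3 λ w v~w → 3≤base (¬Q-nbr v~w)) (m≤m+n _ _))
      where
      2≤deg : 2 ≤ deg v
      2≤deg = ≰⇒> λ deg≤1 → good Sv (inj₁ deg≤1)
      4≤deg : 4 ≤ deg v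
      4≤deg = ≤∧≢⇒< (≤∧≢⇒< 2≤deg (deg≢2 ∘ sym)) (deg≢3 ∘ sym)
    by-degree (no deg≢2) (yes deg≡3) with tri? v
    ... | no ¬T = ≤-trans (subst (λ d → d * 4 ≤ In v) deg≡3 (in≥ 4 λ w v~w → 4≤base (¬Q-nbr v~w) (no-common ¬T w v~w))) (m≤m+n _ _)
    ... | yes T@(e , v~e , f , t) = +-mono-≤ {10} {In v} {2} 10≤in 2≤rec
      where
      v~f : v ~ f
      v~f = proj₁ (common v e f t)
      e~f : e ~ f
      e~f = proj₂ (common v e f t)
      third : ∃ λ h → Nbrs₃ v e f h
      third = nbrs₃ deg≡3 v~e v~f (~⇒≢ e~f)
      h = proj₁ third
      v~h : v ~ h
      v~h = proj₂ (proj₂ (proj₁ (proj₂ third)))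
      10≤in : 10 ≤ In v
      10≤in = subst (_≤ In v) (trans (sumₐ-+ v (λ _ → 3) (δ h)) (cong₂ _+_ (trans (sumₐ-const 3) (cong (_* 3) deg≡3)) (sumₐ-δ v~h)))
        (sumₐ-mono v bound)
        where
        bound : ∀ w → v ~ w → 3 + δ h w ≤ base v w
        bound w v~w with w ≟ h
        ... | no _     = 3≤base (¬Q-nbr v~w)
        ... | yes refl = 4≤base (¬Q-nbr v~w) λ where
          (z , v~z , h~z , _) → third-alone {e} {v} {f} {h} (proj₂ third) e~f (z , ∧-intro {a v z} v~z h~z)
      payer : ∃ λ w → v ~ w × Payer w v
      payer with any? (λ w → T? (a v w) ×-dec large? w) | three-killer deg≡3 v~e
      ... | yes (w , v~w , Lw) | _              = w , v~w , inj₁ Lw , inj₁ Lw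
      ... | no none            | w , v~w , Kw = w , v~w , Kw , inj₂ (none ∘ proj₂)
      pays : ∀ u {k} → k ≤ share v → does (payer? u v) · k ≤ pay u v
      pays u {k} k≤ with payer? u v
      ... | no _   = z≤n
      ... | yes pu = ≤-trans k≤ (≤-trans (≤-reflexive (sym (does-yes (three? u v) (deg≡3 , T , pu))))
                       (≤-trans (m≤n+m _ (does (two? u v) · 2)) (m≤m+n _ (pay₁ u v))))
      2≤rec : 2 ≤ Rec v
      2≤rec with npay v ≤? 1 in eq
      ... | yes ≤1 = ≤-trans (≤-reflexive (sym (does-yes (payer? (proj₁ payer) v) (proj₂ (proj₂ payer)))))
              (≤-trans (pays (proj₁ payer) {2} (≤-reflexive (sym (cong suc (does-yes (npay v ≤? 1) ≤1))))) (rec≥ (proj₁ (proj₂ payer))))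
      ... | no ≰1  = ≤-trans (≰⇒> ≰1) (sumₐ-mono v λ u _ → pays u (s≤s z≤n))

  charge : ∀ {v} → S v → ¬ Q v → Goal ⊎ (12 + Out v ≤ In v + Rec v)
  charge {v} Sv ¬Qv with killer? v
  ... | yes (inj₁ Lv) = large-charge Lv Sv
  ... | yes (inj₂ Mv) = mid-charge Mv Sv
  ... | no soft       = inj₂ (soft-charge Sv soft ¬Qv)

-- Rotation systems and Euler’s inequality

lookup-collect : ∀ {A : Set} {n} {P : A → Set} (F : Fin n → List A) → All P (collect F) → ∀ i → All P (F i)
lookup-collect {n = suc n} F ps zero    = All-++ˡ (F zero) ps
  where
  All-++ˡ : ∀ {A : Set} {P : A → Set} xs {ys} → All P (xs ++ ys) → All P xs
  All-++ˡ []       _        = []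
  All-++ˡ (x ∷ xs) (p ∷ ps) = p ∷ All-++ˡ xs ps
lookup-collect {n = suc n} F ps (suc i) = lookup-collect (F ∘ suc) (All-++ʳ (F zero) ps) i
  where
  All-++ʳ : ∀ {A : Set} {P : A → Set} xs {ys} → All P (xs ++ ys) → All P ys
  All-++ʳ []       ps       = ps
  All-++ʳ (x ∷ xs) (p ∷ ps) = All-++ʳ xs ps

Respects : ∀ {X Y : Set} → (X → Y) → X × X → Set
Respects ψ (x , y) = ψ x ≡ ψ y

-- The classes of the equivalence generated by a list of pairs, described as
-- the finest labelling that identifies these pairs.
record Labels {X : Set} (L : List (X × X)) (k : ℕ) : Set₁ where
  field
    cls       : X → Fin k
    pre       : Fin k → X
    cls-pre   : ∀ i → cls (pre i) ≡ i
    ident      : All (Respects cls) L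
    universal : ∀ {Y : Set} (ψ : X → Y) → All (Respects ψ) L → ∀ {x y} → cls x ≡ cls y → ψ x ≡ ψ y
open Labels

-- A labelling that respects the pairs factors through the finest one, so it cannot take more
-- values.
count≤ : ∀ {X : Set} {L : List (X × X)} {k k′} → Labels L k → (ψ : X → Fin k′) → All (Respects ψ) L →
         (∀ j → ∃ λ x → ψ x ≡ j) → k′ ≤ k
count≤ lab ψ ψ-resp surj = injective⇒≤ {f = λ j → cls lab (proj₁ (surj j))} λ {i} {j} eq →
  trans (sym (proj₂ (surj i))) (trans (universal lab ψ ψ-resp eq) (proj₂ (surj j)))

merge : ∀ {X : Set} {L : List (X × X)} {k} (lab : Labels L k) a b → cls lab a ≢ cls lab b → ∃ λ k′ → suc k′ ≡ k × Labels ((a , b) ∷ L) k′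
merge {X} {L} {zero}  lab a b _ with cls lab a
... | ()
merge {X} {L} {suc k} lab a b a≢b = k , refl , record
  { cls       = μ ∘ cls lab
  ; pre       = pre lab ∘ punchIn j
  ; cls-pre   = λ t → trans (cong μ (cls-pre lab (punchIn j t))) (μ-punchIn t)
  ; ident      = μ-ij ∷ All.map (cong μ) (ident lab)
  ; universal = λ where ψ (ψab ∷ ψL) {x} {y} eq → through ψ ψab ψL (μ-injective _ _ eq)
  }
  where
  i = cls lab a
  j = cls lab b
  μ : Fin (suc k) → Fin k
  μ x with j ≟ x
  ... | yes _  = punchOut {i = j} {j = i} (a≢b ∘ sym)
  ... | no j≢x = punchOut j≢x
  μ-ij : μ i ≡ μ j
  μ-ij with j ≟ i | j ≟ j
  ... | yes j≡i | _       = contradiction (sym j≡i) a≢b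
  ... | no _    | no j≢j  = contradiction refl j≢j
  ... | no _    | yes _   = punchOut-cong j refl
  μ-punchIn : ∀ t → μ (punchIn j t) ≡ t
  μ-punchIn t with j ≟ punchIn j t
  ... | yes j≡ = contradiction (sym j≡) (punchInᵢ≢i j t)
  ... | no j≢  = trans (punchOut-cong j refl) (punchOut-punchIn j)
  μ-injective : ∀ x y → μ x ≡ μ y → x ≡ y ⊎ (x ≡ i × y ≡ j) ⊎ (x ≡ j × y ≡ i)
  μ-injective x y eq with j ≟ x | j ≟ y
  ... | yes j≡x | yes j≡y = inj₁ (trans (sym j≡x) j≡y)
  ... | yes j≡x | no j≢y  = inj₂ (inj₂ (sym j≡x , sym (punchOut-injective (a≢b ∘ sym) j≢y eq)))
  ... | no j≢x  | yes j≡y = inj₂ (inj₁ (punchOut-injective j≢x (a≢b ∘ sym) eq , sym j≡y))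
  ... | no j≢x  | no j≢y  = inj₁ (punchOut-injective j≢x j≢y eq)
  through : ∀ {Y : Set} (ψ : X → Y) → ψ a ≡ ψ b → All (Respects ψ) L → ∀ {x y} →
            cls lab x ≡ cls lab y ⊎ (cls lab x ≡ i × cls lab y ≡ j) ⊎ (cls lab x ≡ j × cls lab y ≡ i) → ψ x ≡ ψ y
  through ψ ψab ψL (inj₁ eq) = universal lab ψ ψL eq
  through ψ ψab ψL (inj₂ (inj₁ (x≡i , y≡j))) = trans (universal lab ψ ψL x≡i) (trans ψab (sym (universal lab ψ ψL y≡j)))
  through ψ ψab ψL (inj₂ (inj₂ (x≡j , y≡i))) = trans (universal lab ψ ψL x≡j) (trans (sym ψab) (sym (universal lab ψ ψL y≡i)))

add : ∀ {X : Set} {L : List (X × X)} {k} → Labels L k → ∀ a b → ∃ λ k′ → k ≤ suc k′ × Labels ((a , b) ∷ L) k′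
add lab a b with cls lab a ≟ cls lab b
... | no a≢b = let k′ , eq , lab′ = merge lab a b a≢b in k′ , ≤-reflexive (sym eq) , lab′
... | yes a≡b = _ , n≤1+n _ , record
  { cls = cls lab ; pre = pre lab ; cls-pre = cls-pre lab ; ident = a≡b ∷ ident lab
  ; universal = λ where ψ (_ ∷ ψL) → universal lab ψ ψL }

labels : ∀ {X : Set} {N} (f : X → Fin N) (f⁻¹ : Fin N → X) → (∀ x → f⁻¹ (f x) ≡ x) → (∀ i → f (f⁻¹ i) ≡ i) →
         ∀ L → ∃ λ k → Labels L k
labels {N = N} f f⁻¹ left right [] = N , record
  { cls = f ; pre = f⁻¹ ; cls-pre = right ; ident = []
  ; universal = λ ψ _ {x} {y} eq → cong ψ (trans (sym (left x)) (trans (cong f⁻¹ eq) (left y))) }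
labels f f⁻¹ left right ((a , b) ∷ L) =
  let _ , lab = labels f f⁻¹ left right L ; k , _ , lab′ = add lab a b in k , lab′

-- Faces of a subgraph in the rotation of the whole graph, and the deletion of an edge.

module Embedded {n : ℕ} (G : Graph (Fin n)) (rotation : Rotation G) where
  open Graph G using (adj; adj-sym; adj-irrefl; _~_)
  open Rotation rotation using (rot; rot-src; rot-cyclic)
  open Dart

  D : Set
  D = Dart G

  ρ : D → D
  ρ = Inverse.to rot

  ρ-injective : ∀ {d d′} → ρ d ≡ ρ d′ → d ≡ d′
  ρ-injective {d} {d′} eq = trans (sym (Inverse.strictlyInverseʳ rot d)) (trans (cong (Inverse.from rot) eq) (Inverse.strictlyInverseʳ rot d′))

  dart-≡ : ∀ {d d′ : D} → src d ≡ src d′ → tgt d ≡ tgt d′ → d ≡ d′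
  dart-≡ {dart u v e} {dart .u .v e′} refl refl = cong (dart u v) (T-irrelevant e e′)

  _≟ᴰ_ : (x y : D) → Dec (x ≡ y)
  x ≟ᴰ y with src x ≟ src y | tgt x ≟ tgt y
  ... | yes p | yes q = yes (dart-≡ p q)
  ... | no ¬p | _     = no (¬p ∘ cong src)
  ... | yes _ | no ¬q = no (¬q ∘ cong tgt)

  rev : D → D
  rev = reverse G

  rev-rev : ∀ d → rev (rev d) ≡ d
  rev-rev d = dart-≡ refl refl

  -- Faces are labelled on ordered pairs of vertices rather than on darts: these are easily
  -- enumerated and also give isolated vertices a face.
  X : Set
  X = Fin n × Fin n

  pair : D → X
  pair d = src d , tgt d

  pair-injective : ∀ {d d′} → pair d ≡ pair d′ → d ≡ d′
  pair-injective eq = dart-≡ (cong proj₁ eq) (cong proj₂ eq)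

  module _ (A : Fin n → Fin n → Bool) where

    onA : D → Bool
    onA d = A (src d) (tgt d)

    -- An edge outside A is cut into two half-edges, along which the face walk turns around.
    α : D → D
    α d with T? (onA d)
    ... | yes _ = rev d
    ... | no _  = d

    φ : D → D
    φ d = ρ (α d)

    α-on : ∀ d → T (onA d) → α d ≡ rev d
    α-on d t with T? (onA d)
    ... | yes _ = refl
    ... | no ¬t = contradiction t ¬t

    α-off : ∀ d → ¬ T (onA d) → α d ≡ d
    α-off d ¬t with T? (onA d)
    ... | yes t = contradiction t ¬t
    ... | no _  = refl

    -- Pairs that are not darts are glued to a dart at the same vertex, except
    -- that an isolated vertex gets a class of its own.
    glue : Fin n → X
    glue u with any? (λ w → T? (adj u w))
    ... | yes (w , _) = u , w
    ... | no _        = u , u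

    step : X → X
    step (u , v) with T? (adj u v)
    ... | yes e = pair (φ (dart u v e))
    ... | no _  = glue u

    faceList : List (X × X)
    faceList = collect λ u → collect λ v → ((u , v) , step (u , v)) ∷ []

    edgeList : List (Fin n × Fin n)
    edgeList = collect λ u → collect λ v → when (A u v) (u , v)

    face-resp : ∀ {Y : Set} (ψ : X → Y) → (∀ d → ψ (pair d) ≡ ψ (pair (φ d))) → (∀ u v → ¬ u ~ v → ψ (u , v) ≡ ψ (glue u)) →
                All (Respects ψ) faceList
    face-resp ψ on-darts on-rest = All-collect _ λ u → All-collect _ λ v → at u v ∷ []
      where
      at : ∀ u v → ψ (u , v) ≡ ψ (step (u , v))
      at u v with T? (adj u v)
      ... | yes e = on-darts (dart u v e)
      ... | no ¬e = on-rest u v ¬e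

    resp-face : ∀ {Y : Set} (ψ : X → Y) → All (Respects ψ) faceList →
                (∀ d → ψ (pair d) ≡ ψ (pair (φ d))) × (∀ u v → ¬ u ~ v → ψ (u , v) ≡ ψ (glue u))
    resp-face ψ all = on-darts , on-rest
      where
      at : ∀ u v → ψ (u , v) ≡ ψ (step (u , v))
      at u v with lookup-collect _ (lookup-collect _ all u) v
      ... | p ∷ [] = p
      on-darts : ∀ d → ψ (pair d) ≡ ψ (pair (φ d))
      on-darts (dart u v e) with T? (adj u v) | at u v
      ... | yes e′ | eq = trans eq (cong (ψ ∘ pair ∘ φ) (dart-≡ refl refl))
      ... | no ¬e  | _  = contradiction e ¬e
      on-rest : ∀ u v → ¬ u ~ v → ψ (u , v) ≡ ψ (glue u)
      on-rest u v ¬e with T? (adj u v) | at u v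
      ... | yes e | _  = contradiction e ¬e
      ... | no _  | eq = eq

    edge-resp : ∀ {Y : Set} (ψ : Fin n → Y) → (∀ u v → T (A u v) → ψ u ≡ ψ v) → All (Respects ψ) edgeList
    edge-resp ψ eq = All-collect _ λ u → All-collect _ λ v → All-when (A u v) (u , v) (eq u v)

    resp-edge : ∀ {Y : Set} (ψ : Fin n → Y) → All (Respects ψ) edgeList → ∀ u v → T (A u v) → ψ u ≡ ψ v
    resp-edge ψ all u v t with A u v | lookup-collect _ (lookup-collect _ all u) v
    ... | true | p ∷ [] = p

    faceLabels : ∃ λ k → Labels faceList k
    faceLabels = labels (λ (u , v) → combine u v) (remQuot n) (λ (u , v) → remQuot-combine u v) (combine-remQuot {n} n) faceList

    componentLabels : ∃ λ k → Labels edgeList k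
    componentLabels = labels id id (λ _ → refl) (λ _ → refl) edgeList

    #F #C #D : ℕ
    #F = proj₁ faceLabels
    #C = proj₁ componentLabels
    #D = sum λ u → sum λ v → A u v · 1

    -- Twice the inequality E + 2C ≤ n + F, since `#D` counts both orientations of an edge.
    Euler : Set
    Euler = #D + 4 * #C ≤ 2 * n + 2 * #F

  iter : (D → D) → ℕ → D → D
  iter f zero    x = x
  iter f (suc k) x = iter f k (f x)

  iter-injective : ∀ {f} → (∀ {x y} → f x ≡ f y → x ≡ y) → ∀ k {x y} → iter f k x ≡ iter f k y → x ≡ y
  iter-injective inj zero    eq = eq
  iter-injective inj (suc k) eq = inj (iter-injective inj k eq)

  iter-+ : ∀ f m k x → iter f (m + k) x ≡ iter f k (iter f m x)
  iter-+ f zero    k x = refl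
  iter-+ f (suc m) k x = iter-+ f m k (f x)

  -- Among more iterates than there are pairs of vertices two coincide; injectivity moves the
  -- coincidence back to `d`.
  returns : ∀ {f} → (∀ {x y} → f x ≡ f y → x ≡ y) → ∀ d → ∃ λ k → iter f k (f d) ≡ d
  returns {f} inj d with pigeonhole {n * n} {suc (n * n)} ≤-refl (λ i → combine (src (iter f (toℕ i) d)) (tgt (iter f (toℕ i) d)))
  ... | i , j , i<j , eq = back (toℕ j ∸ toℕ i) (m<n⇒0<n∸m i<j) (m∸n+n≡m (<⇒≤ i<j))
    where
    combine-pair : ∀ {d d′ : D} → combine (src d) (tgt d) ≡ combine (src d′) (tgt d′) → d ≡ d′
    combine-pair {d} {d′} eq = pair-injective (trans (sym (remQuot-combine (src d) (tgt d)))
      (trans (cong (remQuot n) eq) (remQuot-combine (src d′) (tgt d′))))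
    back : ∀ m → 0 < m → m + toℕ i ≡ toℕ j → ∃ λ k → iter f k (f d) ≡ d
    back (suc k) _ m+i≡j = k , sym (iter-injective inj (toℕ i) (trans (combine-pair eq)
      (trans (cong (λ l → iter f l d) (sym m+i≡j)) (iter-+ f (suc k) (toℕ i) d))))

  module Deletion (A : Fin n → Fin n → Bool) (A-sym : ∀ {x y} → T (A x y) → T (A y x)) (A⊆ : ∀ {x y} → T (A x y) → x ~ y)
                  (u v : Fin n) (Auv : T (A u v)) where

    cut : Fin n → Fin n → Bool
    cut x y = (x == u) ∧ (y == v) ∨ (x == v) ∧ (y == u)

    A′ : Fin n → Fin n → Bool
    A′ x y = A x y ∧ not (cut x y)

    u~v : u ~ v
    u~v = A⊆ Auv

    u≢v : u ≢ v
    u≢v refl = adj-irrefl u~v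

    cut-yes : ∀ {x y} → T (cut x y) → (x ≡ u × y ≡ v) ⊎ (x ≡ v × y ≡ u)
    cut-yes {x} {y} t with x ≟ u | y ≟ v | x ≟ v | y ≟ u
    ... | yes p | yes q | _     | _     = inj₁ (p , q)
    ... | yes p | no _  | yes r | yes s = inj₂ (r , s)
    ... | no _  | _     | yes r | yes s = inj₂ (r , s)

    cut-uv : T (cut u v)
    cut-uv with u ≟ u | v ≟ v
    ... | yes _  | yes _  = tt
    ... | no u≢u | _      = contradiction refl u≢u
    ... | yes _  | no v≢v = contradiction refl v≢v

    cut-vu : T (cut v u)
    cut-vu with v ≟ u | u ≟ v | v ≟ v | u ≟ u
    ... | yes _ | yes _ | _      | _      = tt
    ... | yes _ | no _  | yes _  | yes _  = tt
    ... | no _  | _     | yes _  | yes _  = tt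
    ... | _     | _     | no v≢v | _      = contradiction refl v≢v
    ... | _     | _     | _      | no u≢u = contradiction refl u≢u

    A′⊆A : ∀ {x y} → T (A′ x y) → T (A x y)
    A′⊆A {x} {y} t = proj₁ (∧-elim {A x y} t)

    A′-cut : ∀ {x y} → T (A′ x y) → ¬ T (cut x y)
    A′-cut {x} {y} t c with cut x y
    A′-cut {x} {y} t c | true = proj₂ (∧-elim {A x y} {false} t)

    A-A′ : ∀ {x y} → T (A x y) → ¬ T (cut x y) → T (A′ x y)
    A-A′ {x} {y} t ¬c rewrite ¬T⇒≡false ¬c = ∧-intro {A x y} t tt

    A′-sym : ∀ {x y} → T (A′ x y) → T (A′ y x)
    A′-sym {x} {y} t = A-A′ (A-sym (A′⊆A t)) λ c → A′-cut {x} {y} t (flip (cut-yes {y} {x} c))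
      where
      flip : ∀ {x y} → (y ≡ u × x ≡ v) ⊎ (y ≡ v × x ≡ u) → T (cut x y)
      flip (inj₁ (refl , refl)) = cut-vu
      flip (inj₂ (refl , refl)) = cut-uv

    d d̄ : D
    d = dart u v u~v
    d̄ = rev d

    is-d : ∀ x → T (cut (src x) (tgt x)) → x ≡ d ⊎ x ≡ d̄
    is-d x c with cut-yes {src x} {tgt x} c
    ... | inj₁ (p , q) = inj₁ (dart-≡ p q)
    ... | inj₂ (p , q) = inj₂ (dart-≡ p q)

    φd : φ A d ≡ ρ d̄
    φd = cong ρ (α-on A d Auv)

    φd̄ : φ A d̄ ≡ ρ d
    φd̄ = cong ρ (trans (α-on A d̄ (A-sym Auv)) (rev-rev d))

    φ′d : φ A′ d ≡ ρ d
    φ′d = cong ρ (α-off A′ d λ t → A′-cut {u} {v} t cut-uv)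

    φ′d̄ : φ A′ d̄ ≡ ρ d̄
    φ′d̄ = cong ρ (α-off A′ d̄ λ t → A′-cut {v} {u} t cut-vu)

    φ′-other : ∀ x → x ≢ d → x ≢ d̄ → φ A′ x ≡ φ A x
    φ′-other x x≢d x≢d̄ = cong ρ (by (T? (onA A x)))
      where
      by : Dec (T (onA A x)) → α A′ x ≡ α A x
      by (no ¬t) = trans (α-off A′ x (¬t ∘ A′⊆A)) (sym (α-off A x ¬t))
      by (yes t) = trans (α-on A′ x (A-A′ t λ c → [ x≢d , x≢d̄ ]′ (is-d x c))) (sym (α-on A x t))

    φ-injective : ∀ {x y} → φ A x ≡ φ A y → x ≡ y
    φ-injective {x} {y} eq = trans (sym (α-α x)) (trans (cong (α A) (ρ-injective eq)) (α-α y))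
      where
      α-α : ∀ x → α A (α A x) ≡ x
      α-α x = by (T? (onA A x))
        where
        by : Dec (T (onA A x)) → α A (α A x) ≡ x
        by (yes t) = trans (cong (α A) (α-on A x t)) (trans (α-on A (rev x) (A-sym t)) (rev-rev x))
        by (no ¬t) = trans (cong (α A) (α-off A x ¬t)) (α-off A x ¬t)

    F = proj₂ (faceLabels A)
    F′ = proj₂ (faceLabels A′)
    C = proj₂ (componentLabels A)
    C′ = proj₂ (componentLabels A′)

    f f′ : X → _
    f  = cls F
    f′ = cls F′

    F-step : ∀ x → f (pair x) ≡ f (pair (φ A x))
    F-step = proj₁ (resp-face A f (ident F))

    F′-step : ∀ x → f′ (pair x) ≡ f′ (pair (φ A′ x))
    F′-step = proj₁ (resp-face A′ f′ (ident F′))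

    -- Cutting the edge splits its face or merges its two faces.
    split-or-merge : f (pair d) ≡ f (pair d̄) ⊎ f′ (pair d) ≡ f′ (pair d̄)
    split-or-merge with returns φ-injective d
    ... | k , back = conclude (walk k (φ A d) back)
      where
      -- The old face is followed until it meets one of the two darts; up to there the old and new
      -- steps agree. Arriving at `d` puts the start into the new face of `d`, meeting the reverse
      -- dart into the old face of that one.
      walk : ∀ k x → iter (φ A) k x ≡ d → f′ (pair x) ≡ f′ (pair d) ⊎ f (pair x) ≡ f (pair d̄)
      walk zero x refl = inj₁ refl
      walk (suc k) x eq with x ≟ᴰ d | x ≟ᴰ d̄
      ... | yes refl | _        = inj₁ refl
      ... | no _     | yes refl = inj₂ refl
      ... | no x≢d   | no x≢d̄  with walk k (φ A x) eq
      ...   | inj₁ same = inj₁ (trans (F′-step x) (trans (cong (f′ ∘ pair) (φ′-other x x≢d x≢d̄)) same))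
      ...   | inj₂ same = inj₂ (trans (F-step x) same)
      conclude : f′ (pair (φ A d)) ≡ f′ (pair d) ⊎ f (pair (φ A d)) ≡ f (pair d̄) → f (pair d) ≡ f (pair d̄) ⊎ f′ (pair d) ≡ f′ (pair d̄)
      conclude (inj₁ same) = inj₂ (trans (sym same) (trans (cong (f′ ∘ pair) (trans φd (sym φ′d̄))) (sym (F′-step d̄))))
      conclude (inj₂ same) = inj₁ (trans (F-step d) same)

    -- The old and the new face steps differ only by exchanging the successors of the two darts,
    -- which `ψ` does not distinguish.
    swap-resp : ∀ {Y : Set} (ψ : X → Y) → ψ (pair d) ≡ ψ (pair d̄) → All (Respects ψ) (faceList A) → All (Respects ψ) (faceList A′)
    swap-resp ψ same all = face-resp A′ ψ on-darts (proj₂ (resp-face A ψ all))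
      where
      on : ∀ x → ψ (pair x) ≡ ψ (pair (φ A x))
      on = proj₁ (resp-face A ψ all)
      on-darts : ∀ x → ψ (pair x) ≡ ψ (pair (φ A′ x))
      on-darts x with x ≟ᴰ d | x ≟ᴰ d̄
      ... | yes refl | _        = trans same (trans (on d̄) (cong (ψ ∘ pair) (trans φd̄ (sym φ′d))))
      ... | no _     | yes refl = trans (sym same) (trans (on d) (cong (ψ ∘ pair) (trans φd (sym φ′d̄))))
      ... | no x≢d   | no x≢d̄  = trans (on x) (cong (ψ ∘ pair) (sym (φ′-other x x≢d x≢d̄)))

    F≤F′+1 : #F A ≤ suc (#F A′)
    F≤F′+1 with add F (pair d) (pair d̄)
    -- Identifying the two darts costs at most one of the old classes, and the result respects the
    -- new faces.
    ... | k , F≤ , M = ≤-trans F≤ (s≤s (count≤ F′ (cls M) (swap-resp (cls M) (All.head (ident M)) (All.tail (ident M)))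
                         λ j → pre M j , cls-pre M j))

    c′ : Fin n → _
    c′ = cls C′

    C≤ : c′ u ≡ c′ v → #C A′ ≤ #C A
    C≤ same = count≤ C c′ (edge-resp A c′ connected) λ j → pre C′ j , cls-pre C′ j
      where
      connected : ∀ x y → T (A x y) → c′ x ≡ c′ y
      connected x y t with T? (cut x y)
      ... | no ¬c = resp-edge A′ c′ (ident C′) x y (A-A′ t ¬c)
      ... | yes c with cut-yes {x} {y} c
      ...   | inj₁ (refl , refl) = same
      ...   | inj₂ (refl , refl) = sym same

    C′≤C+1 : #C A′ ≤ suc (#C A)
    C′≤C+1 with add C′ u v
    ... | k , C′≤ , M = ≤-trans C′≤ (s≤s (count≤ C (cls M) (edge-resp A (cls M) connected) λ j → pre M j , cls-pre M j))
      where
      connected : ∀ x y → T (A x y) → cls M x ≡ cls M y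
      connected x y t with T? (cut x y)
      ... | no ¬c = resp-edge A′ (cls M) (All.tail (ident M)) x y (A-A′ t ¬c)
      ... | yes c with cut-yes {x} {y} c
      ...   | inj₁ (refl , refl) = All.head (ident M)
      ...   | inj₂ (refl , refl) = sym (All.head (ident M))

    -- At a bridge, the two darts lie on the same face before the cut and on different faces after it.
    bridge : c′ u ≢ c′ v → suc (#F A) ≤ #F A′
    bridge u≢v with f′ (pair d) ≟ f′ (pair d̄)
    ... | yes same = contradiction (universal F′ (c′ ∘ proj₁) (face-resp A′ (c′ ∘ proj₁) stay glued) same) u≢v
      where
      glued : ∀ x y → ¬ x ~ y → c′ x ≡ c′ (proj₁ (glue A′ x))
      glued x y _ with any? (λ w → T? (adj x w))
      ... | yes _ = refl
      ... | no _  = refl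
      stay : ∀ x → c′ (src x) ≡ c′ (src (φ A′ x))
      stay x = trans (by (T? (onA A′ x))) (cong c′ (sym (rot-src (α A′ x))))
        where
        by : Dec (T (onA A′ x)) → c′ (src x) ≡ c′ (src (α A′ x))
        by (yes t) = trans (resp-edge A′ c′ (ident C′) _ _ t) (cong (c′ ∘ src) (sym (α-on A′ x t)))
        by (no ¬t) = cong (c′ ∘ src) (sym (α-off A′ x ¬t))
    ... | no differ with split-or-merge
    ...   | inj₂ same = contradiction same differ
    ...   | inj₁ same with merge F′ (pair d) (pair d̄) differ
    ...     | k , suc-k , M = ≤-trans (s≤s (count≤ M f (same ∷ swap-resp f same (ident F)) λ j → pre F j , cls-pre F j)) (≤-reflexive suc-k)

    D≡ : #D A ≡ #D A′ + 2
    D≡ = begin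
      #D A
        ≡⟨ sum-cong (λ x → sum-cong (λ y → at x y)) ⟩
      sum (λ x → sum λ y → A′ x y · 1 + ((x == u) · ((y == v) · 1) + (x == v) · ((y == u) · 1)))
        ≡⟨ sum-cong (λ x → sum-+ (λ y → A′ x y · 1) _) ⟩
      sum (λ x → sum (λ y → A′ x y · 1) + sum (λ y → (x == u) · ((y == v) · 1) + (x == v) · ((y == u) · 1)))
        ≡⟨ sum-+ (λ x → sum (λ y → A′ x y · 1)) _ ⟩
      #D A′ + sum (λ x → sum (λ y → (x == u) · ((y == v) · 1) + (x == v) · ((y == u) · 1)))
        ≡⟨ cong (#D A′ +_) (trans (sum-cong λ x → sum-+ (λ y → (x == u) · ((y == v) · 1)) _) (sum-+ (λ x → sum λ y → (x == u) · ((y == v) · 1)) _)) ⟩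
      #D A′ + (sum (λ x → sum (λ y → (x == u) · ((y == v) · 1))) + sum (λ x → sum (λ y → (x == v) · ((y == u) · 1))))
        ≡⟨ cong (#D A′ +_) (cong₂ _+_ (spike u v) (spike v u)) ⟩
      #D A′ + 2 ∎
      where
      open ≡-Reasoning
      pull : ∀ b (h : Fin n → ℕ) → sum (λ y → b · h y) ≡ b · sum h
      pull true  h = refl
      pull false h = sum-0 {n} (λ _ → 0) (λ _ → refl)
      spike : ∀ p q → sum (λ x → sum (λ y → (x == p) · ((y == q) · 1))) ≡ 1
      spike p q = trans (sum-cong λ x → trans (pull (x == p) (λ y → (y == q) · 1)) (cong ((x == p) ·_) (sum-δ q (λ _ → 1)))) (sum-δ p (λ _ → 1))
      at : ∀ x y → A x y · 1 ≡ A′ x y · 1 + ((x == u) · ((y == v) · 1) + (x == v) · ((y == u) · 1))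
      at x y with x ≟ u | y ≟ v | x ≟ v | y ≟ u
      ... | yes refl | yes refl | yes u≡v | _ = contradiction u≡v u≢v
      ... | yes refl | yes refl | no _ | _ rewrite T⇒≡true Auv = refl
      ... | yes refl | no _ | yes u≡v | _ = contradiction u≡v u≢v
      ... | yes refl | no _ | no _ | _ = unchanged (A x y)
        where
        unchanged : ∀ b → b · 1 ≡ (b ∧ true) · 1 + 0
        unchanged true  = refl
        unchanged false = refl
      ... | no _ | _ | yes refl | yes refl rewrite T⇒≡true (A-sym Auv) = refl
      ... | no _ | _ | yes refl | no _ = unchanged (A x y)
        where
        unchanged : ∀ b → b · 1 ≡ (b ∧ true) · 1 + 0
        unchanged true  = refl
        unchanged false = refl
      ... | no _ | _ | no _ | _ = unchanged (A x y)
        where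
        unchanged : ∀ b → b · 1 ≡ (b ∧ true) · 1 + 0
        unchanged true  = refl
        unchanged false = refl

    -- The left side loses 2 with the two darts. Off bridges the right side loses at most 2. At a
    -- bridge the additional component costs 4, of which the darts cover 2 and the additional face
    -- the other 2.
    delete : Euler A → Euler A′
    delete euler = +-cancelˡ-≤ 2 _ _ (≤-trans (≤-reflexive (trans (shuffle (#D A′) _) (cong (_+ 4 * #C A′) (sym D≡)))) (by (c′ u ≟ c′ v)))
      where
      shuffle : ∀ p q → 2 + (p + q) ≡ p + 2 + q
      shuffle = solve-∀
      by : Dec (c′ u ≡ c′ v) → #D A + 4 * #C A′ ≤ 2 + (2 * n + 2 * #F A′)
      by (yes same) = begin
        #D A + 4 * #C A′         ≤⟨ +-monoʳ-≤ (#D A) (*-monoʳ-≤ 4 (C≤ same)) ⟩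
        #D A + 4 * #C A          ≤⟨ euler ⟩
        2 * n + 2 * #F A         ≤⟨ +-monoʳ-≤ (2 * n) (*-monoʳ-≤ 2 F≤F′+1) ⟩
        2 * n + 2 * suc (#F A′)  ≡⟨ sh (2 * n) (#F A′) ⟩
        2 + (2 * n + 2 * #F A′)  ∎
        where
        open ≤-Reasoning
        sh : ∀ p q → p + 2 * suc q ≡ 2 + (p + 2 * q)
        sh = solve-∀
      by (no differ) = begin
        #D A + 4 * #C A′               ≤⟨ +-monoʳ-≤ (#D A) (*-monoʳ-≤ 4 C′≤C+1) ⟩
        #D A + 4 * suc (#C A)          ≡⟨ sh (#D A) (#C A) ⟩
        4 + (#D A + 4 * #C A)          ≤⟨ +-monoʳ-≤ 4 euler ⟩
        4 + (2 * n + 2 * #F A)         ≡⟨ sh′ (2 * n) (#F A) ⟩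
        2 + (2 * n + 2 * suc (#F A))   ≤⟨ +-monoʳ-≤ 2 (+-monoʳ-≤ (2 * n) (*-monoʳ-≤ 2 (bridge differ))) ⟩
        2 + (2 * n + 2 * #F A′)        ∎
        where
        open ≤-Reasoning
        sh : ∀ p q → p + 4 * suc q ≡ 4 + (p + 4 * q)
        sh = solve-∀
        sh′ : ∀ p q → 4 + (p + 2 * q) ≡ 2 + (p + 2 * suc q)
        sh′ = solve-∀

-- Face lengths and the resulting sparsity of the subgraph.

module FaceCount {n : ℕ} (G : Graph (Fin n)) (rotation : Rotation G)
  (noC4 : ∀ {p q r s} → Graph._~_ G p q → Graph._~_ G q r → Graph._~_ G r s → Graph._~_ G s p → p ≢ r → q ≢ s → Empty)
  (noC5 : ∀ {p q r s t} → Graph._~_ G p q → Graph._~_ G q r → Graph._~_ G r s → Graph._~_ G s t → Graph._~_ G t p →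
          p ≢ r → p ≢ s → q ≢ s → q ≢ t → r ≢ t → Empty)
  (A : Fin n → Fin n → Bool) (A-sym : ∀ {x y} → T (A x y) → T (A y x)) (A⊆ : ∀ {x y} → T (A x y) → Graph._~_ G x y)
  (h : Fin n → Bool) (A-h : ∀ {x y} → T (A x y) → T (h x))
  (two-nbrs : ∀ x → T (h x) → ∀ p → ∃ λ y → T (A x y) × y ≢ p)
  (three-nbrs : ∀ {x y} → T (A x y) → (∀ p → ∃ λ z → T (A x z) × z ≢ y × z ≢ p) ⊎ (∀ p → ∃ λ z → T (A y z) × z ≢ x × z ≢ p)) where
  open Graph G using (adj; adj-sym; adj-irrefl; _~_)
  open Rotation rotation using (rot; rot-src; rot-cyclic)
  open Embedded G rotation
  open Labels
  open Dart

  On : D → Set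
  On d = T (onA A d)

  on-rev : ∀ {d} → On d → On (rev d)
  on-rev = A-sym

  iter-comm : ∀ k x → iter ρ (suc k) x ≡ ρ (iter ρ k x)
  iter-comm zero    x = refl
  iter-comm (suc k) x = iter-comm k (ρ x)

  src-iter : ∀ k x → src (iter ρ k x) ≡ src x
  src-iter zero    x = refl
  src-iter (suc k) x = trans (src-iter k (ρ x)) (rot-src x)

  Path : D → D → Set
  Path = Star (λ x y → ρ x ≡ y)

  path⇒iter : ∀ {x y} → Path x y → ∃ λ k → iter ρ k x ≡ y
  path⇒iter ε          = 0 , refl
  path⇒iter (refl ◅ p) = let k , eq = path⇒iter p in suc k , eq

  closed : ∀ {Z : D → Set} → (∀ {x} → Z x → Z (ρ x)) → ∀ {x y} → Path x y → Z x → Z y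
  closed f ε          z = z
  closed f (refl ◅ p) z = closed f p (f z)

  least : ∀ {P : ℕ → Set} → (∀ k → Dec (P k)) → ∀ k → P k → ∃ λ j → P j × (∀ i → i < j → ¬ P i)
  least P? zero    p = 0 , p , λ _ ()
  least P? (suc k) p with P? 0
  ... | yes p₀ = 0 , p₀ , λ _ ()
  ... | no ¬p₀ with least (P? ∘ suc) k p
  ...   | j , pj , below = suc j , pj , λ where
          zero    _         → ¬p₀
          (suc i) (s≤s i<j) → below i i<j

  -- The next dart of A on the face of d.
  record Next (d d′ : D) : Set where
    field
      on    : On d′
      k     : ℕ
      at    : iter ρ (suc k) (rev d) ≡ d′
      skip  : ∀ j → j < k → ¬ On (iter ρ (suc j) (rev d))
      turn  : d′ ≢ rev d

  Arc : D → ℕ → D → Set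
  Arc x k y = ∃ λ j → j ≤ k × iter ρ j x ≡ y

  arc-on : ∀ {x k y} → (∀ j → j < k → ¬ On (iter ρ (suc j) x)) → Arc x k y → On y → y ≡ x
  arc-on skip (zero  , _   , eq) on = sym eq
  arc-on skip (suc j , j<k , eq) on = contradiction (subst On (sym eq) on) (skip j j<k)

  arc-next : ∀ {x k y} → Arc x k y → Arc x k (ρ y) ⊎ ρ y ≡ iter ρ (suc k) x
  arc-next {x} {k} (j , j≤k , refl) with m≤n⇒m<n∨m≡n j≤k
  ... | inj₁ j<k  = inj₁ (suc j , j<k , iter-comm j x)
  ... | inj₂ refl = inj₂ (sym (iter-comm j x))

  -- Rotating on from `rev d`, a dart of `A` is met, because the target has a second neighbour. It
  -- is not `rev d` again, since the rotation would then close up before reaching that neighbour.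
  follow : ∀ d → On d → ∃ λ d′ → Next d d′
  follow d on with two-nbrs (tgt d) (A-h (on-rev {d} on)) (src d)
  ... | w , Avw , w≢u with path⇒iter (rot-cyclic (rev d) (dart (tgt d) w (A⊆ Avw)) refl)
  ...   | zero  , eq = contradiction (sym (cong tgt eq)) w≢u
  ...   | suc K , eq with least (λ j → T? (onA A (iter ρ (suc j) (rev d)))) K (subst On (sym eq) Avw)
  ...     | k , onk , skip = iter ρ (suc k) (rev d) , record { on = onk ; k = k ; at = refl ; skip = skip ; turn = turn }
    where
    turn : iter ρ (suc k) (rev d) ≢ rev d
    turn back = w≢u (cong tgt (arc-on skip
      (closed {Arc (rev d) k} (λ z → [ id , (λ eq′ → 0 , z≤n , sym (trans eq′ back)) ]′ (arc-next z))
        (rot-cyclic (rev d) (dart (tgt d) w (A⊆ Avw)) refl) (0 , z≤n , refl)) Avw))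

  abstract
    s : D → D
    s d with T? (onA A d)
    ... | yes on = proj₁ (follow d on)
    ... | no _   = d

    s-next : ∀ {d} → On d → Next d (s d)
    s-next {d} on with T? (onA A d)
    ... | yes on′ = proj₂ (follow d on′)
    ... | no ¬on  = contradiction on ¬on

  s-on : ∀ {d} → On d → On (s d)
  s-on on = Next.on (s-next on)

  s-src : ∀ {d} → On d → src (s d) ≡ tgt d
  s-src {d} on = trans (cong src (sym (Next.at (s-next on)))) (src-iter (suc (Next.k (s-next on))) (rev d))

  s-turn : ∀ {d} → On d → tgt (s d) ≢ src d
  s-turn {d} on eq = Next.turn (s-next on) (dart-≡ (s-src on) eq)

  rev-injective : ∀ {d d′} → rev d ≡ rev d′ → d ≡ d′
  rev-injective eq = dart-≡ (cong tgt eq) (cong src eq)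

  -- Cancelling the shorter rotation, `rev d` is reached from `rev d′` by the difference of the two.
  -- As a dart of `A` it is none of the skipped ones, so the difference is zero.
  ordered : ∀ {d d′ e} → On d → (N : Next d e) (N′ : Next d′ e) → Next.k N ≤ Next.k N′ → d ≡ d′
  ordered {d} {d′} on N N′ k≤k′ = rev-injective (by (Next.k N′ ∸ Next.k N) (m∸n+n≡m k≤k′))
    where
    by : ∀ m → m + Next.k N ≡ Next.k N′ → rev d ≡ rev d′
    by m m+k with iter-injective ρ-injective (suc (Next.k N)) {rev d} {iter ρ m (rev d′)}
        (trans (Next.at N) (trans (sym (Next.at N′)) (trans (cong (λ l → iter ρ l (rev d′)) (sym (trans (+-suc m _) (cong suc m+k))))
          (iter-+ ρ m (suc (Next.k N)) (rev d′)))))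
    by zero    m+k | same = same
    by (suc m) m+k | same = contradiction (subst On same (on-rev {d} on)) (Next.skip N′ m (≤-trans (m≤m+n (suc m) _) (≤-reflexive m+k)))

  s-injective : ∀ {d d′} → On d → On d′ → s d ≡ s d′ → d ≡ d′
  s-injective {d} {d′} on on′ eq with ≤-total (Next.k (s-next on)) (Next.k (subst (Next d′) (sym eq) (s-next on′)))
  ... | inj₁ k≤k′ = ordered on (s-next on) (subst (Next d′) (sym eq) (s-next on′)) k≤k′
  ... | inj₂ k′≤k = sym (ordered on′ (subst (Next d′) (sym eq) (s-next on′)) (s-next on) k′≤k)

  -- If the two faces at a corner with darts p and q run through p and q only,
  -- there are no other darts at this vertex.
  two-cycle : ∀ {p q t} → On p → On q → On t → src p ≡ src t → s (rev p) ≡ q → s (rev q) ≡ p → t ≡ p ⊎ t ≡ q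
  two-cycle {p} {q} {t} onp onq ont src≡ p→q q→p = conclude (closed {Z} step-Z (rot-cyclic p t src≡) (inj₁ (0 , z≤n , rev-rev p)))
    where
    N = s-next (on-rev {p} onp)
    M = s-next (on-rev {q} onq)
    Z : D → Set
    Z y = Arc (rev (rev p)) (Next.k N) y ⊎ Arc (rev (rev q)) (Next.k M) y
    step-Z : ∀ {y} → Z y → Z (ρ y)
    step-Z (inj₁ z) with arc-next z
    ... | inj₁ z′ = inj₁ z′
    ... | inj₂ eq = inj₂ (0 , z≤n , trans (rev-rev q) (sym (trans eq (trans (Next.at N) p→q))))
    step-Z (inj₂ z) with arc-next z
    ... | inj₁ z′ = inj₂ z′
    ... | inj₂ eq = inj₁ (0 , z≤n , trans (rev-rev p) (sym (trans eq (trans (Next.at M) q→p))))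
    conclude : Z t → t ≡ p ⊎ t ≡ q
    conclude (inj₁ z) = inj₁ (trans (arc-on (Next.skip N) z ont) (rev-rev p))
    conclude (inj₂ z) = inj₂ (trans (arc-on (Next.skip M) z ont) (rev-rev q))

  s-iter-on : ∀ k {d} → On d → On (iter s k d)
  s-iter-on zero    on = on
  s-iter-on (suc k) on = s-iter-on k (s-on on)

  s-peel : ∀ k {d e} → On d → On e → iter s k d ≡ iter s k e → d ≡ e
  s-peel zero    on on′ eq = eq
  s-peel (suc k) on on′ eq = s-injective on on′ (s-peel k (s-on on) (s-on on′) eq)

  Tri3 : D → Set
  Tri3 d = s (s (s d)) ≡ d

  module Walk {d} (on : On d) where

    v : ℕ → Fin n
    v k = src (iter s k d)

    v-step : ∀ k → tgt (iter s k d) ≡ v (suc k)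
    v-step k = trans (sym (s-src (s-iter-on k on))) (cong src (comm k d))
      where
      comm : ∀ k x → s (iter s k x) ≡ iter s k (s x)
      comm zero    x = refl
      comm (suc k) x = comm k (s x)

    v~ : ∀ k → v k ~ v (suc k)
    v~ k = subst (v k ~_) (v-step k) (edge (iter s k d))

    v-turn : ∀ k → v k ≢ v (suc (suc k))
    v-turn k eq = s-turn (s-iter-on k on) (trans (cong tgt (comm k d)) (trans (v-step (suc k)) (sym eq)))
      where
      comm : ∀ k x → s (iter s k x) ≡ iter s k (s x)
      comm zero    x = refl
      comm (suc k) x = comm k (s x)

    -- A closed non-backtracking walk of length 4 or 5 is a cycle.
    period≢ : ¬ Tri3 d → ∀ p → 1 ≤ p → p ≤ 5 → iter s p d ≢ d
    period≢ ¬tri 1 _ _ eq = adj-irrefl (subst (v 0 ~_) (cong src eq) (v~ 0))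
    period≢ ¬tri 2 _ _ eq = v-turn 0 (sym (cong src eq))
    period≢ ¬tri 3 _ _ eq = ¬tri eq
    period≢ ¬tri 4 _ _ eq = noC4 (v~ 0) (v~ 1) (v~ 2) (subst (v 3 ~_) (cong src eq) (v~ 3)) (v-turn 0) (v-turn 1)
    period≢ ¬tri 5 _ _ eq = noC5 (v~ 0) (v~ 1) (v~ 2) (v~ 3) (subst (v 4 ~_) (cong src eq) (v~ 4))
      (v-turn 0) (λ e → v-turn 3 (trans (sym e) (sym (cong src eq)))) (v-turn 1)
      (λ e → v-turn 4 (trans (sym e) (sym (cong (src ∘ s) eq)))) (v-turn 2)
    period≢ ¬tri (suc (suc (suc (suc (suc (suc _)))))) _ (s≤s (s≤s (s≤s (s≤s (s≤s ())))))

    apart-on-walk : ¬ Tri3 d → ∀ i p → 1 ≤ p → p ≤ 5 → iter s i d ≢ iter s (p + i) d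
    apart-on-walk ¬tri i p 1≤p p≤5 eq = period≢ ¬tri p 1≤p p≤5
      (sym (s-peel i on (s-iter-on p on) (trans eq (iter-+ s p i d))))

    1≤ : ∀ {k} → 1 ≤ suc k
    1≤ = s≤s z≤n

    six-distinct : ¬ Tri3 d → AllPairs _≢_ (d ∷ iter s 1 d ∷ iter s 2 d ∷ iter s 3 d ∷ iter s 4 d ∷ iter s 5 d ∷ [])
    six-distinct ¬tri =
      (ne 0 1 ∷ ne 0 2 ∷ ne 0 3 ∷ ne 0 4 ∷ ne 0 5 ∷ []) ∷ (ne 1 1 ∷ ne 1 2 ∷ ne 1 3 ∷ ne 1 4 ∷ []) ∷
      (ne 2 1 ∷ ne 2 2 ∷ ne 2 3 ∷ []) ∷ (ne 3 1 ∷ ne 3 2 ∷ []) ∷ (ne 4 1 ∷ []) ∷ [] ∷ []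
      where
      ne : ∀ i p {_ : T (1 ≤ᵇ p)} {_ : T (p ≤ᵇ 5)} → iter s i d ≢ iter s (p + i) d
      ne i p {1≤p} {p≤5} = apart-on-walk ¬tri i p (≤ᵇ⇒≤ 1 p 1≤p) (≤ᵇ⇒≤ p 5 p≤5)

    three-distinct : AllPairs _≢_ (d ∷ s d ∷ s (s d) ∷ [])
    three-distinct = (d≢sd on ∷ d≢ssd ∷ []) ∷ (d≢sd (s-on on) ∷ []) ∷ [] ∷ []
      where
      d≢sd : ∀ {e} → On e → e ≢ s e
      d≢sd {e} on-e eq = adj-irrefl (subst (src e ~_) (trans (sym (s-src on-e)) (cong src (sym eq))) (edge e))
      d≢ssd : d ≢ s (s d)
      d≢ssd eq = v-turn 0 (cong src eq)

  ΣΣ : (Fin n → Fin n → ℕ) → ℕ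
  ΣΣ g = sum λ u → sum λ v → g u v

  ΣΣ-mono : ∀ {g g′} → (∀ u v → g u v ≤ g′ u v) → ΣΣ g ≤ ΣΣ g′
  ΣΣ-mono g≤ = sum-mono λ u → sum-mono λ v → g≤ u v

  ΣΣ-cong : ∀ {g g′} → (∀ u v → g u v ≡ g′ u v) → ΣΣ g ≡ ΣΣ g′
  ΣΣ-cong g≡ = sum-cong λ u → sum-cong λ v → g≡ u v

  ΣΣ-+ : ∀ g g′ → ΣΣ (λ u v → g u v + g′ u v) ≡ ΣΣ g + ΣΣ g′
  ΣΣ-+ g g′ = trans (sum-cong λ u → sum-+ (g u) (g′ u)) (sum-+ (λ u → sum (g u)) (λ u → sum (g′ u)))

  pull : ∀ {l} b (k : Fin l → ℕ) → sum (λ y → b · k y) ≡ b · sum k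
  pull true  k = refl
  pull {l} false k = sum-0 {l} (λ _ → 0) (λ _ → refl)

  distinct≤ΣΣ : ∀ g ds → AllPairs _≢_ ds → ∑ᴸ (λ d → g (src d) (tgt d)) ds ≤ ΣΣ g
  distinct≤ΣΣ g ds dis = subst (_≤ ΣΣ g) (sum-marks ds) (ΣΣ-mono (marks≤ ds dis))
    where
    mark : D → Fin n → Fin n → ℕ
    mark d u v = (u == src d) · (v == tgt d) · g u v
    marks : List D → Fin n → Fin n → ℕ
    marks ds u v = ∑ᴸ (λ d → mark d u v) ds
    marks-0 : ∀ {d ds} → All (d ≢_) ds → marks ds (src d) (tgt d) ≡ 0
    marks-0 []                             = refl
    marks-0 {d} (_∷_ {x = e} d≢e rest) with src d ≟ src e | tgt d ≟ tgt e
    ... | yes p | yes q = contradiction (dart-≡ p q) d≢e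
    ... | yes _ | no _  = marks-0 rest
    ... | no _  | _     = marks-0 rest
    marks≤ : ∀ ds → AllPairs _≢_ ds → ∀ u v → marks ds u v ≤ g u v
    marks≤ []       []         u v = z≤n
    marks≤ (d ∷ ds) (d≢ ∷ dis) u v with u ≟ src d | v ≟ tgt d
    ... | yes refl | yes refl rewrite marks-0 d≢ = ≤-reflexive (+-identityʳ _)
    ... | yes _    | no _     = marks≤ ds dis u v
    ... | no _     | _        = marks≤ ds dis u v
    sum-marks : ∀ ds → ΣΣ (marks ds) ≡ ∑ᴸ (λ d → g (src d) (tgt d)) ds
    sum-marks []       = sum-0 {n} _ λ u → sum-0 {n} (λ _ → 0) λ v → refl
    sum-marks (d ∷ ds) = trans (ΣΣ-+ (mark d) (marks ds)) (cong₂ _+_ (spike d) (sum-marks ds))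
      where
      spike : ∀ d → ΣΣ (mark d) ≡ g (src d) (tgt d)
      spike d = trans (sum-cong λ u → trans (pull (u == src d) (λ v → (v == tgt d) · g u v))
        (cong ((u == src d) ·_) (sum-δ (tgt d) (g u)))) (sum-δ (src d) (λ u → g u (tgt d)))

  TriAt : Fin n → Fin n → Set
  TriAt u v = Σ (T (A u v)) λ t → Tri3 (dart u v (A⊆ t))

  triAt? : ∀ u v → Dec (TriAt u v)
  triAt? u v = by (T? (A u v))
    where
    by : Dec (T (A u v)) → Dec (TriAt u v)
    by (no ¬t) = no (¬t ∘ proj₁)
    by (yes t) with s (s (s (dart u v (A⊆ t)))) ≟ᴰ dart u v (A⊆ t)
    ... | yes tri = yes (t , tri)
    ... | no ¬tri = no λ (_ , tri) → ¬tri (subst Tri3 (dart-≡ refl refl) tri)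

  tf : Fin n → Fin n → Bool
  tf u v = does (triAt? u v)

  tf-tri : ∀ {u v} → T (tf u v) → TriAt u v
  tf-tri {u} {v} t = by (triAt? u v) t
    where
    by : ∀ {P : Set} (P? : Dec P) → T (does P?) → P
    by (yes p) _ = p

  tri-tf : ∀ {d} → On d → Tri3 d → tf (src d) (tgt d) ≡ true
  tri-tf {d} on tri = by (triAt? (src d) (tgt d)) (on , subst Tri3 (dart-≡ refl refl) tri)
    where
    by : ∀ {P : Set} (P? : Dec P) → P → does P? ≡ true
    by (yes _) _ = refl
    by (no ¬p) p = contradiction p ¬p

  -- Chosen so that every face with a dart of `A` weighs at least 12: three darts of weight 4 on a
  -- triangle, six of weight 2 otherwise.
  weight : Fin n → Fin n → ℕ
  weight u v = A u v · (2 + tf u v · 2)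

  Fa = proj₂ (faceLabels A)

  f : X → Fin (#F A)
  f = cls Fa

  f-step : ∀ d → f (pair d) ≡ f (pair (φ A d))
  f-step = proj₁ (resp-face A f (ident Fa))

  f-glue : ∀ u v → ¬ u ~ v → f (u , v) ≡ f (glue A u)
  f-glue = proj₂ (resp-face A f (ident Fa))

  f-off : ∀ d → ¬ On d → f (pair d) ≡ f (pair (ρ d))
  f-off d ¬on = trans (f-step d) (cong (f ∘ pair ∘ ρ) (α-off A d ¬on))

  f-s : ∀ {d} → On d → f (pair d) ≡ f (pair (s d))
  f-s {d} on = trans (f-step d) (trans (cong (f ∘ pair ∘ ρ) (α-on A d on))
    (trans (along (Next.k N) ≤-refl) (cong (f ∘ pair) (Next.at N))))
    where
    N = s-next on
    along : ∀ j → j ≤ Next.k N → f (pair (ρ (rev d))) ≡ f (pair (iter ρ (suc j) (rev d)))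
    along zero    _   = refl
    along (suc j) j<k = trans (along j (<⇒≤ j<k)) (trans (f-off _ (Next.skip N j j<k)) (cong (f ∘ pair) (sym (iter-comm (suc j) (rev d)))))

  f-iter : ∀ k {d} → On d → f (pair d) ≡ f (pair (iter s k d))
  f-iter zero    on = refl
  f-iter (suc k) on = trans (f-s on) (f-iter k (s-on on))

  in-class : Fin (#F A) → Fin n → Fin n → ℕ
  in-class i u v = (f (u , v) == i) · weight u v

  hits : ∀ {i d} → f (pair d) ≡ i → in-class i (src d) (tgt d) ≡ weight (src d) (tgt d)
  hits {i} {d} eq with f (pair d) ≟ i
  ... | yes _ = refl
  ... | no ≢i = contradiction eq ≢i

  weight-on : ∀ {d} → On d → weight (src d) (tgt d) ≡ 2 + tf (src d) (tgt d) · 2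
  weight-on {d} on = cong (_· (2 + tf (src d) (tgt d) · 2)) (T⇒≡true on)

  2≤weight : ∀ {d} → On d → 2 ≤ weight (src d) (tgt d)
  2≤weight {d} on = subst (2 ≤_) (sym (weight-on {d} on)) (m≤m+n 2 _)

  4≤weight : ∀ {d} → On d → Tri3 d → 4 ≤ weight (src d) (tgt d)
  4≤weight {d} on tri = ≤-reflexive (sym (trans (weight-on {d} on) (cong (λ b → 2 + b · 2) (tri-tf on tri))))

  heavy : ∀ {d i} → On d → f (pair d) ≡ i → 12 ≤ ΣΣ (in-class i)
  heavy {d} {i} on fd≡i with s (s (s d)) ≟ᴰ d
  ... | yes tri = ≤-trans (+-mono-≤ (four on fd≡i tri) (+-mono-≤ (four (s-on on) (trans (sym (f-s on)) fd≡i) (cong s tri))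
        (+-mono-≤ (four (s-on (s-on on)) (trans (sym (f-iter 2 on)) fd≡i) (cong (s ∘ s) tri)) z≤n)))
        (distinct≤ΣΣ (in-class i) _ (Walk.three-distinct on))
    where
    four : ∀ {e} → On e → f (pair e) ≡ i → Tri3 e → 4 ≤ in-class i (src e) (tgt e)
    four {e} on-e fe tri = subst (4 ≤_) (sym (hits {d = e} fe)) (4≤weight {e} on-e tri)
  ... | no ¬tri = ≤-trans (+-mono-≤ (two-at 0) (+-mono-≤ (two-at 1) (+-mono-≤ (two-at 2) (+-mono-≤ (two-at 3) (+-mono-≤ (two-at 4) (+-mono-≤ (two-at 5) z≤n))))))
        (distinct≤ΣΣ (in-class i) _ (Walk.six-distinct on ¬tri))
    where
    two-at : ∀ k → 2 ≤ in-class i (src (iter s k d)) (tgt (iter s k d))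
    two-at k = subst (2 ≤_) (sym (hits {d = iter s k d} (trans (sym (f-iter k on)) fd≡i))) (2≤weight {iter s k d} (s-iter-on k on))

  glue-nbr : ∀ {u v} → u ~ v → ∃ λ w → u ~ w × glue A u ≡ (u , w)
  glue-nbr {u} {v} u~v with any? (λ w → T? (adj u w))
  ... | yes (w , u~w) = w , u~w , refl
  ... | no none       = contradiction (v , u~v) none

  outside : Fin (#F A) → Fin n → ℕ
  outside i u = not (h u) · (f (u , u) == i) · 12

  -- A class with a pair at a vertex of `h` contains a dart of `A`, found by rotating, and is heavy.
  -- At a vertex outside `h` there are no such darts, and all its pairs form the class of its
  -- diagonal pair, for which the vertex itself provides the 12.
  class-weight : ∀ i → 12 ≤ ΣΣ (in-class i) + sum (outside i)
  class-weight i with pre Fa i | cls-pre Fa i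
  ... | u , v | fx≡i with T? (h u)
  ...   | no ¬hu = ≤-trans (≤-trans (≤-reflexive (sym at-u)) (term≤sum (outside i) u)) (m≤n+m _ (ΣΣ (in-class i)))
    where
    off : ∀ {d} → src d ≡ u → ¬ On d
    off {d} refl on = ¬hu (A-h {src d} {tgt d} on)
    same-f : ∀ {d d′} → src d ≡ u → Path d d′ → f (pair d) ≡ f (pair d′)
    same-f src≡ ε = refl
    same-f {d} src≡ (refl ◅ p) = trans (f-off d (off {d} src≡)) (same-f (trans (rot-src d) src≡) p)
    to-glue : ∀ w → f (u , w) ≡ f (glue A u)
    to-glue w with T? (adj u w)
    ... | no u≁w  = f-glue u w u≁w
    ... | yes u~w with glue-nbr u~w
    ...   | w₀ , u~w₀ , eq = trans (same-f refl (rot-cyclic (dart u w u~w) (dart u w₀ u~w₀) refl)) (cong f (sym eq))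
    fuu : f (u , u) ≡ i
    fuu = trans (to-glue u) (trans (sym (to-glue v)) fx≡i)
    at-u : outside i u ≡ 12
    at-u rewrite ¬T⇒≡false ¬hu with f (u , u) ≟ i
    ... | yes _ = refl
    ... | no ≢i = contradiction fuu ≢i
  ...   | yes hu with two-nbrs u hu u
  ...     | w , Auw , _ = ≤-trans (heavy {proj₁ found} (proj₁ (proj₂ found)) (trans (proj₂ (proj₂ found)) fx≡i)) (m≤m+n _ _)
    where
    search : ∀ {x t} → Path x t → On t → ∃ λ d → On d × f (pair d) ≡ f (pair x)
    search {x} ε on = x , on , refl
    search {x} (refl ◅ p) on with T? (onA A x)
    ... | yes onx = x , onx , refl
    ... | no ¬onx = let d , ond , eq = search p on in d , ond , trans eq (sym (f-off x ¬onx))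
    from-dart : ∀ {y} → u ~ y → ∃ λ d → On d × f (pair d) ≡ f (u , y)
    from-dart {y} u~y = search (rot-cyclic (dart u y u~y) (dart u w (A⊆ Auw)) refl) Auw
    found : ∃ λ d → On d × f (pair d) ≡ f (u , v)
    found with T? (adj u v)
    ... | yes u~v = from-dart u~v
    ... | no u≁v with glue-nbr (A⊆ Auw)
    ...   | w₀ , u~w₀ , eq = let d , ond , fd = from-dart u~w₀ in d , ond , trans fd (trans (cong f (sym eq)) (sym (f-glue u v u≁v)))

  #out : ℕ
  #out = sum λ u → not (h u) · 1

  sum-classes : ∀ {l} (x : Fin l) k → sum (λ i → (x == i) · k) ≡ k
  sum-classes x k = trans (sum-cong λ i → cong (_· k) (==-sym x i)) (sum-δ x (λ _ → k))
    where
    ==-sym : ∀ {l} (x y : Fin l) → (x == y) ≡ (y == x)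
    ==-sym x y with x ≟ y | y ≟ x
    ... | yes _ | yes _ = refl
    ... | no _  | no _  = refl
    ... | yes p | no ¬q = contradiction (sym p) ¬q
    ... | no ¬p | yes q = contradiction (sym q) ¬p

  face-bound : #F A * 12 ≤ ΣΣ weight + #out * 12
  face-bound = begin
    #F A * 12                                                  ≡⟨ sum-const (#F A) 12 ⟨
    sum {#F A} (λ _ → 12)                                      ≤⟨ sum-mono class-weight ⟩
    sum (λ i → ΣΣ (in-class i) + sum (outside i))              ≡⟨ sum-+ (λ i → ΣΣ (in-class i)) _ ⟩
    sum (λ i → ΣΣ (in-class i)) + sum (λ i → sum (outside i))  ≡⟨ cong₂ _+_ darts vertices ⟩
    ΣΣ weight + #out * 12                                      ∎
    where
    open ≤-Reasoning
    darts : sum (λ i → ΣΣ (in-class i)) ≡ ΣΣ weight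
    darts = trans (sum-swap (λ i u → sum (in-class i u)))
      (sum-cong λ u → trans (sum-swap (λ i v → in-class i u v)) (sum-cong λ v → sum-classes (f (u , v)) (weight u v)))
    scale : ∀ {l} (k : Fin l → ℕ) → sum (λ u → k u * 12) ≡ sum k * 12
    scale {zero}  k = refl
    scale {suc l} k = trans (cong (k zero * 12 +_) (scale (k ∘ suc))) (sym (*-distribʳ-+ 12 (k zero) (sum (k ∘ suc))))
    ·12 : ∀ b → b · 12 ≡ (b · 1) * 12
    ·12 true  = refl
    ·12 false = refl
    vertices : sum (λ i → sum (outside i)) ≡ #out * 12
    vertices = trans (sum-swap outside) (trans (sum-cong λ u → trans (pull (not (h u)) (λ i → (f (u , u) == i) · 12))
      (trans (cong (not (h u) ·_) (sum-classes (f (u , u)) 12)) (·12 (not (h u))))) (scale (λ u → not (h u) · 1)))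

  tr? : ∀ u v → Dec (∃ λ z → T (A u z) × T (A v z))
  tr? u v = any? λ z → T? (A u z) ×-dec T? (A v z)

  tr : Fin n → Fin n → Bool
  tr u v = does (tr? u v)

  module Corner {u v} (t : T (A u v)) (tri : Tri3 (dart u v (A⊆ t))) where
    d₀ d₁ d₂ : D
    d₀ = dart u v (A⊆ t)
    d₁ = s d₀
    d₂ = s d₁
    on₁ : On d₁
    on₁ = s-on {d₀} t
    on₂ : On d₂
    on₂ = s-on {d₁} on₁
    w : Fin n
    w = tgt d₁
    src₁ : src d₁ ≡ v
    src₁ = s-src {d₀} t
    src₂ : src d₂ ≡ w
    src₂ = s-src {d₁} on₁
    tgt₂ : tgt d₂ ≡ u
    tgt₂ = trans (sym (s-src {d₂} on₂)) (cong src tri)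
    Avw : T (A v w)
    Avw = subst (λ x → T (A x w)) src₁ on₁
    Awu : T (A w u)
    Awu = subst₂ (λ x y → T (A x y)) src₂ tgt₂ on₂

  tf-tr : ∀ {u v} → T (tf u v) → T (tr u v)
  tf-tr {u} {v} tf-uv with tf-tri tf-uv
  ... | t , tri = by (tr? u v) (w , A-sym Awu , Avw)
    where
    open Corner t tri
    by : ∀ {P : Set} (P? : Dec P) → P → T (does P?)
    by (yes _) _ = tt
    by (no ¬p) p = contradiction p ¬p

  -- Two triangular faces beside an edge would share their third vertex, as there is no 4-cycle. The
  -- two faces then use up all darts at both ends of the edge, although one end has a third
  -- neighbour.
  tf-exclusive : ∀ {u v} → T (tf u v) → T (tf v u) → Empty
  tf-exclusive {u} {v} tf-uv tf-vu with tf-tri tf-uv | tf-tri tf-vu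
  ... | t , tri | t′ , tri′ = by (three-nbrs t)
    where
    module P = Corner t tri
    module R = Corner t′ tri′
    w≡ : P.w ≡ R.w
    w≡ with P.w ≟ R.w
    ... | yes eq = eq
    ... | no ≢   = ⊥-elim (noC4 (A⊆ (A-sym P.Awu)) (A⊆ (A-sym P.Avw)) (A⊆ (A-sym R.Awu)) (A⊆ (A-sym R.Avw)) (λ where refl → adj-irrefl (A⊆ t)) ≢)
    by : (∀ p → ∃ λ z → T (A u z) × z ≢ v × z ≢ p) ⊎ (∀ p → ∃ λ z → T (A v z) × z ≢ u × z ≢ p) → Empty
    by (inj₁ third) with third P.w
    ... | z , Auz , z≢v , z≢w = [ (λ eq → z≢w (cong tgt eq)) , (λ eq → z≢v (cong tgt eq)) ]′
      (two-cycle {dart u P.w (A⊆ (A-sym P.Awu))} {P.d₀} {dart u z (A⊆ Auz)} (A-sym P.Awu) t Auz refl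
        (trans (cong s (dart-≡ (sym P.src₂) (sym P.tgt₂))) tri)
        (trans (cong s (dart-≡ refl refl)) (dart-≡ R.src₁ (sym w≡))))
    by (inj₂ third) with third P.w
    ... | z , Avz , z≢u , z≢w = [ (λ eq → z≢u (cong tgt eq)) , (λ eq → z≢w (cong tgt eq)) ]′
      (two-cycle {R.d₀} {dart v P.w (A⊆ P.Avw)} {dart v z (A⊆ Avz)} t′ P.Avw Avz refl
        (trans (cong s (dart-≡ refl refl)) (dart-≡ P.src₁ refl))
        (trans (cong s (dart-≡ (trans w≡ (sym R.src₂)) (sym R.tgt₂))) tri′))

  #tri : ℕ
  #tri = ΣΣ λ u v → A u v · (tr u v · 1)

  ΣΣ-scale : ∀ k → ΣΣ (λ u v → A u v · k) ≡ #D A * k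
  ΣΣ-scale k = trans (sum-cong λ u → trans (sum-cong λ v → ·k (A u v)) (scale (λ v → A u v · 1))) (scale (λ u → sum λ v → A u v · 1))
    where
    scale : ∀ {l} (g : Fin l → ℕ) → sum (λ u → g u * k) ≡ sum g * k
    scale {zero}  g = refl
    scale {suc l} g = trans (cong (g zero * k +_) (scale (g ∘ suc))) (sym (*-distribʳ-+ k (g zero) (sum (g ∘ suc))))
    ·k : ∀ b → b · k ≡ (b · 1) * k
    ·k true  = sym (+-identityʳ k)
    ·k false = refl

  -- At most one dart of an edge carries the extra weight 2. It is spread evenly over the two darts,
  -- which gives 1 to each dart of an edge in a triangle.
  weight≤ : ΣΣ weight ≤ #D A * 2 + #tri
  weight≤ = begin
    ΣΣ weight                                             ≡⟨ ΣΣ-cong (λ u v → split (A u v) (tf u v)) ⟩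
    ΣΣ (λ u v → A u v · 2 + (p u v + p u v))              ≡⟨ ΣΣ-+ (λ u v → A u v · 2) (λ u v → p u v + p u v) ⟩
    ΣΣ (λ u v → A u v · 2) + ΣΣ (λ u v → p u v + p u v)   ≡⟨ cong₂ _+_ (ΣΣ-scale 2) mirror ⟩
    #D A * 2 + ΣΣ (λ u v → p u v + p v u)                 ≤⟨ +-monoʳ-≤ (#D A * 2) (ΣΣ-mono λ u v →
      bound (A u v) (A v u) (tf u v) (tf v u) (tr u v) A-sym tf-exclusive tf-tr (tr-sym v u ∘ tf-tr)) ⟩
    #D A * 2 + #tri                                       ∎
    where
    open ≤-Reasoning
    p : Fin n → Fin n → ℕ
    p u v = A u v · (tf u v · 1)
    split : ∀ b t → b · (2 + t · 2) ≡ b · 2 + (b · (t · 1) + b · (t · 1))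
    split true  true  = refl
    split true  false = refl
    split false t     = refl
    mirror : ΣΣ (λ u v → p u v + p u v) ≡ ΣΣ (λ u v → p u v + p v u)
    mirror = trans (ΣΣ-+ p p) (trans (cong (ΣΣ p +_) (sum-swap p)) (sym (ΣΣ-+ p (λ u v → p v u))))
    tr-sym : ∀ u v → T (tr u v) → T (tr v u)
    tr-sym u v t = by′ (tr? v u) (by (tr? u v) t)
      where
      by : ∀ {P : Set} (P? : Dec P) → T (does P?) → P
      by (yes p) _ = p
      by′ : (P? : Dec (∃ λ z → T (A v z) × T (A u z))) → (∃ λ z → T (A u z) × T (A v z)) → T (does P?)
      by′ (yes _) _             = tt
      by′ (no ¬p) (z , uz , vz) = contradiction (z , vz , uz) ¬p
    bound : ∀ b b′ t t′ r → (T b′ → T b) → (T t → T t′ → Empty) → (T t → T r) → (T t′ → T r) →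
            b · (t · 1) + b′ · (t′ · 1) ≤ b · (r · 1)
    bound true  true  true  true  r     _    ex _  _   = ⊥-elim (ex tt tt)
    bound true  b′    true  false true  _    _  _  _   = ≤-reflexive (cong suc (zero-at b′))
      where
      zero-at : ∀ b → b · 0 ≡ 0
      zero-at true  = refl
      zero-at false = refl
    bound true  false true  true  r     _    ex _  _   = ⊥-elim (ex tt tt)
    bound true  b′    true  t′    false _    _  tr _   = ⊥-elim (tr tt)
    bound true  true  false true  true  _    _  _  _   = ≤-refl
    bound true  true  false true  false _    _  _  tr′ = ⊥-elim (tr′ tt)
    bound true  true  false false r     _    _  _  _   = z≤n
    bound true  false false t′    r     _    _  _  _   = z≤n
    bound false true  t     t′    r     back _  _  _   = ⊥-elim (back tt)
    bound false false t     t′    r     _    _  _  _   = z≤n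

  -- The labelling `ψ`, constant on `h` and injective outside, respects the edges. So the vertices
  -- outside `h` have components of their own, apart from that of `v₀`.
  component-bound : ∀ v₀ → T (h v₀) → suc #out ≤ #C A
  component-bound v₀ hv₀ = subst₂ _≤_ total (trans (sum-const (#C A) 1) (*-identityʳ _)) (sum-mono per-class)
    where
    Co = proj₂ (componentLabels A)
    c : Fin n → Fin (#C A)
    c = cls Co
    ψ : Fin n → Maybe (Fin n)
    ψ x with T? (h x)
    ... | yes _ = nothing
    ... | no _  = just x
    ψ-in : ∀ {x} → T (h x) → ψ x ≡ nothing
    ψ-in {x} hx with T? (h x)
    ... | yes _  = refl
    ... | no ¬hx = contradiction hx ¬hx
    ψ-out : ∀ {x} → ¬ T (h x) → ψ x ≡ just x
    ψ-out {x} ¬hx with T? (h x)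
    ... | yes hx = contradiction hx ¬hx
    ... | no _   = refl
    ψ-cls : ∀ {x y} → c x ≡ c y → ψ x ≡ ψ y
    ψ-cls = universal Co ψ (edge-resp A ψ λ x y t → trans (ψ-in (A-h t)) (sym (ψ-in (A-h (A-sym t)))))
    term : Fin (#C A) → Fin n → ℕ
    term i x = not (h x) · ((c x == i) · 1)
    T-not : ∀ {b} → T (not b) → ¬ T b
    T-not {false} _ ()
    per-class : ∀ i → (c v₀ == i) · 1 + sum (term i) ≤ 1
    per-class i with any? (λ x → T? (not (h x)) ×-dec (c x ≟ i))
    ... | no none = ≤-trans (+-monoʳ-≤ _ (≤-reflexive (sum-0 (term i) zero-at))) (≤-trans (≤-reflexive (+-identityʳ _)) (at-most (c v₀ == i)))
      where
      at-most : ∀ b → b · 1 ≤ 1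
      at-most true  = ≤-refl
      at-most false = z≤n
      zero-at : ∀ x → term i x ≡ 0
      zero-at x = by (not (h x)) refl (c x ≟ i)
        where
        by : ∀ b → b ≡ not (h x) → (dec : Dec (c x ≡ i)) → b · (does dec · 1) ≡ 0
        by true  eq (yes p) = contradiction (x , subst T eq tt , p) none
        by true  eq (no _)  = refl
        by false eq _       = refl
    ... | yes (x , outx , refl) = ≤-trans (+-mono-≤ (≤-reflexive not-v₀) (sum-mono only-x)) (≤-reflexive (sum-δ x (λ _ → 1)))
      where
      ¬hx : ¬ T (h x)
      ¬hx = T-not outx
      not-v₀ : (c v₀ == c x) · 1 ≡ 0
      not-v₀ with c v₀ ≟ c x
      ... | no _   = refl
      ... | yes eq = contradiction (trans (sym (ψ-in hv₀)) (trans (ψ-cls eq) (ψ-out ¬hx))) λ ()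
      only-x : ∀ y → term (c x) y ≤ (y == x) · 1
      only-x y = by (not (h y)) refl (c y ≟ c x) (y ≟ x)
        where
        by : ∀ b → b ≡ not (h y) → (p : Dec (c y ≡ c x)) (q : Dec (y ≡ x)) → b · (does p · 1) ≤ does q · 1
        by false _  _       _       = z≤n
        by true  _  (no _)  _       = z≤n
        by true  _  (yes _) (yes _) = ≤-refl
        by true  eq (yes p) (no q)  = contradiction
          (just-injective (trans (sym (ψ-out (T-not (subst T eq tt)))) (trans (ψ-cls p) (ψ-out ¬hx)))) q
    total : sum (λ i → (c v₀ == i) · 1 + sum (term i)) ≡ suc #out
    total = trans (sum-+ (λ i → (c v₀ == i) · 1) (λ i → sum (term i))) (cong₂ _+_ (sum-classes (c v₀) 1)
      (trans (sum-swap term) (sum-cong λ x → trans (pull (not (h x)) (λ i → (c x == i) · 1)) (cong (not (h x) ·_) (sum-classes (c x) 1)))))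

  -- Six times Euler's inequality with the face bound inserted. A vertex outside `h` cancels: it
  -- contributes 24 as a component on one side, and 12 as a vertex and 12 as a face on the other.
  sparse : Euler A → ∀ v₀ → T (h v₀) → ΣΣ (λ u v → A u v · (3 + not (tr u v) · 1)) < 12 * sum (λ v → h v · 1)
  -- The component of `v₀` contributes 24 more; one unit makes the inequality strict and 23 are
  -- dropped.
  sparse euler v₀ hv₀ = ≤-trans (m≤n+m (suc W) 23) (+-cancelʳ-≤ #tri _ _ (+-cancelʳ-≤ (24 * #out + 2 * #D A) _ _ (begin
    23 + suc W + #tri + (24 * #out + 2 * #D A)              ≡⟨ e₁ W #tri #out (#D A) ⟩
    (W + #tri) + 2 * #D A + 24 * suc #out                   ≡⟨ cong (λ k → k + 2 * #D A + 24 * suc #out) W+tri ⟩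
    #D A * 4 + 2 * #D A + 24 * suc #out                     ≤⟨ +-monoʳ-≤ (#D A * 4 + 2 * #D A) (*-monoʳ-≤ 24 (component-bound v₀ hv₀)) ⟩
    #D A * 4 + 2 * #D A + 24 * #C A                         ≡⟨ e₂ (#D A) (#C A) ⟩
    6 * (#D A + 4 * #C A)                                   ≤⟨ *-monoʳ-≤ 6 euler ⟩
    6 * (2 * n + 2 * #F A)                                  ≡⟨ e₃ n (#F A) ⟩
    12 * n + #F A * 12                                      ≤⟨ +-mono-≤ (≤-reflexive (cong (12 *_) n≡)) (≤-trans face-bound (+-monoˡ-≤ (#out * 12) weight≤)) ⟩
    12 * (H + #out) + (#D A * 2 + #tri + #out * 12)         ≡⟨ e₄ H #out (#D A) #tri ⟩
    12 * H + #tri + (24 * #out + 2 * #D A)                  ∎)))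
    where
    open ≤-Reasoning
    W = ΣΣ (λ u v → A u v · (3 + not (tr u v) · 1))
    H = sum (λ v → h v · 1)
    e₁ : ∀ W t K D → 23 + suc W + t + (24 * K + 2 * D) ≡ (W + t) + 2 * D + 24 * suc K
    e₁ = solve-∀
    e₂ : ∀ D C → D * 4 + 2 * D + 24 * C ≡ 6 * (D + 4 * C)
    e₂ = solve-∀
    e₃ : ∀ n F → 6 * (2 * n + 2 * F) ≡ 12 * n + F * 12
    e₃ = solve-∀
    e₄ : ∀ H K D t → 12 * (H + K) + (D * 2 + t + K * 12) ≡ 12 * H + t + (24 * K + 2 * D)
    e₄ = solve-∀
    W+tri : W + #tri ≡ #D A * 4
    W+tri = trans (sym (ΣΣ-+ (λ u v → A u v · (3 + not (tr u v) · 1)) (λ u v → A u v · (tr u v · 1))))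
      (trans (ΣΣ-cong λ u v → four (A u v) (tr u v)) (ΣΣ-scale 4))
      where
      four : ∀ b t → b · (3 + not t · 1) + b · (t · 1) ≡ b · 4
      four true  true  = refl
      four true  false = refl
      four false t     = refl
    n≡ : n ≡ H + #out
    n≡ = trans (sym (trans (sum-const n 1) (*-identityʳ n))) (trans (sum-cong λ v → one-of (h v)) (sum-+ (λ v → h v · 1) (λ v → not (h v) · 1)))
      where
      one-of : ∀ b → 1 ≡ b · 1 + not b · 1
      one-of true  = refl
      one-of false = refl

-- Euler's inequality for a planar graph and its subgraphs.

module FromPlanar {n : ℕ} (G : Graph (Fin n)) (planar : Planar G) where
  open Graph G using (adj; adj-sym; adj-irrefl; _~_)
  open Planar planar
  open Rotation rotation using (faceStep)
  open Embedded G rotation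
  open Labels
  open Dart

  preimage : ∀ {S : Setoid 0ℓ 0ℓ} {k} (b : HasClasses S k) → Fin k → Setoid.Carrier S
  preimage b i = proj₁ (Bijection.surjective b i)

  to-preimage : ∀ {S : Setoid 0ℓ 0ℓ} {k} (b : HasClasses S k) i → Bijection.to b (preimage b i) ≡ i
  to-preimage {S} b i = proj₂ (Bijection.surjective b i) (Setoid.refl S)

  vertices≤n : #vertices ≤ n
  vertices≤n = injective⇒≤ {f = preimage vertices} λ {i} {j} eq →
    trans (sym (to-preimage vertices i)) (trans (cong (Bijection.to vertices) eq) (to-preimage vertices j))

  components≥ : #C adj ≤ #components
  components≥ = injective⇒≤ {f = λ i → Bijection.to components (pre Co i)} λ {i} {j} eq →
    trans (sym (cls-pre Co i)) (trans (Closure.gfold isEquivalence (cls Co)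
      (λ {x} {y} → resp-edge adj (cls Co) (ident Co) x y) (Bijection.injective components eq)) (cls-pre Co j))
    where
    Co = proj₂ (componentLabels adj)

  -- A labelling that respects the face list and reaches every orbit and every isolated vertex, so
  -- that `count≤` bounds their number by `#F`.
  ψ : X → Fin (#orbits + #isolated)
  ψ (u , v) with T? (adj u v)
  ... | yes e = Bijection.to orbits (dart u v e) ↑ˡ #isolated
  ... | no _ with any? (λ w → T? (adj u w))
  ...   | yes (w , e) = Bijection.to orbits (dart u w e) ↑ˡ #isolated
  ...   | no none     = #orbits ↑ʳ Bijection.to isolated (u , λ w e → none (w , e))

  ψ-dart : ∀ d → ψ (pair d) ≡ Bijection.to orbits d ↑ˡ #isolated
  ψ-dart d with T? (adj (src d) (tgt d))
  ... | yes e = cong (λ d → Bijection.to orbits d ↑ˡ #isolated) (dart-≡ refl refl)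
  ... | no ¬e = contradiction (edge d) ¬e

  ψ-isolated : ∀ u (none : Isolated G u) → ψ (u , u) ≡ #orbits ↑ʳ Bijection.to isolated (u , none)
  ψ-isolated u none with T? (adj u u)
  ... | yes e = contradiction e (none u)
  ... | no _ with any? (λ w → T? (adj u w))
  ...   | yes (w , e) = contradiction e (none w)
  ...   | no _        = cong (#orbits ↑ʳ_) (Bijection.cong isolated refl)

  ψ-glue : ∀ u v → ¬ u ~ v → ψ (u , v) ≡ ψ (glue adj u)
  ψ-glue u v ¬e with T? (adj u v)
  ... | yes e = contradiction e ¬e
  ... | no _ with any? (λ w → T? (adj u w))
  ...   | yes (w , e) = sym (ψ-dart (dart u w e))
  ...   | no none     = sym (ψ-isolated u λ w e → none (w , e))

  ψ-step : ∀ d → ψ (pair d) ≡ ψ (pair (φ adj d))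
  ψ-step d = begin
    ψ (pair d)                                          ≡⟨ ψ-dart d ⟩
    Bijection.to orbits d ↑ˡ #isolated                  ≡⟨ cong (_↑ˡ #isolated) (Bijection.cong orbits (Closure.return refl)) ⟩
    Bijection.to orbits (faceStep d) ↑ˡ #isolated       ≡⟨ cong (λ d → Bijection.to orbits d ↑ˡ #isolated) (cong ρ (α-on adj d (edge d))) ⟨
    Bijection.to orbits (φ adj d) ↑ˡ #isolated          ≡⟨ ψ-dart (φ adj d) ⟨
    ψ (pair (φ adj d))                                  ∎
    where open ≡-Reasoning

  faces≥ : #orbits + #isolated ≤ #F adj
  faces≥ = count≤ (proj₂ (faceLabels adj)) ψ (face-resp adj ψ ψ-step ψ-glue) surj
    where
    surj : ∀ j → ∃ λ x → ψ x ≡ j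
    surj j with splitAt #orbits j in eq
    ... | inj₁ i = pair (preimage orbits i) ,
          trans (ψ-dart (preimage orbits i)) (trans (cong (_↑ˡ #isolated) (to-preimage orbits i)) (splitAt⁻¹-↑ˡ eq))
    ... | inj₂ i = (u , u) , trans (ψ-isolated u none) (trans (cong (#orbits ↑ʳ_) (to-preimage isolated i)) (splitAt⁻¹-↑ʳ eq))
      where
      u = proj₁ (preimage isolated i)
      none = proj₂ (preimage isolated i)

  SameEdge : D → D → Set
  SameEdge d d′ = d ≡ d′ ⊎ rev d ≡ d′

  -- Reversal is an involution, so the generated equivalence relates a dart only to itself and to
  -- its reverse.
  sameEdge : IsEquivalence SameEdge
  sameEdge = record
    { refl  = inj₁ refl
    ; sym   = λ where
        (inj₁ refl) → inj₁ refl
        (inj₂ refl) → inj₂ (rev-rev _)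
    ; trans = λ where
        (inj₁ refl) q           → q
        (inj₂ p)    (inj₁ refl) → inj₂ p
        (inj₂ refl) (inj₂ q)    → inj₁ (trans (sym (rev-rev _)) q)
    }

  same-class : ∀ {d d′} → Bijection.to edges d ≡ Bijection.to edges d′ → SameEdge d d′
  same-class eq = Closure.fold sameEdge inj₂ (Bijection.injective edges eq)

  -- Each edge has only two darts.
  edges≥ : #D adj ≤ #edges * 2
  edges≥ = begin
    #D adj                                             ≡⟨ sum-cong (λ u → sum-cong λ v → all-classes u v (T? (adj u v))) ⟩
    sum (λ u → sum λ v → sum λ i → member i u v)       ≡⟨ sum-cong (λ u → sum-swap (λ v i → member i u v)) ⟩
    sum (λ u → sum λ i → sum λ v → member i u v)       ≡⟨ sum-swap (λ u i → sum (member i u)) ⟩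
    sum (λ i → sum λ u → sum λ v → member i u v)       ≤⟨ sum-mono per-class ⟩
    sum {#edges} (λ _ → 2)                             ≡⟨ sum-const #edges 2 ⟩
    #edges * 2                                         ∎
    where
    open ≤-Reasoning
    Member : Fin #edges → Fin n → Fin n → Set
    Member i u v = Σ (u ~ v) λ e → Bijection.to edges (dart u v e) ≡ i
    member? : ∀ i u v → Dec (Member i u v)
    member? i u v = by (T? (adj u v))
      where
      by : Dec (u ~ v) → Dec (Member i u v)
      by (no ¬e) = no (¬e ∘ proj₁)
      by (yes e) with Bijection.to edges (dart u v e) ≟ i
      ... | yes eq = yes (e , eq)
      ... | no ≢i  = no λ (e′ , eq) → ≢i (trans (cong (Bijection.to edges) (dart-≡ refl refl)) eq)
    member : Fin #edges → Fin n → Fin n → ℕ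
    member i u v = does (member? i u v) · 1
    all-classes : ∀ u v → Dec (u ~ v) → adj u v · 1 ≡ sum λ i → member i u v
    all-classes u v (no ¬e) = trans (cong (_· 1) (¬T⇒≡false ¬e)) (sym (sum-0 (λ i → member i u v) λ i → none (member? i u v)))
      where
      none : ∀ {i} (p : Dec (Member i u v)) → does p · 1 ≡ 0
      none (yes (e , _)) = contradiction e ¬e
      none (no _)        = refl
    all-classes u v (yes e) = trans (cong (_· 1) (T⇒≡true e)) (sym (trans (sum-cong λ i → exactly i (member? i u v) (i ≟ c)) (sum-δ c (λ _ → 1))))
      where
      c = Bijection.to edges (dart u v e)
      exactly : ∀ i (p : Dec (Member i u v)) (q : Dec (i ≡ c)) → does p · 1 ≡ does q · 1
      exactly i (yes _)        (yes _)  = refl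
      exactly i (no _)         (no _)   = refl
      exactly i (yes (e′ , p)) (no ≢c)  = contradiction (trans (sym p) (cong (Bijection.to edges) (dart-≡ refl refl))) ≢c
      exactly i (no ¬p)        (yes refl) = contradiction (e , refl) ¬p
    per-class : ∀ i → sum (λ u → sum λ v → member i u v) ≤ 2
    per-class i with preimage edges i | to-preimage edges i
    ... | dart p q e | eq = begin
      sum (λ u → sum λ v → member i u v)                                    ≤⟨ sum-mono (λ u → sum-mono λ v → bound u v (member? i u v)) ⟩
      sum (λ u → sum λ v → (u == p) · ((v == q) · 1) + (u == q) · ((v == p) · 1))
        ≡⟨ trans (sum-cong λ u → sum-+ (λ v → (u == p) · ((v == q) · 1)) _) (sum-+ (λ u → sum λ v → (u == p) · ((v == q) · 1)) _) ⟩
      sum (λ u → sum λ v → (u == p) · ((v == q) · 1)) + sum (λ u → sum λ v → (u == q) · ((v == p) · 1))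
        ≡⟨ cong₂ _+_ (spike p q) (spike q p) ⟩
      2 ∎
      where
      pull : ∀ b (k : Fin n → ℕ) → sum (λ y → b · k y) ≡ b · sum k
      pull true  k = refl
      pull false k = sum-0 {n} (λ _ → 0) (λ _ → refl)
      spike : ∀ p q → sum (λ u → sum (λ v → (u == p) · ((v == q) · 1))) ≡ 1
      spike p q = trans (sum-cong λ u → trans (pull (u == p) (λ v → (v == q) · 1)) (cong ((u == p) ·_) (sum-δ q (λ _ → 1)))) (sum-δ p (λ _ → 1))
      bound : ∀ u v (d : Dec (Member i u v)) → does d · 1 ≤ (u == p) · ((v == q) · 1) + (u == q) · ((v == p) · 1)
      bound u v (no _) = z≤n
      bound u v (yes (e′ , eq′)) with same-class {dart p q e} {dart u v e′} (trans eq (sym eq′))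
      ... | inj₁ refl rewrite ==-refl p | ==-refl q = s≤s z≤n
      ... | inj₂ refl rewrite ==-refl p | ==-refl q = m≤n+m 1 _

  euler-adj : Euler adj
  euler-adj = begin
    #D adj + 4 * #C adj                          ≤⟨ +-mono-≤ edges≥ (*-monoʳ-≤ 4 components≥) ⟩
    #edges * 2 + 4 * #components                 ≡⟨ e₁ #edges #components ⟩
    2 * (#edges + 2 * #components)               ≡⟨ cong (2 *_) euler ⟨
    2 * (#vertices + (#orbits + #isolated))      ≤⟨ *-monoʳ-≤ 2 (+-mono-≤ vertices≤n faces≥) ⟩
    2 * (n + #F adj)                             ≡⟨ *-distribˡ-+ 2 n (#F adj) ⟩
    2 * n + 2 * #F adj                           ∎
    where
    open ≤-Reasoning
    e₁ : ∀ E C → E * 2 + 4 * C ≡ 2 * (E + 2 * C)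
    e₁ = solve-∀

  -- Deleting edges one at a time leads to any given subgraph.
  restrict : ∀ (B : Fin n → Fin n → Bool) → (∀ {x y} → T (B x y) → T (B y x)) → ∀ k (A : Fin n → Fin n → Bool) → #D A ≤ k →
             (∀ {x y} → T (A x y) → T (A y x)) → (∀ {x y} → T (A x y) → x ~ y) → (∀ {x y} → T (B x y) → T (A x y)) → Euler A →
             ∃ λ A′ → (∀ {x y} → T (A′ x y) → T (B x y)) × (∀ {x y} → T (B x y) → T (A′ x y)) × Euler A′
  restrict B B-sym k A D≤k A-sym A⊆ B⊆A euler with any? (λ u → any? λ v → T? (A u v) ×-dec ¬? (T? (B u v)))
  ... | no none = A , (λ {x} {y} t → sure x y t (T? (B x y))) , B⊆A , euler
    where
    sure : ∀ x y → T (A x y) → Dec (T (B x y)) → T (B x y)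
    sure x y t (yes b) = b
    sure x y t (no ¬b) = contradiction (x , y , t , ¬b) none
  -- The bound `k` on the number of darts decreases with each deletion; at zero there is no edge
  -- left to delete.
  restrict B B-sym zero A D≤k A-sym A⊆ B⊆A euler | yes (u , v , Auv , ¬Buv) =
    contradiction (≤-trans (≤-trans (m≤n+m 2 _) (≤-reflexive (sym (Deletion.D≡ A A-sym A⊆ u v Auv)))) D≤k) λ ()
  restrict B B-sym (suc k) A D≤k A-sym A⊆ B⊆A euler | yes (u , v , Auv , ¬Buv) =
    restrict B B-sym k A′ (≤-pred (≤-trans (≤-trans (≤-trans (≤-reflexive (+-comm 1 _)) (+-monoʳ-≤ (#D A′) (s≤s z≤n))) (≤-reflexive (sym D≡))) D≤k))
      A′-sym (A⊆ ∘ A′⊆A) (λ {x} {y} b → A-A′ (B⊆A b) λ c → keep {x} {y} b (cut-yes {x} {y} c)) (delete euler)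
    where
    open Deletion A A-sym A⊆ u v Auv
    keep : ∀ {x y} → T (B x y) → ¬ ((x ≡ u × y ≡ v) ⊎ (x ≡ v × y ≡ u))
    keep b (inj₁ (refl , refl)) = ¬Buv b
    keep b (inj₂ (refl , refl)) = ¬Buv (B-sym b)

-- Translation between cycles, degrees and colourings.

module ShortCycles {V : Set} (G : Graph V) where
  open Graph G

  ≢-edge : ∀ {u v} → u ~ v → u ≢ v
  ≢-edge u~u refl = adj-irrefl u~u

  cycle₄ : ¬ Cycle G 4 →
           ∀ {p q r s} → p ~ q → q ~ r → r ~ s → s ~ p → p ≢ r → q ≢ s → Empty
  cycle₄ none {p} {q} {r} {s} pq qr rs sp p≢r q≢s = none record
    { 3≤ℓ       = s≤s (s≤s (s≤s z≤n))
    ; vertex    = lookup (p ∷ q ∷ r ∷ s ∷ [])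
    ; injective = Uniqueᵛ.lookup-injective
        ((≢-edge pq ∷ p≢r ∷ ≢-edge sp ∘ sym ∷ []) ∷ (≢-edge qr ∷ q≢s ∷ []) ∷ (≢-edge rs ∷ []) ∷ [] ∷ []) _ _
    ; adjacent  = λ where
        zero                   → pq
        (suc zero)             → qr
        (suc (suc zero))       → rs
        (suc (suc (suc zero))) → sp
    }

  cycle₅ : ¬ Cycle G 5 →
           ∀ {p q r s t} → p ~ q → q ~ r → r ~ s → s ~ t → t ~ p → p ≢ r → p ≢ s → q ≢ s → q ≢ t → r ≢ t → Empty
  cycle₅ none {p} {q} {r} {s} {t} pq qr rs st tp p≢r p≢s q≢s q≢t r≢t = none record
    { 3≤ℓ       = s≤s (s≤s (s≤s z≤n))
    ; vertex    = lookup (p ∷ q ∷ r ∷ s ∷ t ∷ [])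
    ; injective = Uniqueᵛ.lookup-injective
        ((≢-edge pq ∷ p≢r ∷ p≢s ∷ ≢-edge tp ∘ sym ∷ []) ∷ (≢-edge qr ∷ q≢s ∷ q≢t ∷ []) ∷
         (≢-edge rs ∷ r≢t ∷ []) ∷ (≢-edge st ∷ []) ∷ [] ∷ []) _ _
    ; adjacent  = λ where
        zero                         → pq
        (suc zero)                   → qr
        (suc (suc zero))             → rs
        (suc (suc (suc zero)))       → st
        (suc (suc (suc (suc zero)))) → tp
    }

toℕ-next : ∀ {m} (i : Fin (suc m)) → toℕ (next i) ≡ suc (toℕ i) % suc m
toℕ-next i = toℕ-fromℕ< _

-- Length at least 3 makes the two neighbours on a cycle distinct, as a core of minimum degree two
-- demands.
previous : ∀ {ℓ} → 3 ≤ ℓ → (i : Fin ℓ) → ∃ λ j → next j ≡ i × j ≢ next i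
previous {suc (suc (suc m))} (s≤s (s≤s (s≤s z≤n))) zero = fromℕ (2 + m) , toℕ-injective next-last , last≢next
  where
  next-last : toℕ (next (fromℕ (2 + m))) ≡ 0
  next-last = trans (toℕ-next (fromℕ (2 + m))) (trans (cong (λ k → suc k % (3 + m)) (toℕ-fromℕ (2 + m))) (n%n≡0 (3 + m)))
  last≢next : fromℕ (2 + m) ≢ next {3 + m} zero
  last≢next eq with trans (sym (toℕ-fromℕ (2 + m))) (cong toℕ eq)
  ... | ()
previous {suc (suc (suc m))} (s≤s (s≤s (s≤s z≤n))) (suc i) = inject₁ i , toℕ-injective next-i , i≢next
  where
  next-i : toℕ (next (inject₁ i)) ≡ suc (toℕ i)
  next-i = trans (toℕ-next (inject₁ i)) (trans (cong (λ k → suc k % (3 + m)) (toℕ-inject₁ i)) (m<n⇒m%n≡m (s≤s (toℕ<n i))))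
  i≢next : inject₁ i ≢ next (suc i)
  i≢next eq = by (m≤n⇒m<n∨m≡n (s≤s (toℕ<n i)))
    where
    eq′ : toℕ i ≡ suc (suc (toℕ i)) % (3 + m)
    eq′ = trans (sym (toℕ-inject₁ i)) (trans (cong toℕ eq) (toℕ-next (suc i)))
    by : suc (suc (toℕ i)) < 3 + m ⊎ suc (suc (toℕ i)) ≡ 3 + m → Empty
    by (inj₁ lt) = <⇒≢ (m≤n+m _ 1) (trans eq′ (m<n⇒m%n≡m lt))
    by (inj₂ eq″) with trans (sym (cong (λ k → k ∸ 2) eq″)) (trans eq′ (trans (cong (_% (3 + m)) eq″) (n%n≡0 (3 + m))))
    ... | ()

rank : ∀ {n} (b : Fin n → Bool) → ∃ (T ∘ b) → Fin (sum λ i → b i · 1)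
rank b (zero , t) with b zero
... | true = zero
rank b (suc i , t) = (b zero · 1) ↑ʳ rank (b ∘ suc) (i , t)

rank-injective : ∀ {n} (b : Fin n → Bool) x y → rank b x ≡ rank b y → proj₁ x ≡ proj₁ y
rank-injective b (zero , _)  (zero , _)   _  = refl
rank-injective b (zero , t)  (suc j , t′) eq with b zero
rank-injective b (zero , t)  (suc j , t′) () | true
rank-injective b (suc i , t) (zero , t′)  eq with b zero
rank-injective b (suc i , t) (zero , t′)  () | true
rank-injective b (suc i , t) (suc j , t′) eq = cong suc (rank-injective (b ∘ suc) (i , t) (j , t′) (↑ʳ-injective (b zero · 1) _ _ eq))

rank-surjective : ∀ {n} (b : Fin n → Bool) j → ∃ λ x → rank b x ≡ j
rank-surjective {suc n} b j with splitAt (b zero · 1) j in eq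
... | inj₁ i = (zero , inhabited i) , trans (at-zero i (inhabited i)) (splitAt⁻¹-↑ˡ eq)
  where
  inhabited : ∀ {c} → Fin (c · 1) → T c
  inhabited {true} _ = tt
  at-zero : ∀ (i : Fin (b zero · 1)) t → rank b (zero , t) ≡ i ↑ˡ sum (λ k → b (suc k) · 1)
  at-zero i t with b zero
  at-zero zero t | true = refl
... | inj₂ i = let (k , t) , eq′ = rank-surjective (b ∘ suc) i in
  (suc k , t) , trans (cong ((b zero · 1) ↑ʳ_) eq′) (splitAt⁻¹-↑ʳ eq)

module ColourClass {n : ℕ} (G : Graph (Fin n)) (g : C45Free n) (a≡adj : ∀ u v → C45Free.a g u v ≡ Graph.adj G u v) where
  open Graph G
  open Colouring g using (Colouring; Valid; dg; dg≤; acyc)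

  -- The vertices of a monochromatic cycle form a set in which each has two distinct neighbours.
  class-forest : ∀ {κ c S} → Valid κ → (∀ {v} → v ∈ S → κ v ≡ just c) → Forest (induced G S)
  class-forest {κ} {c} {S} val mono ℓ C = acyc val c OnCycle (λ where _ (i , refl) → mono (proj₂ (vertex i))) core
    (proj₁ (vertex start)) (start , refl)
    where
    open Cycle C
    OnCycle : Fin n → Set
    OnCycle u = ∃ λ i → u ≡ proj₁ (vertex i)
    start : Fin ℓ
    start = fromℕ< (≤-trans (s≤s z≤n) 3≤ℓ)
    vertex-≢ : ∀ {i j} → i ≢ j → proj₁ (vertex i) ≢ proj₁ (vertex j)
    vertex-≢ i≢j eq = i≢j (injective (pair-≡ eq))
      where
      pair-≡ : ∀ {x y : ∃ (_∈ S)} → proj₁ x ≡ proj₁ y → x ≡ y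
      pair-≡ {u , p} {.u , q} refl = cong (u ,_) ([]=-irrelevant p q)
    edge : ∀ {u v} → u ~ v → T (C45Free.a g u v)
    edge {u} {v} = subst T (sym (a≡adj u v))
    core : ∀ u → OnCycle u → ∃₂ λ w w′ → w ≢ w′ × OnCycle w × OnCycle w′ × T (C45Free.a g u w) × T (C45Free.a g u w′)
    core u (i , refl) with previous 3≤ℓ i
    ... | j , refl , j≢ = proj₁ (vertex j) , proj₁ (vertex (next i)) , vertex-≢ j≢ , (j , refl) , (next i , refl) ,
      edge (adj-sym (adjacent j)) , edge (adjacent i)

  class-degree : ∀ {κ c S} → Valid κ → (∀ {v} → v ∈ S → κ v ≡ just c) → MaxDegree≤ (cap c) (induced G S)
  class-degree {κ} {c} {S} val mono (v , v∈S) = sum (λ w → b w · 1) , mk⤖ {to = λ x → rank b (inside x)} (inj , surj) ,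
    ≤-trans (sum-mono count) (dg≤ val v c (mono v∈S))
    where
    b : Fin n → Bool
    b w = adj v w ∧ ⌊ w ∈? S ⌋
    Nb : Set
    Nb = Graph.Neighbour (induced G S) (v , v∈S)
    inside : Nb → ∃ (T ∘ b)
    inside ((w , w∈S) , e) = w , ∧-intro {adj v w} e (fromWitness w∈S)
    outside : ∃ (T ∘ b) → Nb
    outside (w , t) = (w , toWitness (proj₂ (∧-elim {adj v w} t))) , proj₁ (∧-elim {adj v w} t)
    Nb-≡ : ∀ {x y : Nb} → proj₁ (proj₁ x) ≡ proj₁ (proj₁ y) → x ≡ y
    Nb-≡ {(w , p) , e} {(.w , p′) , e′} refl = cong₂ (λ p e → (w , p) , e) ([]=-irrelevant p p′) (T-irrelevant e e′)
    inj : ∀ {x y} → rank b (inside x) ≡ rank b (inside y) → x ≡ y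
    inj eq = Nb-≡ (rank-injective b _ _ eq)
    surj : ∀ j → ∃ λ x → ∀ {z} → z ≡ x → rank b (inside z) ≡ j
    surj j with rank-surjective b j
    ... | (w , t) , eq = outside (w , t) , λ where refl → trans (cong (λ t → rank b (w , t)) (T-irrelevant _ t)) eq
    count : ∀ w → b w · 1 ≤ C45Free.a g v w · is c (κ w)
    count w rewrite a≡adj v w with adj v w | w ∈? S
    ... | false | _       = z≤n
    ... | true  | no _    = z≤n
    ... | true  | yes w∈S rewrite mono w∈S = ≤-reflexive (sym (is-just c))

all-or : ∀ {ℓ} {A : Set ℓ} {n} {P : Fin n → Set} → (∀ i → A ⊎ P i) → A ⊎ (∀ i → P i)
all-or {n = zero}  f = inj₂ λ ()
all-or {n = suc n} f with f zero | all-or (f ∘ suc)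
... | inj₁ a | _      = inj₁ a
... | inj₂ _ | inj₁ a = inj₁ a
... | inj₂ p | inj₂ q = inj₂ λ where
  zero    → p
  (suc i) → q i

not-does : ∀ {P : Set} (P? : Dec P) → T (not (does P?)) → ¬ P
not-does (no ¬p) _ = ¬p

does-not : ∀ {P : Set} (P? : Dec P) → ¬ P → T (not (does P?))
does-not (yes p) ¬p = ¬p p
does-not (no _)  _  = tt

-- The induction on vertex sets.

module Induction {n : ℕ} (G : Graph (Fin n)) (planar : Planar G) (no₄ : ¬ Cycle G 4) (no₅ : ¬ Cycle G 5) where
  open Graph G using (adj; adj-sym; adj-irrefl)
  open Planar planar using (rotation)

  whole : C45Free n
  whole = record
    { a = adj ; ~-sym = adj-sym ; ~-irr = adj-irrefl
    ; noC4 = ShortCycles.cycle₄ G no₄ ; noC5 = ShortCycles.cycle₅ G no₅ }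

  Sub : Set
  Sub = Fin n → Bool

  size : Sub → ℕ
  size S = sum λ v → S v · 1

  Colourable : Sub → Set₁
  Colourable S = Σ (Fin n → Maybe Col) λ κ → Colouring.Valid whole κ × (∀ u → T (S u) → ∃ λ c → κ u ≡ just c)

  _↾_ : (Fin n → Maybe Col) → Sub → Fin n → Maybe Col
  (κ ↾ S) u = if S u then κ u else nothing

  ↾-just : ∀ κ S {u c} → (κ ↾ S) u ≡ just c → T (S u) × κ u ≡ just c
  ↾-just κ S {u} eq with S u
  ... | true = tt , eq

  ↾-on : ∀ κ S {u} → T (S u) → (κ ↾ S) u ≡ κ u
  ↾-on κ S {u} t rewrite T⇒≡true t = refl

  ↾-off : ∀ κ S {u} → ¬ T (S u) → (κ ↾ S) u ≡ nothing
  ↾-off κ S {u} ¬t rewrite ¬T⇒≡false ¬t = refl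

  a∣ : Sub → Fin n → Fin n → Bool
  a∣ S u v = S u ∧ (S v ∧ adj u v)

  ∣-intro : ∀ S {u v} → T (S u) → T (S v) → T (adj u v) → T (a∣ S u v)
  ∣-intro S {u} {v} Su Sv uv = ∧-intro {S u} Su (∧-intro {S v} Sv uv)

  ∣-elim : ∀ S u v → T (a∣ S u v) → T (S u) × T (S v) × T (adj u v)
  ∣-elim S u v t = let Su , t′ = ∧-elim {S u} t in Su , ∧-elim {S v} t′

  ∣-adj : ∀ S {u v} → T (a∣ S u v) → T (adj u v)
  ∣-adj S {u} {v} t = proj₂ (proj₂ (∣-elim S u v t))

  ∣-sym : ∀ S {u v} → T (a∣ S u v) → T (a∣ S v u)
  ∣-sym S {u} {v} t = let Su , Sv , uv = ∣-elim S u v t in ∣-intro S {v} {u} Sv Su (adj-sym uv)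

  -- The induced subgraph is kept on the full vertex type with the remaining vertices isolated, so
  -- the type does not change in the induction.
  part : Sub → C45Free n
  part S = record
    { a     = a∣ S
    ; ~-sym = λ {u} {v} → ∣-sym S {u} {v}
    ; ~-irr = λ {v} t → adj-irrefl (∣-adj S {v} {v} t)
    ; noC4  = λ {p} {q} {r} {s} pq qr rs sp → C45Free.noC4 whole {p} {q} {r} {s}
        (∣-adj S {p} {q} pq) (∣-adj S {q} {r} qr) (∣-adj S {r} {s} rs) (∣-adj S {s} {p} sp)
    ; noC5  = λ {p} {q} {r} {s} {t} pq qr rs st tp → C45Free.noC5 whole {p} {q} {r} {s} {t}
        (∣-adj S {p} {q} pq) (∣-adj S {q} {r} qr) (∣-adj S {r} {s} rs) (∣-adj S {s} {t} st) (∣-adj S {t} {p} tp)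
    }

  valid-part : ∀ S {κ} → Colouring.Valid whole κ → Colouring.Valid (part S) κ
  valid-part S {κ} val = record
    { dg≤  = λ v c κv → ≤-trans (sum-mono λ w → bound (S v) (S w) (adj v w)) (Colouring.Valid.dg≤ val v c κv)
    ; acyc = λ c P mono core → Colouring.Valid.acyc val c P mono λ v Pv →
        let w , w′ , w≢w′ , Pw , Pw′ , v~w , v~w′ = core v Pv
        in w , w′ , w≢w′ , Pw , Pw′ , ∣-adj S {v} {w} v~w , ∣-adj S {v} {w′} v~w′
    }
    where
    bound : ∀ b c d {k} → (b ∧ (c ∧ d)) · k ≤ d · k
    bound true  true  d = ≤-refl
    bound true  false d = z≤n
    bound false c     d = z≤n

  valid-whole : ∀ S {κ} → Colouring.Valid (part S) κ → Colouring.Valid whole (κ ↾ S)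
  valid-whole S {κ} val = record
    { dg≤  = λ v c κv → let Sv , κv′ = ↾-just κ S {v} κv in
        ≤-trans (sum-mono λ w → bound v w c Sv (is-cases c ((κ ↾ S) w))) (Colouring.Valid.dg≤ val v c κv′)
    ; acyc = λ c P mono core → Colouring.Valid.acyc val c P (λ v Pv → proj₂ (↾-just κ S {v} (mono v Pv))) λ v Pv →
        let w , w′ , w≢w′ , Pw , Pw′ , v~w , v~w′ = core v Pv
            in-S : ∀ u → P u → T (S u)
            in-S u Pu = proj₁ (↾-just κ S {u} (mono u Pu))
        in w , w′ , w≢w′ , Pw , Pw′ , ∣-intro S {v} {w} (in-S v Pv) (in-S w Pw) v~w , ∣-intro S {v} {w′} (in-S v Pv) (in-S w′ Pw′) v~w′
    }
    where
    bound : ∀ v w c → T (S v) → ((κ ↾ S) w ≡ just c × is c ((κ ↾ S) w) ≡ 1) ⊎ ((κ ↾ S) w ≢ just c × is c ((κ ↾ S) w) ≡ 0) →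
            adj v w · is c ((κ ↾ S) w) ≤ a∣ S v w · is c (κ w)
    bound v w c Sv (inj₂ (_ , ≡0)) rewrite ≡0 | ·-0 (adj v w) = z≤n
    bound v w c Sv (inj₁ (κw , _)) =
      let Sw , _ = ↾-just κ S {w} κw in
      ≤-reflexive (cong₂ _·_ (T-≡ (∣-intro S {v} {w} Sv Sw) (∣-adj S {v} {w})) (cong (is c) (↾-on κ S {w} Sw)))

  module Step (S : Sub) (smaller : ∀ S′ → size S′ < size S → Colourable S′) where
    g : C45Free n
    g = part S

    S-~ : ∀ {u v : Fin n} → C45Free._~_ g u v → T (S u)
    S-~ {u} {v} t = proj₁ (∣-elim S u v t)

    colour-rest : ∀ x → T (S x) → (R : Fin n → Set) → (∀ u → Dec (R u)) → R x →
      Σ (Fin n → Maybe Col) λ κ → Colouring.Valid g κ × (∀ u → R u → κ u ≡ nothing) ×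
        (∀ u → T (S u) → ¬ R u → ∃ λ c → κ u ≡ just c)
    colour-rest x Sx R R? Rx with smaller S′ S′<S
      where
      S′ : Sub
      S′ u = S u ∧ not (does (R? u))
      S′<S : size S′ < size S
      S′<S = begin
        suc (size S′)                                ≡⟨ +-comm 1 (size S′) ⟩
        size S′ + 1                                  ≡⟨ cong (size S′ +_) (sum-δ x (λ _ → 1)) ⟨
        size S′ + sum (λ v → (v == x) · 1)           ≡⟨ sum-+ (λ v → S′ v · 1) _ ⟨
        sum (λ v → S′ v · 1 + (v == x) · 1)          ≤⟨ sum-mono bound ⟩
        size S                                       ∎
        where
        open ≤-Reasoning
        bound : ∀ v → S′ v · 1 + (v == x) · 1 ≤ S v · 1
        bound v with v ≟ x
        bound v | yes refl with R? v
        ... | yes _ rewrite T⇒≡true Sx = ≤-refl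
        ... | no ¬R = contradiction Rx ¬R
        bound v | no _ with S v | R? v
        ... | true  | yes _ = z≤n
        ... | true  | no _  = ≤-refl
        ... | false | _     = z≤n
    ... | κ , val , col = κ ↾ S′ , valid-part S (Colouring.shrink whole val λ v c eq → proj₂ (↾-just κ S′ {v} eq)) ,
      (λ u Ru → ↾-off κ S′ {u} λ t → not-does (R? u) (proj₂ (∧-elim {S u} t)) Ru) ,
      λ u Su ¬Ru → let t = ∧-intro {S u} Su (does-not (R? u) ¬Ru) ; c , eq = col u t in c , trans (↾-on κ S′ {u} t) eq
      where
      S′ : Sub
      S′ u = S u ∧ not (does (R? u))

    open Degrees.BadReducible g (T ∘ S) S-~ colour-rest using (Goal; bad⇒goal)

    finish : Goal → Colourable S
    finish (κ , val , col) = κ ↾ S , valid-whole S val , λ u Su → let c , eq = col u Su in c , trans (↾-on κ S {u} Su) eq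

    module Discharge (good : ∀ {v : Fin n} → T (S v) → ¬ Degrees.Bad g v) where
      open AllCharges g (T ∘ S) S-~ colour-rest good hiding (Goal)

      kept : Sub
      kept w = not (does (Q? w))

      ¬Q⇒kept : ∀ {w} → ¬ Q w → T (kept w)
      ¬Q⇒kept {w} = does-not (Q? w)

      kept⇒¬Q : ∀ {w} → T (kept w) → ¬ Q w
      kept⇒¬Q {w} = not-does (Q? w)

      h : Sub
      h v = S v ∧ kept v

      h-elim : ∀ v → T (h v) → T (S v) × T (kept v)
      h-elim v = ∧-elim {S v}

      B : Fin n → Fin n → Bool
      B x y = h x ∧ (h y ∧ adj x y)

      B-elim : ∀ x y → T (B x y) → T (h x) × T (h y) × T (adj x y)
      B-elim = ∣-elim h

      ~⇒B : ∀ {x y} → T (kept x) → T (kept y) → x ~ y → T (B x y)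
      ~⇒B {x} {y} kx ky xy = let Sx , Sy , e = ∣-elim S x y xy in
        ∣-intro h {x} {y} (∧-intro {S x} Sx kx) (∧-intro {S y} Sy ky) e

      B⇒~ : ∀ {x y} → T (B x y) → x ~ y
      B⇒~ {x} {y} t = let hx , hy , e = B-elim x y t in ∣-intro S {x} {y} (proj₁ (h-elim x hx)) (proj₁ (h-elim y hy)) e

      keptDeg : Fin n → ℕ
      keptDeg v = sumₐ v λ w → kept w · 1

      -- Every block has a vertex that is kept: a triangular 2-vertex has killers as neighbours, and
      -- these are never left out.
      m≤keptDeg : ∀ v → m v ≤ keptDeg v
      m≤keptDeg v = begin
        m v                                        ≡⟨ trans (∑ᴸ-const 1 (blocks v)) (*-identityʳ (m v)) ⟨
        ∑ᴸ (λ _ → 1) (blocks v)                    ≤⟨ ∑ᴸ-≤ (λ _ → 1) (weigh λ w → kept w · 1) (All.map (λ {C} → 1≤ C) (blocks-valid v)) ⟩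
        ∑ᴸ (weigh λ w → kept w · 1) (blocks v)     ≡⟨ sum-blocks v (λ w → kept w · 1) ⟩
        keptDeg v                                  ∎
        where
        open ≤-Reasoning
        one≤ : ∀ {w} → ¬ Q w → 1 ≤ kept w · 1
        one≤ {w} ¬Qw = ≤-reflexive (cong (_· 1) (sym (T⇒≡true (¬Q⇒kept {w} ¬Qw))))
        base⇒ : ∀ b {k l} → suc l ≤ b · k → 1 ≤ b · 1
        base⇒ true _ = ≤-refl
        1≤ : ∀ C → IsBlock v C → 1 ≤ weigh (λ w → kept w · 1) C
        1≤ (one w)   isB           = base⇒ (kept w) (single-base isB)
        1≤ (two w z) (_ , _ , w~z) = by (Q? w)
          where
          by : Dec (Q w) → 1 ≤ kept w · 1 + kept z · 1
          by (yes Qw) = ≤-trans (one≤ (killer⇒¬Q (two-killers (proj₁ Qw) w~z))) (m≤n+m _ _)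
          by (no ¬Qw) = ≤-trans (one≤ ¬Qw) (m≤m+n _ _)

      keptDeg-cases : ∀ {v} → T (S v) → ¬ Q v → 3 ≤ keptDeg v ⊎ (deg v ≡ 2 × 2 ≤ keptDeg v)
      keptDeg-cases {v} Sv ¬Qv with killer? v
      ... | yes K = inj₁ (≤-trans (<⇒≤ (killer⇒4≤m K)) (m≤keptDeg v))
      ... | no ¬K = by (m≤n⇒m<n∨m≡n 2≤deg)
        where
        2≤deg : 2 ≤ deg v
        2≤deg = ≰⇒> λ deg≤1 → good Sv (inj₁ deg≤1)
        deg≤ : deg v ≤ keptDeg v
        deg≤ = sumₐ-mono v λ w v~w → ≤-reflexive (cong (_· 1) (sym (T⇒≡true (¬Q⇒kept {w} λ (deg≡2 , _) →
          ¬K (two-killers deg≡2 (~-sym {v} {w} v~w))))))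
        by : 2 < deg v ⊎ 2 ≡ deg v → 3 ≤ keptDeg v ⊎ (deg v ≡ 2 × 2 ≤ keptDeg v)
        by (inj₁ 3≤deg) = inj₁ (≤-trans 3≤deg deg≤)
        by (inj₂ 2≡deg) = inj₂ (sym 2≡deg , ≤-trans 2≤deg deg≤)

      2≤keptDeg : ∀ {v} → T (S v) → ¬ Q v → 2 ≤ keptDeg v
      2≤keptDeg Sv ¬Qv with keptDeg-cases Sv ¬Qv
      ... | inj₁ 3≤      = <⇒≤ 3≤
      ... | inj₂ (_ , 2≤) = 2≤

      B-two : ∀ x → T (h x) → ∀ p → ∃ λ y → T (B x y) × y ≢ p
      B-two x hx p with another-in {x} kept (p ∷ []) (2≤keptDeg (proj₁ (h-elim x hx)) (kept⇒¬Q {x} (proj₂ (h-elim x hx))))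
      ... | y , x~y , ky , y≢p ∷ [] = y , ~⇒B {x} {y} (proj₂ (h-elim x hx)) ky x~y , y≢p

      Third : Fin n → Fin n → Set
      Third x y = ∀ p → ∃ λ z → T (B x z) × z ≢ y × z ≢ p

      third : ∀ {x} y → T (h x) → 3 ≤ keptDeg x → Third x y
      third {x} y hx 3≤ p with another-in {x} kept (y ∷ p ∷ []) 3≤
      ... | z , x~z , kz , z≢y ∷ z≢p ∷ [] = z , ~⇒B {x} {z} (proj₂ (h-elim x hx)) kz x~z , z≢y , z≢p

      -- If `x` has degree 2, then `y` is a killer, and its four or more blocks each leave it a
      -- neighbour.
      B-three : ∀ {x y} → T (B x y) → Third x y ⊎ Third y x
      B-three {x} {y} t = by (keptDeg-cases (proj₁ (h-elim x hx)) (kept⇒¬Q {x} (proj₂ (h-elim x hx))))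
        where
        hx = proj₁ (B-elim x y t)
        hy = proj₁ (proj₂ (B-elim x y t))
        by : 3 ≤ keptDeg x ⊎ (deg x ≡ 2 × 2 ≤ keptDeg x) → Third x y ⊎ Third y x
        by (inj₁ 3≤)          = inj₁ (third y hx 3≤)
        by (inj₂ (deg≡2 , _)) = inj₂ (third x hy (≤-trans (<⇒≤ (killer⇒4≤m (two-killers deg≡2 (B⇒~ {x} {y} t)))) (m≤keptDeg y)))

      Charged : Fin n → Set
      Charged v = T (S v) → ¬ Q v → 12 + Out v ≤ In v + Rec v

      charge-all : Goal ⊎ (∀ v → Charged v)
      charge-all = all-or λ v → by v (T? (S v)) (Q? v)
        where
        by : ∀ v → Dec (T (S v)) → Dec (Q v) → Goal ⊎ Charged v
        by v (no ¬Sv) _        = inj₂ λ Sv → contradiction Sv ¬Sv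
        by v (yes _)  (yes Qv) = inj₂ λ _ ¬Qv → contradiction Qv ¬Qv
        by v (yes Sv) (no ¬Qv) with charge Sv ¬Qv
        ... | inj₁ goal = inj₁ goal
        ... | inj₂ le   = inj₂ λ _ _ → le

      -- Only killers pay, and these are never left out.
      Out-kept : ∀ w → Out w ≤ h w · Out w
      Out-kept w = by (T? (h w))
        where
        by : Dec (T (h w)) → Out w ≤ h w · Out w
        by (yes hw) = ≤-reflexive (cong (_· Out w) (sym (T⇒≡true hw)))
        by (no ¬hw) = ≤-trans (sumₐ-mono w {pay w} {λ _ → 0} λ v w~v → no-pay v w~v) (≤-trans (≤-reflexive (sum-0 _ λ v → ·-0 (a w v))) z≤n)
          where
          no-killer : ∀ {v} → w ~ v → ¬ Killer w
          no-killer {v} w~v K = ¬hw (∧-intro {S w} (S-~ {w} {v} w~v) (¬Q⇒kept {w} (killer⇒¬Q K)))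
          no-pay : ∀ v → w ~ v → pay w v ≤ 0
          no-pay v w~v = let soft = no-killer {v} w~v in pay≤ {w} {v}
            (≤-reflexive (pay₀-0 {w} {v} (soft ∘ proj₂ ∘ proj₂) (soft ∘ proj₁ ∘ proj₂ ∘ proj₂))) (soft ∘ inj₁ ∘ proj₁)

      ΣRec≤ΣOut : sum (λ v → h v · Rec v) ≤ sum (λ v → h v · Out v)
      ΣRec≤ΣOut = begin
        sum (λ v → h v · Rec v)                     ≤⟨ sum-mono (λ v → drop (h v)) ⟩
        sum (λ v → sum λ w → a v w · pay w v)       ≡⟨ sum-swap (λ v w → a v w · pay w v) ⟩
        sum (λ w → sum λ v → a v w · pay w v)       ≡⟨ sum-cong (λ w → sum-cong λ v → cong (_· pay w v) (T-≡ (~-sym {v} {w}) (~-sym {w} {v}))) ⟩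
        sum (λ w → Out w)                           ≤⟨ sum-mono Out-kept ⟩
        sum (λ w → h w · Out w)                     ∎
        where
        open ≤-Reasoning
        drop : ∀ b {k} → b · k ≤ k
        drop true  = ≤-refl
        drop false = z≤n

      module Count (A : Fin n → Fin n → Bool) (A⇒B : ∀ {x y} → T (A x y) → T (B x y)) (B⇒A : ∀ {x y} → T (B x y) → T (A x y)) where

        A-sym : ∀ {x y} → T (A x y) → T (A y x)
        A-sym {x} {y} t = B⇒A {y} {x} (∣-sym h {x} {y} (A⇒B {x} {y} t))

        A-two : ∀ x → T (h x) → ∀ p → ∃ λ y → T (A x y) × y ≢ p
        A-two x hx p = let y , t , y≢p = B-two x hx p in y , B⇒A {x} {y} t , y≢p

        A-third : ∀ {x y} → Third x y → ∀ p → ∃ λ z → T (A x z) × z ≢ y × z ≢ p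
        A-third {x} f p = let z , t , ≢ = f p in z , B⇒A {x} {z} t , ≢

        A-three : ∀ {x y} → T (A x y) → (∀ p → ∃ λ z → T (A x z) × z ≢ y × z ≢ p) ⊎ (∀ p → ∃ λ z → T (A y z) × z ≢ x × z ≢ p)
        A-three {x} {y} t with B-three {x} {y} (A⇒B {x} {y} t)
        ... | inj₁ f = inj₁ (A-third {x} {y} f)
        ... | inj₂ f = inj₂ (A-third {y} {x} f)

        open FaceCount G rotation (C45Free.noC4 whole) (C45Free.noC5 whole) A (λ {x} {y} → A-sym {x} {y}) (λ {x} {y} t → ∣-adj h {x} {y} (A⇒B {x} {y} t))
          h (λ {x} {y} t → proj₁ (B-elim x y (A⇒B {x} {y} t))) A-two (λ {x} {y} → A-three {x} {y}) using (sparse; ΣΣ) renaming (tr? to trA?; tr to trA) public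

        weight : Fin n → Fin n → ℕ
        weight u v = A u v · (3 + not (trA u v) · 1)

        -- A triangle of the remaining graph has a third vertex that is kept, so wherever `weight`
        -- is reduced to 3, `base` is as well.
        In≤ : ∀ v → h v · In v ≤ sum (weight v)
        In≤ v = ≤-trans (≤-reflexive (scale (h v))) (sum-mono λ w → by w (T? (h v)) (T? (a v w)) (Q? w))
          where
          scale : ∀ b → b · In v ≡ sum λ w → b · (a v w · base v w)
          scale true  = refl
          scale false = sym (sum-0 {n} (λ _ → 0) λ _ → refl)
          base-Q : ∀ {x w} → Q w → base x w ≡ 0
          base-Q {x} {w} Qw with Q? w
          ... | yes _  = refl
          ... | no ¬Qw = contradiction Qw ¬Qw
          by : ∀ w → Dec (T (h v)) → Dec (v ~ w) → Dec (Q w) → h v · (a v w · base v w) ≤ weight v w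
          by w (no ¬hv) _ _ rewrite ¬T⇒≡false ¬hv = z≤n
          by w (yes _) (no ¬vw) _ rewrite ¬T⇒≡false ¬vw | ·-0 (h v) = z≤n
          by w (yes hv) (yes vw) (no ¬Qw) = subst₂ _≤_ (sym (trans (cong (_· (a v w · base v w)) (T⇒≡true hv)) (cong (_· base v w) (T⇒≡true vw))))
            (sym (cong (_· (3 + not (trA v w) · 1)) (T⇒≡true (B⇒A {v} {w} (~⇒B {v} {w} (proj₂ (h-elim v hv)) (¬Q⇒kept {w} ¬Qw) vw)))))
            (≤-trans (does-not-≤ (Q? w)) (+-monoʳ-≤ 3 (flip (onKept? v w) (trA? v w) λ (z , vz , wz) →
              z , B⇒~ {v} {z} (A⇒B {v} {z} vz) , B⇒~ {w} {z} (A⇒B {w} {z} wz) ,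
              kept⇒¬Q {z} (proj₂ (h-elim z (proj₁ (proj₂ (B-elim v z (A⇒B {v} {z} vz)))))))))
            where
            does-not-≤ : ∀ {P : Set} (P? : Dec P) {k} → not (does P?) · k ≤ k
            does-not-≤ (yes _) = z≤n
            does-not-≤ (no _)  = ≤-refl
            flip : ∀ {P R : Set} (P? : Dec P) (R? : Dec R) → (R → P) → not (does P?) · 1 ≤ not (does R?) · 1
            flip (yes _) _       _ = z≤n
            flip (no ¬p) (yes r) f = contradiction (f r) ¬p
            flip (no _)  (no _)  _ = ≤-refl
          by w (yes _) (yes _) (yes Qw) rewrite base-Q {v} Qw | ·-0 (a v w) | ·-0 (h v) = z≤n

        -- The payments cancel in the sum: every payer belongs to the remaining graph, so the total
        -- received there is at most the total paid there.
        overcharged : (∀ v → Charged v) → 12 * sum (λ v → h v · 1) ≤ ΣΣ weight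
        overcharged all = +-cancelʳ-≤ (sum λ v → h v · Out v) _ _ (begin
          12 * sum (λ v → h v · 1) + sum (λ v → h v · Out v)     ≡⟨ cong (_+ sum (λ v → h v · Out v)) (sum-12 (λ v → h v · 1)) ⟩
          sum (λ v → 12 * (h v · 1)) + sum (λ v → h v · Out v)   ≡⟨ sum-+ (λ v → 12 * (h v · 1)) _ ⟨
          sum (λ v → 12 * (h v · 1) + h v · Out v)               ≤⟨ sum-mono (λ v → local v (T? (h v))) ⟩
          sum (λ v → h v · In v + h v · Rec v)                   ≡⟨ sum-+ (λ v → h v · In v) _ ⟩
          sum (λ v → h v · In v) + sum (λ v → h v · Rec v)       ≤⟨ +-mono-≤ (sum-mono In≤) ΣRec≤ΣOut ⟩
          ΣΣ weight + sum (λ v → h v · Out v)                    ∎)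
          where
          open ≤-Reasoning
          sum-12 : ∀ {l} (f : Fin l → ℕ) → 12 * sum f ≡ sum λ v → 12 * f v
          sum-12 {zero}  f = refl
          sum-12 {suc l} f = trans (*-distribˡ-+ 12 (f zero) _) (cong (12 * f zero +_) (sum-12 (f ∘ suc)))
          local : ∀ v → Dec (T (h v)) → 12 * (h v · 1) + h v · Out v ≤ h v · In v + h v · Rec v
          local v (no ¬hv) rewrite ¬T⇒≡false ¬hv = z≤n
          local v (yes hv) = subst (λ b → 12 * (b · 1) + b · Out v ≤ b · In v + b · Rec v) (sym (T⇒≡true hv))
            (all v (proj₁ (h-elim v hv)) (kept⇒¬Q {v} (proj₂ (h-elim v hv))))

      colourable : Colourable S
      colourable with any? (λ v → T? (h v)) | charge-all
      ... | _ | inj₁ goal = finish goal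
      ... | yes (v , hv) | inj₂ all with FromPlanar.restrict G planar B (λ {x} {y} → ∣-sym h {x} {y}) _ adj ≤-refl adj-sym id
                                           (λ {x} {y} → ∣-adj h {x} {y}) (FromPlanar.euler-adj G planar)
      ...   | A , A⇒B , B⇒A , euler = contradiction (Count.overcharged A (λ {x} {y} → A⇒B {x} {y}) (λ {x} {y} → B⇒A {x} {y}) all)
              (<⇒≱ (Count.sparse A (λ {x} {y} → A⇒B {x} {y}) (λ {x} {y} → B⇒A {x} {y}) euler v hv))
      -- If nothing remains, `S` is empty: a triangular 2-vertex in `S` would have a killer beside
      -- it, which is kept.
      colourable | no none | inj₂ _ = (λ _ → nothing) , record { dg≤ = λ _ _ () ; acyc = λ c P mono _ v Pv → case mono v Pv of λ () } ,
        λ u Su → contradiction Su (empty u)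
        where
        empty : ∀ u → ¬ T (S u)
        empty u Su with Q? u
        ... | no ¬Qu = none (u , ∧-intro {S u} Su (¬Q⇒kept {u} ¬Qu))
        ... | yes (deg≡2 , w , u~w , _) = none (w , ∧-intro {S w} (S-~ {w} {u} (~-sym {u} {w} u~w)) (¬Q⇒kept {w} (killer⇒¬Q (two-killers deg≡2 u~w))))

    colourable : Colourable S
    colourable with any? (λ v → T? (S v) ×-dec Degrees.bad? g v)
    ... | yes (v , Sv , bad) = finish (bad⇒goal Sv bad)
    ... | no none            = Discharge.colourable λ {v} Sv bad → none (v , Sv , bad)

  all-colourable : ∀ k S → size S ≤ k → Colourable S
  all-colourable k S size≤k = Step.colourable S (smaller k size≤k)
    where
    smaller : ∀ k → size S ≤ k → ∀ S′ → size S′ < size S → Colourable S′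
    smaller zero    size≤ S′ lt = contradiction (≤-trans lt size≤) λ ()
    smaller (suc k) size≤ S′ lt = all-colourable k S′ (≤-pred (≤-trans lt size≤))

theorem1p2 : ∀ (n : ℕ) (G : Graph (Fin n)) → Planar G → ¬ Cycle G 4 → ¬ Cycle G 5 →
    ∃₂ λ (V₁ V₂ : Subset n) →
    (V₁ ∪ V₂ ≡ ⊤) × (V₁ ∩ V₂ ≡ ⊥) × 𝓕 3 (induced G V₁) × 𝓕 4 (induced G V₂)
theorem1p2 n G planar no₄ no₅ with Induction.all-colourable G planar no₄ no₅ _ (λ _ → true) ≤-refl
... | κ , val , col = V₁ , ∁ V₁ , ∪-inverseʳ V₁ , ∩-inverseʳ V₁ ,
  (class-forest val mono₁ , class-degree val mono₁) , (class-forest val mono₂ , class-degree val mono₂)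
  where
  open ColourClass G (Induction.whole G planar no₄ no₅) (λ _ _ → refl)
  V₁ : Subset n
  V₁ = tabulate λ v → does (just? (κ v) ○)
  mono₁ : ∀ {v} → v ∈ V₁ → κ v ≡ just ○
  mono₁ {v} v∈ with just? (κ v) ○ | trans (sym (lookup∘tabulate (λ v → does (just? (κ v) ○)) v)) ([]=⇒lookup v∈)
  ... | yes eq | _ = eq
  mono₂ : ∀ {v} → v ∈ ∁ V₁ → κ v ≡ just ●
  mono₂ {v} v∈ with col v tt
  ... | ● , eq = eq
  ... | ○ , eq = contradiction (lookup⇒[]= v V₁ (trans (lookup∘tabulate _ v) (white eq))) (x∈∁p⇒x∉p v∈)
    where
    white : κ v ≡ just ○ → does (just? (κ v) ○) ≡ true
    white eq with just? (κ v) ○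
    ... | yes _ = refl
    ... | no ≢○ = contradiction eq ≢○
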